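{- Let $H$ be a finite set of connected fully commutative permutations each of whose heaps contains at least two entries in each internal column, or let $H=\emptyset$. Suppose $$F(x)=\sum_{n\ge 0}\bigl|S_{n+1}^{\{[321]\}}(H)\bigr|\,x^n,\qquad L(x)=F(x)-xF(x)-1,\qquad M(x)=F(x)-2xF(x)+x^2F(x)-1 .$$ Then $$\sum_{n\ge 0}\bigl|S_{n+1}^{\{[3421],[4231],[4312],[4321]\}}(H)\bigr|\,x^n = F(x)+\frac{L(x)^2}{1-M(x)}$$ and $$\sum_{n\ge 0}\bigl|S_{n+1}^{\{[3421],[4312],[4321]\}}(H)\bigr|\,x^n = F(x)+\frac{L(x)^2}{1-x-M(x)} .$$
   Context: The symmetric group $S_n$ is generated by the adjacent transpositions $s_1,\dots,s_{n-1}$, with $s_i=(i\;\,i+1)$. Reduced expressions for $w$ are words in the $s_i$ of minimal length representing $w$; $\mathrm{supp}(w)$ is the set of generators occurring in any (equivalently every) reduced expression of $w$. A permutation $w\in S_n$ is connected if the subscripts of the generators in $\mathrm{supp}(w)$ form a nonempty interval in $\{1,\dots,n-1\}$. Two reduced expressions of $w$ lie in the same commutativity class if they differ by a sequence of moves $s_is_j\mapsto s_js_i$ with $|i-j|\ge 2$; $w$ is fully commutative if it has exactly one commutativity class. Heaps: for a reduced expression $\mathsf w=\mathsf w_1\cdots\mathsf w_k$, the heap of $\mathsf w$ is the poset on $\{1,\dots,k\}$ given by the transitive closure of: $a\prec b$ if $a<b$ and $\mathsf w_a$ does not commute with $\mathsf w_b$, with element $a$ labeled by $\mathsf w_a$.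 Up to labeled isomorphism it depends only on the commutativity class; a fully commutative permutation has a unique heap. Entries labeled $s_i$ form column $i$. If $w$ is fully commutative and connected with $\mathrm{supp}(w)=\{s_i,s_{i+1},\dots,s_j\}$, then columns $i+1,\dots,j-1$ are the internal columns of the heap of $w$ and columns $i$ and $j$ are its extremal columns. Heap containment: an orientation preserving Coxeter embedding $f:\{s_1,\dots,s_{k-1}\}\to\{s_1,\dots,s_{n-1}\}$ is an injective map such that for each $m\in\{2,3\}$, $(s_is_j)^m=1$ if and only if $(f(s_i)f(s_j))^m=1$, and such that the subscript of $f(s_i)$ is less than that of $f(s_j)$ whenever $i<j$; it is applied letterwise to words. A permutation $w\in S_n$ heap-contains $h\in S_k$ if there are commutativity classes of $w$ and $h$, represented by reduced expressions $\mathsf w$ and $\mathsf h$, and such an $f$ for which the heap of $f(\mathsf h)$ is contained as a convex labeled subposet of the heap of $\mathsf w$ (a subposet $Q$ of $P$ is convex if $x<y<z$ in $P$ with $x,z\in Q$ implies $y\in Q$). Otherwise $w$ heap-avoids $h$. For a set $P$ of permutations, $S_{n}^{P}(H)$ denotes the set of $w\in S_{n}$ that avoid every $p\in P$ as a classical (one-line) permutation pattern and that heap-avoid every $h\in H$. The constant term of $F(x)$ is defined to be $1$, corresponding to the empty heap.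
   Formalization: Each h in H is additionally required to have all generators of its symmetric group in its support and not to lie in S_3 (exactly two columns); without these the identities fail, e.g. for H = {s_2 in S_4} and H = {s_1s_2 in S_3}. -}

module Defs where

open import Data.Fin.Base as Fin using (Fin; zero; suc; toℕ; inject₁; punchIn; _≤_; _<_)
open import Data.Fin.Induction using (>-wellFounded)
open import Data.Fin.Patterns
open import Data.Fin.Permutation
open import Data.Fin.Properties using (_≟_; _<?_; all?; any?)
open import Data.Integer.Base as ℤ using (ℤ; +_; 0ℤ; 1ℤ)
import Data.Integer.Properties as ℤ
open import Data.List.Base using (List; []; _∷_; _++_; map; length; lookup; filter; foldr; concatMap; allFin; deduplicate)
open import Data.List.Membership.Propositional using (_∈_)
import Data.List.Membership.Propositional.Properties as ∈
open import Data.List.Properties using (map-cong)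
open import Data.List.Relation.Unary.All as All using (All)
open import Data.List.Relation.Unary.AllPairs using ([]; _∷_)
open import Data.List.Relation.Unary.Any as Any using (Any; here)
import Data.List.Relation.Unary.Any.Properties as Any
open import Data.List.Relation.Unary.Enumerates.Setoid using (IsEnumeration)
import Data.List.Relation.Unary.Enumerates.Setoid.Properties as Enumerates
import Data.List.Relation.Unary.Unique.DecSetoid.Properties as UniqueDec
import Data.List.Relation.Unary.Unique.Setoid as UniqueSetoid
open import Data.Nat.Base as ℕ using (ℕ; zero; suc; z≤n; s≤s; ∣_-_∣)
import Data.Nat.Properties as ℕ
open import Data.Product.Base using (Σ; Σ-syntax; ∃; ∃-syntax; ∃₂; _×_; _,_; proj₁; proj₂)
open import Data.Sum.Base using (_⊎_; inj₁; inj₂)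
open import Data.Vec.Base as Vec using (Vec; []; _∷_)
import Data.Vec.Functional as Vector
open import Function.Base using (_∘_)
open import Function.Bundles using (_⇔_; mk⇔; Equivalence; Inverse)
open import Function.Definitions using (Injective)
open import Level using (0ℓ)
open import Relation.Binary.Bundles using (Setoid; DecSetoid)
import Relation.Binary.Construct.On as On
open import Relation.Binary.Construct.Closure.Equivalence using (EqClosure)
open import Relation.Binary.Construct.Closure.Transitive using (TransClosure)
open import Relation.Binary.Core using (Rel)
open import Relation.Binary.Definitions using (Decidable)
open import Relation.Binary.PropositionalEquality
  using (_≡_; _≢_; _≗_; refl; sym; trans; cong; cong₂; subst; setoid; module ≡-Reasoning)
open import Relation.Nullary using (Dec; yes; no; ¬_; contradiction)
open import Relation.Nullary.Decidable
  using (True; toWitness; map′; ¬?; _×-dec_; _⊎-dec_; _→-dec_)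

------------------------------------------------------------------------
-- Words in the adjacent transpositions
--
-- The rank m symmetric group is S_{m+1} = Permutation′ (suc m), acting
-- on {0,…,m}.  Subscripts are shifted down by one: the letter i : Fin m
-- stands for s_{i+1}, the transposition of i and i+1.

s : ∀ {m} → Fin m → Permutation′ (suc m)
s i = transpose (inject₁ i) (suc i)

Word : ℕ → Set
Word m = List (Fin m)

-- π₁ ∘ₚ π₂ applies π₁ first, so ⟦ i ∷ 𝐰 ⟧ is the function product
-- s_i · ⟦ 𝐰 ⟧.
⟦_⟧ : ∀ {m} → Word m → Permutation′ (suc m)
⟦ 𝐰 ⟧ = foldr (λ i π → π ∘ₚ s i) id 𝐰

record ReducedFor {m} (w : Permutation′ (suc m)) (𝐰 : Word m) : Set where
  constructor reduced
  field
    represents : ⟦ 𝐰 ⟧ ≈ w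
    minimal    : ∀ 𝐯 → ⟦ 𝐯 ⟧ ≈ w → length 𝐰 ℕ.≤ length 𝐯

_∈supp_ : ∀ {m} → Fin m → Permutation′ (suc m) → Set
i ∈supp w = ∃[ 𝐰 ] ReducedFor w 𝐰 × i ∈ 𝐰

SupportIs[_,_] : ∀ {m} → Fin m → Fin m → Permutation′ (suc m) → Set
SupportIs[ lo , hi ] w = lo ≤ hi × (∀ i → i ∈supp w ⇔ (lo ≤ i × i ≤ hi))

Connected : ∀ {m} → Permutation′ (suc m) → Set
Connected w = ∃₂ λ lo hi → SupportIs[ lo , hi ] w

-- Required of the elements of H, together with rank ≠ 2, because the
-- generating function identities fail without them.  An h of rank k
-- that omits an extremal generator still forces its k columns to fit
-- inside the ambient symmetric group, so containment is not local: for
-- H = {s₂} in S₄ the coefficients of x³ in the first identity are 4 and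
-- 10.  A two-column h has no internal column, and can occur in a braid
-- s₁s₂s₁ glued from two avoiders: for H = {s₁s₂} in S₃ the coefficients
-- of x² are 4 and 5.
FullSupport : ∀ {m} → Permutation′ (suc m) → Set
FullSupport w = ∀ i → i ∈supp w

data CommutationMove {m} : Rel (Word m) 0ℓ where
  move : ∀ 𝐮 i j 𝐯 → 2 ℕ.≤ ∣ toℕ i - toℕ j ∣ →
         CommutationMove (𝐮 ++ i ∷ j ∷ 𝐯) (𝐮 ++ j ∷ i ∷ 𝐯)

FullyCommutative : ∀ {m} → Permutation′ (suc m) → Set
FullyCommutative w = ∀ 𝐮 𝐯 → ReducedFor w 𝐮 → ReducedFor w 𝐯 →
                     EqClosure CommutationMove 𝐮 𝐯

------------------------------------------------------------------------
-- Heaps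

Commute : ∀ {m} → Rel (Fin m) 0ℓ
Commute i j = s i ∘ₚ s j ≈ s j ∘ₚ s i

Generating : ∀ {m} (𝐰 : Word m) → Rel (Fin (length 𝐰)) 0ℓ
Generating 𝐰 a b = a < b × ¬ Commute (lookup 𝐰 a) (lookup 𝐰 b)

-- The strict order of the heap of 𝐰; the label of a is lookup 𝐰 a.
Heap : ∀ {m} (𝐰 : Word m) → Rel (Fin (length 𝐰)) 0ℓ
Heap 𝐰 = TransClosure (Generating 𝐰)

columnSize : ∀ {m} → Fin m → Word m → ℕ
columnSize i 𝐰 = length (filter (i ≟_) 𝐰)

InternalColumns≥2 : ∀ {m} → Permutation′ (suc m) → Set
InternalColumns≥2 w =
  ∀ {lo hi} → SupportIs[ lo , hi ] w →
  ∀ 𝐰 → ReducedFor w 𝐰 →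
  ∀ i → lo < i → i < hi → 2 ℕ.≤ columnSize i 𝐰

-- e identifies the heap of 𝐮, as a labeled poset, with a convex
-- subposet of the heap of 𝐰.
record IsConvexEmbedding {m} (𝐮 𝐰 : Word m)
                         (e : Fin (length 𝐮) → Fin (length 𝐰)) : Set where
  constructor convexEmbedding
  field
    injective : Injective _≡_ _≡_ e
    labels    : ∀ a → lookup 𝐰 (e a) ≡ lookup 𝐮 a
    order     : ∀ a b → Heap 𝐮 a b ⇔ Heap 𝐰 (e a) (e b)
    convex    : ∀ a b y → Heap 𝐰 (e a) y → Heap 𝐰 y (e b) → ∃[ c ] e c ≡ y

_^ₚ_ : ∀ {n} → Permutation′ n → ℕ → Permutation′ n
π ^ₚ zero  = id
π ^ₚ suc m = π ∘ₚ (π ^ₚ m)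

record IsCoxeterEmbedding {k m} (f : Fin k → Fin m) : Set where
  constructor coxeterEmbedding
  field
    injective   : Injective _≡_ _≡_ f
    relations   : ∀ q → q ≡ 2 ⊎ q ≡ 3 → ∀ i j →
                  ((s i ∘ₚ s j) ^ₚ q ≈ id) ⇔ ((s (f i) ∘ₚ s (f j)) ^ₚ q ≈ id)
    orientation : ∀ i j → i < j → f i < f j

HeapContains : ∀ {m k} → Permutation′ (suc m) → Permutation′ (suc k) → Set
HeapContains w h =
  ∃[ 𝐰 ] ReducedFor w 𝐰 × ∃[ 𝐡 ] ReducedFor h 𝐡 ×
  ∃[ f ] IsCoxeterEmbedding f × ∃ (IsConvexEmbedding (map f 𝐡) 𝐰)

------------------------------------------------------------------------
-- Classical patterns

ContainsPattern : ∀ {n k} → Permutation′ n → Permutation′ k → Set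
ContainsPattern {n} {k} w p =
  Σ[ e ∈ (Fin k → Fin n) ]
    (∀ a b → a < b → e a < e b) ×
    (∀ a b → p ⟨$⟩ʳ a < p ⟨$⟩ʳ b ⇔ w ⟨$⟩ʳ e a < w ⟨$⟩ʳ e b)

-- The permutation with one-line notation v, whose inverse has one-line
-- notation u.
oneLine : ∀ {n} (v u : Vec (Fin n) n) →
          {True (all? λ i → Vec.lookup v (Vec.lookup u i) ≟ i)} →
          {True (all? λ i → Vec.lookup u (Vec.lookup v i) ≟ i)} →
          Permutation′ n
oneLine v u {vu} {uv} =
  permutation (Vec.lookup v) (Vec.lookup u) (toWitness vu) (toWitness uv)

-- Values are also shifted down by one.
[321] : Permutation′ 3
[321] = oneLine (2F ∷ 1F ∷ 0F ∷ []) (2F ∷ 1F ∷ 0F ∷ [])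

[3421] [4231] [4312] [4321] : Permutation′ 4
[3421] = oneLine (2F ∷ 3F ∷ 1F ∷ 0F ∷ []) (3F ∷ 2F ∷ 0F ∷ 1F ∷ [])
[4231] = oneLine (3F ∷ 1F ∷ 2F ∷ 0F ∷ []) (3F ∷ 1F ∷ 2F ∷ 0F ∷ [])
[4312] = oneLine (3F ∷ 2F ∷ 0F ∷ 1F ∷ []) (2F ∷ 3F ∷ 1F ∷ 0F ∷ [])
[4321] = oneLine (3F ∷ 2F ∷ 1F ∷ 0F ∷ []) (3F ∷ 2F ∷ 1F ∷ 0F ∷ [])

-- Finite sets of permutations of varying sizes, listed.
Patterns HeapPatterns : Set
Patterns     = List (∃[ n ] Permutation′ n)
HeapPatterns = List (∃[ k ] Permutation′ (suc k))

Avoids : ∀ (P : Patterns) (H : HeapPatterns) {m} → Permutation′ (suc m) → Set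
Avoids P H w = All (λ (_ , p) → ¬ ContainsPattern w p) P ×
               All (λ (_ , h) → ¬ HeapContains w h) H

≈-decSetoid : ℕ → DecSetoid 0ℓ 0ℓ
≈-decSetoid n = record
  { Carrier = Permutation′ n
  ; _≈_     = _≈_
  ; isDecEquivalence = record
    { isEquivalence = record
      { refl  = λ _ → refl
      ; sym   = λ p i → sym (p i)
      ; trans = λ p q i → trans (p i) (q i)
      }
    ; _≟_ = λ π ρ → all? λ i → π ⟨$⟩ʳ i ≟ ρ ⟨$⟩ʳ i
    }
  }

Avoider : Patterns → HeapPatterns → ℕ → Set
Avoider P H m = Σ[ w ∈ Permutation′ (suc m) ] Avoids P H w

-- Permutation′ carries proofs, so elements are identified when they
-- agree as functions, not propositionally.  Index m gives
-- S_{m+1}^P(H).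
AvoiderSetoid : Patterns → HeapPatterns → ℕ → DecSetoid 0ℓ 0ℓ
AvoiderSetoid P H m = On.decSetoid (≈-decSetoid (suc m)) λ (a : Avoider P H m) → proj₁ a

Finite : Setoid 0ℓ 0ℓ → Set
Finite S = ∃[ n ] Inverse S (setoid (Fin n))

------------------------------------------------------------------------
-- AvoiderSetoid is finite: membership is decidable because reduced
-- expressions are no longer than any given expression.

module Finiteness where

  _⇔-dec_ : ∀ {A B : Set} → Dec A → Dec B → Dec (A ⇔ B)
  a? ⇔-dec b? = map′ (λ (f , g) → mk⇔ f g)
                     (λ e → Equivalence.to e , Equivalence.from e)
                     ((a? →-dec b?) ×-dec (b? →-dec a?))

  _≈?_ : ∀ {n} → Decidable (_≈_ {n} {n})
  _≈?_ {n} = DecSetoid._≟_ (≈-decSetoid n)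

  anyFunction? : ∀ k {n} {P : (Fin k → Fin n) → Set} →
                 (∀ {f g} → f ≗ g → P f → P g) →
                 (∀ f → Dec (P f)) → Dec (∃ P)
  anyFunction? zero resp P? =
    map′ (Vector.[] ,_) (λ (_ , p) → resp (λ ()) p) (P? Vector.[])
  anyFunction? (suc k) {P = P} resp P? =
    map′ (λ (x , f , p) → x Vector.∷ f , p)
         (λ (f , p) → f zero , f ∘ suc , resp (λ { zero → refl ; (suc _) → refl }) p)
         (any? λ x → anyFunction? k {P = λ f → P (x Vector.∷ f)}
           (λ f≗g → resp λ { zero → refl ; (suc i) → f≗g i })
           (λ f → P? (x Vector.∷ f)))

  anyWord? : ∀ {m} (n : ℕ) {P : Word m → Set} → (∀ 𝐰 → Dec (P 𝐰)) →
             Dec (∃[ 𝐰 ] length 𝐰 ℕ.≤ n × P 𝐰)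
  anyWord? zero P? =
    map′ (λ p → [] , z≤n , p) (λ { ([] , _ , p) → p }) (P? [])
  anyWord? (suc n) P? =
    map′ (λ { (inj₁ p) → [] , z≤n , p
            ; (inj₂ (i , 𝐰 , l , p)) → i ∷ 𝐰 , s≤s l , p })
         (λ { ([] , _ , p) → inj₁ p
            ; (i ∷ 𝐰 , s≤s l , p) → inj₂ (i , 𝐰 , l , p) })
         (P? [] ⊎-dec any? λ i → anyWord? n λ 𝐰 → P? (i ∷ 𝐰))

  containsPattern? : ∀ {n k} (w : Permutation′ n) (p : Permutation′ k) →
                     Dec (ContainsPattern w p)
  containsPattern? w p = anyFunction? _ resp λ e →
    (all? λ a → all? λ b → (a <? b) →-dec (e a <? e b)) ×-dec
    (all? λ a → all? λ b →
      ((p ⟨$⟩ʳ a) <? (p ⟨$⟩ʳ b)) ⇔-dec ((w ⟨$⟩ʳ e a) <? (w ⟨$⟩ʳ e b)))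
    where
    resp : ∀ {e e′} → e ≗ e′ → _ → _
    resp e≗e′ (mono , iso) =
      (λ a b a<b → subst-< (e≗e′ a) (e≗e′ b) (mono a b a<b)) ,
      (λ a b → mk⇔
        (subst-< (cong (w ⟨$⟩ʳ_) (e≗e′ a)) (cong (w ⟨$⟩ʳ_) (e≗e′ b)) ∘ Equivalence.to (iso a b))
        (Equivalence.from (iso a b) ∘
          subst-< (cong (w ⟨$⟩ʳ_) (sym (e≗e′ a))) (cong (w ⟨$⟩ʳ_) (sym (e≗e′ b)))))
      where
      subst-< : ∀ {n} {a a′ b b′ : Fin n} → a ≡ a′ → b ≡ b′ → a < b → a′ < b′
      subst-< refl refl a<b = a<b

  reducedFor? : ∀ {m} (w : Permutation′ (suc m)) (𝐰 : Word m) → Dec (ReducedFor w 𝐰)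
  reducedFor? w 𝐰 = map′ to from
    ((⟦ 𝐰 ⟧ ≈? w) ×-dec
     ¬? (anyWord? (length 𝐰) λ 𝐯 → (⟦ 𝐯 ⟧ ≈? w) ×-dec (length 𝐯 ℕ.<? length 𝐰)))
    where
    to : _ → ReducedFor w 𝐰
    to (rep , noShorter) = reduced rep λ 𝐯 rep′ → ℕ.≮⇒≥ λ shorter →
      noShorter (𝐯 , ℕ.<⇒≤ shorter , rep′ , shorter)
    from : ReducedFor w 𝐰 → _
    from (reduced rep min) = rep , λ (𝐯 , _ , rep′ , shorter) →
      ℕ.<⇒≱ shorter (min 𝐯 rep′)

  module _ {n} {_∼_ : Rel (Fin n) 0ℓ} (_∼?_ : Decidable _∼_)
           (∼⇒< : ∀ {a b} → a ∼ b → a < b) where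

    open import Induction.WellFounded using (Acc; acc)

    closure? : ∀ {a} → Acc Fin._>_ a → ∀ b → Dec (TransClosure _∼_ a b)
    closure? {a} (acc rec) b = map′
      (λ { (inj₁ a∼b) → TransClosure.[ a∼b ] ; (inj₂ (_ , a∼c , c∼⁺b)) → a∼c TransClosure.∷ c∼⁺b })
      (λ { TransClosure.[ a∼b ] → inj₁ a∼b ; (a∼c TransClosure.∷ c∼⁺b) → inj₂ (_ , a∼c , c∼⁺b) })
      ((a ∼? b) ⊎-dec any? step)
      where
      step : ∀ c → Dec (a ∼ c × TransClosure _∼_ c b)
      step c with a ∼? c
      ... | no  a≁c = no (a≁c ∘ proj₁)
      ... | yes a∼c = map′ (a∼c ,_) proj₂ (closure? (rec (∼⇒< a∼c)) b)

  heap? : ∀ {m} (𝐰 : Word m) → Decidable (Heap 𝐰)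
  heap? 𝐰 a b = closure?
    (λ a b → (a <? b) ×-dec ¬? ((s (lookup 𝐰 a) ∘ₚ s (lookup 𝐰 b)) ≈? (s (lookup 𝐰 b) ∘ₚ s (lookup 𝐰 a))))
    proj₁ (>-wellFounded a) b

  injective? : ∀ {m n} (f : Fin m → Fin n) → Dec (Injective _≡_ _≡_ f)
  injective? f = map′ (λ g → g _ _) (λ g _ _ → g)
    (all? λ a → all? λ b → (f a ≟ f b) →-dec (a ≟ b))

  injective-resp : ∀ {m n} {f g : Fin m → Fin n} → f ≗ g →
                   Injective _≡_ _≡_ f → Injective _≡_ _≡_ g
  injective-resp f≗g inj eq = inj (trans (f≗g _) (trans eq (sym (f≗g _))))

  anyConvexEmbedding? : ∀ {m} (𝐮 𝐰 : Word m) → Dec (∃ (IsConvexEmbedding 𝐮 𝐰))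
  anyConvexEmbedding? 𝐮 𝐰 = anyFunction? _ resp λ e → map′
    (λ (i , l , o , c) → convexEmbedding (λ {a} {b} → i {a} {b}) l o c)
    (λ (convexEmbedding i l o c) → (λ {a} {b} → i {a} {b}) , l , o , c)
    (injective? e ×-dec
     (all? λ a → lookup 𝐰 (e a) ≟ lookup 𝐮 a) ×-dec
     (all? λ a → all? λ b → heap? 𝐮 a b ⇔-dec heap? 𝐰 (e a) (e b)) ×-dec
     (all? λ a → all? λ b → all? λ y →
       heap? 𝐰 (e a) y →-dec (heap? 𝐰 y (e b) →-dec any? λ c → e c ≟ y)))
    where
    resp : ∀ {e e′} → e ≗ e′ → IsConvexEmbedding 𝐮 𝐰 e → IsConvexEmbedding 𝐮 𝐰 e′
    resp {e} {e′} eq (convexEmbedding i l o c) = convexEmbedding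
      (injective-resp eq i)
      (λ a → trans (cong (lookup 𝐰) (sym (eq a))) (l a))
      (λ a b → subst (λ x → _ ⇔ Heap 𝐰 x _) (eq a)
                 (subst (λ y → _ ⇔ Heap 𝐰 _ y) (eq b) (o a b)))
      (λ a b y p q → let (d , ed≡y) = c a b y (subst (λ x → Heap 𝐰 x y) (sym (eq a)) p)
                                              (subst (Heap 𝐰 y) (sym (eq b)) q)
                     in d , trans (sym (eq d)) ed≡y)

  Relations : ∀ {k m} → (Fin k → Fin m) → ℕ → Set
  Relations f q = ∀ i j →
    ((s i ∘ₚ s j) ^ₚ q ≈ id) ⇔ ((s (f i) ∘ₚ s (f j)) ^ₚ q ≈ id)

  coxeterEmbedding? : ∀ {k m} (f : Fin k → Fin m) → Dec (IsCoxeterEmbedding f)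
  coxeterEmbedding? f = map′
    (λ (i , r₂ , r₃ , o) → coxeterEmbedding (λ {a} {b} → i {a} {b})
      (λ { _ (inj₁ refl) → r₂ ; _ (inj₂ refl) → r₃ }) o)
    (λ (coxeterEmbedding i r o) → (λ {a} {b} → i {a} {b}) , r 2 (inj₁ refl) , r 3 (inj₂ refl) , o)
    (injective? f ×-dec relations? 2 ×-dec relations? 3 ×-dec
     (all? λ i → all? λ j → (i <? j) →-dec (f i <? f j)))
    where
    relations? : ∀ q → Dec (Relations f q)
    relations? q = all? λ i → all? λ j →
      (((s i ∘ₚ s j) ^ₚ q) ≈? id) ⇔-dec (((s (f i) ∘ₚ s (f j)) ^ₚ q) ≈? id)

  coxeterEmbedding-resp : ∀ {k m} {f g : Fin k → Fin m} → f ≗ g →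
                          IsCoxeterEmbedding f → IsCoxeterEmbedding g
  coxeterEmbedding-resp {f = f} {g} eq (coxeterEmbedding i r o) = coxeterEmbedding
    (injective-resp eq i)
    (λ q q∈ a b → subst (λ x → ((s a ∘ₚ s b) ^ₚ q ≈ id) ⇔ ((s x ∘ₚ s (g b)) ^ₚ q ≈ id)) (eq a)
                    (subst (λ y → ((s a ∘ₚ s b) ^ₚ q ≈ id) ⇔ ((s (f a) ∘ₚ s y) ^ₚ q ≈ id)) (eq b)
                      (r q q∈ a b)))
    (λ a b a<b → subst (_< _) (eq a) (subst (_ <_) (eq b) (o a b a<b)))

  anyReduced? : ∀ {m} (w : Permutation′ (suc m)) (𝐯 : Word m) → ⟦ 𝐯 ⟧ ≈ w →
                {P : Word m → Set} → (∀ 𝐰 → Dec (P 𝐰)) →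
                Dec (∃[ 𝐰 ] ReducedFor w 𝐰 × P 𝐰)
  anyReduced? w 𝐯 rep P? = map′
    (λ (𝐰 , _ , r , p) → 𝐰 , r , p)
    (λ (𝐰 , r , p) → 𝐰 , ReducedFor.minimal r 𝐯 rep , r , p)
    (anyWord? (length 𝐯) λ 𝐰 → reducedFor? w 𝐰 ×-dec P? 𝐰)

  ∘ₚ-cong : ∀ {n} {π π′ ρ ρ′ : Permutation′ n} → π ≈ π′ → ρ ≈ ρ′ → π ∘ₚ ρ ≈ π′ ∘ₚ ρ′
  ∘ₚ-cong {ρ = ρ} p q i = trans (cong (ρ ⟨$⟩ʳ_) (p i)) (q _)

  ⟦⟧-++ : ∀ {m} (𝐮 𝐯 : Word m) → ⟦ 𝐮 ++ 𝐯 ⟧ ≈ ⟦ 𝐯 ⟧ ∘ₚ ⟦ 𝐮 ⟧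
  ⟦⟧-++ []      𝐯 _ = refl
  ⟦⟧-++ (i ∷ 𝐮) 𝐯 x = cong (s i ⟨$⟩ʳ_) (⟦⟧-++ 𝐮 𝐯 x)

  ⟦⟧-lift₀ : ∀ {m} (𝐰 : Word m) → ⟦ map suc 𝐰 ⟧ ≈ lift₀ ⟦ 𝐰 ⟧
  ⟦⟧-lift₀ []      x = sym (lift₀-id x)
  ⟦⟧-lift₀ (i ∷ 𝐰) x = begin
    s (suc i) ⟨$⟩ʳ (⟦ map suc 𝐰 ⟧ ⟨$⟩ʳ x)  ≡⟨ cong (s (suc i) ⟨$⟩ʳ_) (⟦⟧-lift₀ 𝐰 x) ⟩
    s (suc i) ⟨$⟩ʳ (lift₀ ⟦ 𝐰 ⟧ ⟨$⟩ʳ x)    ≡⟨ lift₀-transpose (inject₁ i) (suc i) _ ⟩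
    lift₀ (s i) ⟨$⟩ʳ (lift₀ ⟦ 𝐰 ⟧ ⟨$⟩ʳ x)  ≡⟨ lift₀-comp ⟦ 𝐰 ⟧ (s i) x ⟩
    lift₀ (⟦ 𝐰 ⟧ ∘ₚ s i) ⟨$⟩ʳ x            ∎
    where open ≡-Reasoning

  cycle : ∀ {m} → Fin (suc m) → Word m
  cycle             zero    = []
  cycle {suc m} (suc j) = map suc (cycle j) ++ zero ∷ []

  cycle-zero : ∀ {m} (j : Fin (suc m)) → ⟦ cycle j ⟧ ⟨$⟩ʳ zero ≡ j
  cycle-zero             zero    = refl
  cycle-zero {suc m} (suc j) =
    trans (⟦⟧-++ (map suc (cycle j)) _ zero)
      (trans (⟦⟧-lift₀ (cycle j) 1F) (cong suc (cycle-zero j)))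

  cycle-suc : ∀ {m} (j : Fin (suc m)) x → ⟦ cycle j ⟧ ⟨$⟩ʳ suc x ≡ punchIn j x
  cycle-suc             zero    x       = refl
  cycle-suc {suc m} (suc j) zero    =
    trans (⟦⟧-++ (map suc (cycle j)) _ 1F) (⟦⟧-lift₀ (cycle j) zero)
  cycle-suc {suc m} (suc j) (suc x) =
    trans (⟦⟧-++ (map suc (cycle j)) _ (suc (suc x)))
      (trans (⟦⟧-lift₀ (cycle j) (suc (suc x))) (cong suc (cycle-suc j x)))

  word : ∀ {m} (w : Permutation′ (suc m)) → ∃[ 𝐰 ] ⟦ 𝐰 ⟧ ≈ w
  word {zero}  w = [] , λ { zero → unique (w ⟨$⟩ʳ zero) }
    where
    unique : (x : Fin 1) → zero ≡ x
    unique zero = refl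
  word {suc m} w = cycle (w ⟨$⟩ʳ zero) ++ map suc 𝐯 , rep
    where
    𝐯 = proj₁ (word (remove zero w))

    inner : ∀ x → ⟦ cycle (w ⟨$⟩ʳ zero) ⟧ ⟨$⟩ʳ (lift₀ ⟦ 𝐯 ⟧ ⟨$⟩ʳ x) ≡ w ⟨$⟩ʳ x
    inner zero    = cycle-zero (w ⟨$⟩ʳ zero)
    inner (suc x) =
      trans (cycle-suc (w ⟨$⟩ʳ zero) _)
        (trans (cong (punchIn (w ⟨$⟩ʳ zero)) (proj₂ (word (remove zero w)) x))
          (sym (punchIn-permute w zero x)))

    rep : ⟦ cycle (w ⟨$⟩ʳ zero) ++ map suc 𝐯 ⟧ ≈ w
    rep x =
      trans (⟦⟧-++ (cycle (w ⟨$⟩ʳ zero)) (map suc 𝐯) x)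
        (trans (cong (⟦ cycle (w ⟨$⟩ʳ zero) ⟧ ⟨$⟩ʳ_) (⟦⟧-lift₀ 𝐯 x)) (inner x))

  heapContains? : ∀ {m k} (w : Permutation′ (suc m)) (h : Permutation′ (suc k)) →
                  Dec (HeapContains w h)
  heapContains? w h =
    anyReduced? w (proj₁ (word w)) (proj₂ (word w)) λ 𝐰 →
    anyReduced? h (proj₁ (word h)) (proj₂ (word h)) λ 𝐡 →
    anyFunction? _
      (λ f≗g (cox , conv) → coxeterEmbedding-resp f≗g cox ,
        subst (λ 𝐮 → ∃ (IsConvexEmbedding 𝐮 𝐰)) (map-cong f≗g 𝐡) conv)
      (λ f → coxeterEmbedding? f ×-dec anyConvexEmbedding? (map f 𝐡) 𝐰)

  avoids? : ∀ P H {m} (w : Permutation′ (suc m)) → Dec (Avoids P H w)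
  avoids? P H w = All.all? (λ (_ , p) → ¬? (containsPattern? w p)) P ×-dec
                  All.all? (λ (_ , h) → ¬? (heapContains? w h)) H

  ContainsPattern-resp : ∀ {n k} {w w′ : Permutation′ n} {p : Permutation′ k} →
                         w ≈ w′ → ContainsPattern w p → ContainsPattern w′ p
  ContainsPattern-resp w≈w′ (e , mono , iso) = e , mono , λ a b →
    subst (λ x → _ ⇔ x < _) (w≈w′ (e a)) (subst (λ y → _ ⇔ _ < y) (w≈w′ (e b)) (iso a b))

  HeapContains-resp : ∀ {m k} {w w′ : Permutation′ (suc m)} {h : Permutation′ (suc k)} →
                      w ≈ w′ → HeapContains w h → HeapContains w′ h
  HeapContains-resp w≈w′ (𝐰 , reduced rep min , rest) =
    𝐰 , reduced (λ i → trans (rep i) (w≈w′ i))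
                (λ 𝐯 rep′ → min 𝐯 λ i → trans (rep′ i) (sym (w≈w′ i))) , rest

  Avoids-resp : ∀ P H {m} {w w′ : Permutation′ (suc m)} →
                w ≈ w′ → Avoids P H w → Avoids P H w′
  Avoids-resp P H {w = w} {w′} w≈w′ (p , h) =
    All.map (λ {(_ , q)} ¬c → ¬c ∘ ContainsPattern-resp {w = w′} {w} {q} (λ i → sym (w≈w′ i))) p ,
    All.map (λ {(_ , q)} ¬c → ¬c ∘ HeapContains-resp {w = w′} {w} {q} (λ i → sym (w≈w′ i))) h

  permutations : ∀ n → List (Permutation′ n)
  permutations zero    = id ∷ []
  permutations (suc n) =
    concatMap (λ π → map (λ j → insert zero j π) (allFin (suc n))) (permutations n)

  insert-cong : ∀ {n} {j} {π ρ : Permutation′ n} → π ≈ ρ →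
                insert zero j π ≈ insert zero j ρ
  insert-cong π≈ρ zero    = refl
  insert-cong {j = j} π≈ρ (suc i) = cong (punchIn j) (π≈ρ i)

  permutations-complete : ∀ n (w : Permutation′ n) → Any (w ≈_) (permutations n)
  permutations-complete zero    w = here λ ()
  permutations-complete (suc n) w =
    Any.concatMap⁺ _ (Any.map inner (permutations-complete n (remove zero w)))
    where
    inner : ∀ {π} → remove zero w ≈ π →
            Any (w ≈_) (map (λ j → insert zero j π) (allFin (suc n)))
    inner {π} eq = Any.map⁺ (Any.map
      (λ { refl i → trans (sym (insert-remove zero w i)) (insert-cong {π = remove zero w} {π} eq i) })
      (∈.∈-allFin (w ⟨$⟩ʳ zero)))

  module _ (S : DecSetoid 0ℓ 0ℓ) where
    open DecSetoid S using () renaming (setoid to S′; _≈_ to _≈ₛ_; sym to symₛ; trans to transₛ)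
    open UniqueSetoid S′ using (Unique)

    private
      lookup-injective : ∀ {xs} → Unique xs → ∀ i j → lookup xs i ≈ₛ lookup xs j → i ≡ j
      lookup-injective (x∉ ∷ u) zero    zero    _  = refl
      lookup-injective (x∉ ∷ u) zero    (suc j) eq = contradiction eq (All.lookup x∉ (∈.∈-lookup j))
      lookup-injective (x∉ ∷ u) (suc i) zero    eq = contradiction (symₛ eq) (All.lookup x∉ (∈.∈-lookup i))
      lookup-injective (x∉ ∷ u) (suc i) (suc j) eq = cong suc (lookup-injective u i j eq)

    enumeration⇒finite : ∀ {xs} → IsEnumeration S′ xs → Finite S′
    enumeration⇒finite {xs} enum = length ys , record
      { to        = λ x → Any.index (enum′ x)
      ; from      = lookup ys
      ; to-cong   = λ {x} {y} x≈y → inj _ _ (transₛ (symₛ (at x)) (transₛ x≈y (at y)))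
      ; from-cong = λ { refl → DecSetoid.refl S }
      ; inverse   = (λ {i} {x} x≈ → inj _ _ (transₛ (symₛ (at x)) x≈))
                  , (λ { {x} refl → symₛ (at x) })
      }
      where
      ys = deduplicate (DecSetoid._≟_ S) xs
      enum′ : IsEnumeration S′ ys
      enum′ = Enumerates.deduplicate⁺ S enum
      at : ∀ x → x ≈ₛ lookup ys (Any.index (enum′ x))
      at x = Any.lookup-index (enum′ x)
      inj = lookup-injective (UniqueDec.deduplicate-! S xs)

open Finiteness

abstract
  avoiders-finite : ∀ P H m → Finite (DecSetoid.setoid (AvoiderSetoid P H m))
  avoiders-finite P H m = enumeration⇒finite (AvoiderSetoid P H m) {concatMap keep (permutations (suc m))} complete
    where
    keep : Permutation′ (suc m) → List (Avoider P H m)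
    keep w with avoids? P H w
    ... | yes a = (w , a) ∷ []
    ... | no  _ = []

    keep-complete : ∀ w → Avoids P H w → ∀ {w′} → w ≈ w′ →
                    Any (λ (a : Avoider P H m) → w ≈ proj₁ a) (keep w′)
    keep-complete w a {w′} w≈w′ with avoids? P H w′
    ... | yes _ = here w≈w′
    ... | no ¬a = contradiction (Avoids-resp P H {w = w} {w′} w≈w′ a) ¬a

    complete : IsEnumeration (DecSetoid.setoid (AvoiderSetoid P H m)) (concatMap keep (permutations (suc m)))
    complete (w , a) = Any.concatMap⁺ keep
      (Any.map (λ {w′} → keep-complete w a {w′}) (permutations-complete (suc m) w))

-- ∣ S_{m+1}^P(H) ∣
avoiderCount : Patterns → HeapPatterns → ℕ → ℕ
avoiderCount P H m = proj₁ (avoiders-finite P H m)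

------------------------------------------------------------------------
-- Formal power series over ℤ, as coefficient sequences

open import Algebra.Properties.Monoid.Sum ℤ.+-0-monoid using (sum; sum-cong-≗)

Series : Set
Series = ℕ → ℤ

infix  4 _≋_
infixl 6 _+ˢ_ _-ˢ_
infixl 7 _*ˢ_ _/ˢ_

_≋_ : Rel Series 0ℓ
f ≋ g = ∀ n → f n ≡ g n

constant : ℤ → Series
constant c zero    = c
constant c (suc _) = 0ℤ

X : Series
X zero          = 0ℤ
X (suc zero)    = 1ℤ
X (suc (suc _)) = 0ℤ

_+ˢ_ _-ˢ_ _*ˢ_ : Series → Series → Series
(f +ˢ g) n = f n ℤ.+ g n
(f -ˢ g) n = f n ℤ.- g n
(f *ˢ g) n = sum {suc n} λ i → f (toℕ i) ℤ.* g (n ℕ.∸ toℕ i)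

-- The coefficients of 1/g, in the order n, n-1, …, 0, for g with
-- constant term 1: the recursion solves g * (1/g) = 1 for the
-- coefficient of xⁿ⁺¹.  For other g the result has no meaning.
inverseCoefficients : Series → ∀ n → Vector.Vector ℤ (suc n)
inverseCoefficients g zero    = λ _ → 1ℤ
inverseCoefficients g (suc n) =
  (ℤ.- sum λ i → g (suc (toℕ i)) ℤ.* inverseCoefficients g n i)
  Vector.∷ inverseCoefficients g n

inverse : Series → Series
inverse g n = inverseCoefficients g n zero

inverse-correct : ∀ g → g 0 ≡ 1ℤ → g *ˢ inverse g ≋ constant 1ℤ
inverse-correct g g₀≡1 zero    = cong (λ c → c ℤ.* 1ℤ ℤ.+ 0ℤ) g₀≡1
inverse-correct g g₀≡1 (suc n) = begin
  g 0 ℤ.* inverse g (suc n) ℤ.+ sum {suc n} (λ i → g (suc (toℕ i)) ℤ.* inverse g (n ℕ.∸ toℕ i))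
    ≡⟨ cong₂ ℤ._+_ (trans (cong (ℤ._* inverse g (suc n)) g₀≡1) (ℤ.*-identityˡ _))
                   (sum-cong-≗ {suc n} {λ i → g (suc (toℕ i)) ℤ.* inverse g (n ℕ.∸ toℕ i)} {tail} λ i →
                      cong (g (suc (toℕ i)) ℤ.*_) (sym (entry n i))) ⟩
  ℤ.- sum tail ℤ.+ sum tail
    ≡⟨ ℤ.+-inverseˡ (sum tail) ⟩
  0ℤ ∎
  where
  open ≡-Reasoning
  tail : Fin (suc n) → ℤ
  tail i = g (suc (toℕ i)) ℤ.* inverseCoefficients g n i
  entry : ∀ n i → inverseCoefficients g n i ≡ inverse g (n ℕ.∸ toℕ i)
  entry zero    zero    = refl
  entry (suc n) zero    = refl
  entry (suc n) (suc i) = entry n i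

_/ˢ_ : Series → Series → Series
f /ˢ g = f *ˢ inverse g

-- ∑ₙ ∣ S_{n+1}^P(H) ∣ xⁿ
avoiderSeries : Patterns → HeapPatterns → Series
avoiderSeries P H n = + avoiderCount P H n

{-# OPTIONS --safe #-}
module Submission where

-- If a permutation avoids 3421, 4312 and 4321, then the middle entry p of
-- a 321-pattern is a fixed point that exactly one entry x < p passes on its
-- way up and exactly one entry y > p on its way down: a cut.  At its first
-- cut the permutation w is glued from a 321-avoiding u not fixing its last
-- point and a permutation v of the same kind as w not fixing its first
-- point; w avoids 4231 if and only if v does and v has no cut at its second
-- point.  So the series T of such permutations satisfies T = F + L N, where
-- N counts the v, and N = (1-x)T - 1, respectively (1+x)N = (1-x)T - 1
-- unless L = 0.
--
-- Gluing respects heap avoidance.  In a reduced word of w the wire p makes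
-- exactly two crossings, so the word is W₂ s_p W₁ s_p W₀ with no s_{p-1}
-- and s_p in W₂ and W₀, and no s_p and s_{p+1} in W₁, or the mirror image of
-- this.  Its letters below p form a reduced word of u; those from p on, with
-- one s_p deleted, form one of v.  A convex subheap that reaches across p
-- has an internal column s_{p-1} or s_p, which occurs in it twice, but
-- between two consecutive letters s_i of a fully commutative word there are
-- both an s_{i-1} and an s_{i+1}, and this cannot be realised in the word.

open import Defs
open import Algebra.Bundles using (CommutativeRing)
open import Data.Empty using (⊥; ⊥-elim)
open import Data.Fin.Base as Fin using (Fin; zero; suc; toℕ; fromℕ<; inject₁)
import Data.Fin.Properties as Fin
open import Data.Fin.Permutation using (Permutation′; permutation; _⟨$⟩ʳ_; _⟨$⟩ˡ_; inverseˡ; inverseʳ; _∘ₚ_; _≈_)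
open import Data.List using (List; []; _∷_; _++_; map; length; lookup; filter; tabulate)
import Data.List.Properties as List
open import Data.List.Membership.Propositional using (_∈_; _∉_)
open import Data.List.Membership.DecPropositional using (_∈?_)
open import Data.List.Relation.Unary.All as All using (All; []; _∷_)
import Data.List.Relation.Unary.All.Properties as All
open import Data.List.Relation.Unary.Any using (here; there)
open import Data.Nat.Base using (ℕ; zero; suc; _+_; _*_; _∸_; _≤_; _<_; z≤n; s≤s; s≤s⁻¹; z<s; s<s⁻¹)
open import Data.Maybe.Base using (just; nothing)
open import Data.Nat.Properties
open import Data.Product using (Σ; Σ-syntax; ∃; ∃-syntax; ∃₂; _×_; _,_; proj₁; proj₂)
open import Data.Sum using (_⊎_; inj₁; inj₂; [_,_]′)
open import Data.Unit using (⊤)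
open import Function.Base using (_∘_; case_of_; id)
open import Function.Bundles using (_⇔_; mk⇔; Equivalence; Inverse)
open import Level using (0ℓ)
open import Relation.Binary.Bundles using (Setoid; DecSetoid)
open import Relation.Binary.Definitions using (tri<; tri≈; tri>)
open import Relation.Binary.PropositionalEquality
open import Relation.Nullary using (Dec; yes; no; ¬_; contradiction)
open import Relation.Nullary.Decidable using (map′; _×-dec_; _⊎-dec_; _→-dec_)
import Function.Construct.Composition as Composition
import Function.Construct.Symmetry as Symmetry
open import Data.Fin.Permutation using (↔⇒≡)
open import Data.Product.Function.NonDependent.Setoid using (_×-inverse_)
open import Data.Product.Relation.Binary.Pointwise.NonDependent using (_×ₛ_)
import Data.Integer.Base as ℤ
import Data.Integer.Properties as ℤ
open import Algebra.Properties.Monoid.Sum ℤ.+-0-monoid using (sum; sum-cong-≗)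
import Relation.Binary.Construct.Closure.Equivalence as EqClosure

-- Words in the adjacent transpositions of ℕ

-- Every permutation is extended by fixed points to a bijection of ℕ, so that `u`, `v` and `w` have
-- one type and a Coxeter embedding becomes the addition of an offset. A convex subheap is a
-- contiguous factor of some reduced word, which turns heap containment into a statement about
-- factors. That the halves of a reduced word of `w` are reduced is not read off the crossings: the
-- lengths add up to one more than those of `u` and `v`, so neither half has room to be longer than
-- a shortest word. Which of the two middle letters is deleted is a free choice, since on the side
-- where they count they commute with everything between them; the one outside the subheap is taken.
-- Conversely a heap in `u` or in `v` has to stay contiguous in `w`, so a reduced word of `w` is
-- built around each of them. The extra term of the equation for N in the case of 4231 counts
-- permutations with a cut at the second point. They are glued from the transposition in the
-- symmetric group of two points and a further `v`, and so carry the factor `l 1`. It is 1 unless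
-- the one-column heap is forbidden; then only identities avoid H and L = 0.

swap : ℕ → ℕ → ℕ
swap zero    zero          = 1
swap zero    (suc zero)    = 0
swap zero    (suc (suc x)) = suc (suc x)
swap (suc i) zero          = zero
swap (suc i) (suc x)       = suc (swap i x)

swap-left : ∀ i → swap i i ≡ suc i
swap-left zero    = refl
swap-left (suc i) = cong suc (swap-left i)

swap-right : ∀ i → swap i (suc i) ≡ i
swap-right zero    = refl
swap-right (suc i) = cong suc (swap-right i)

swap-fix : ∀ i {x} → x ≢ i → x ≢ suc i → swap i x ≡ x
swap-fix zero    {zero}        x≢ _   = contradiction refl x≢
swap-fix zero    {suc zero}    _  x≢  = contradiction refl x≢
swap-fix zero    {suc (suc x)} _  _   = refl
swap-fix (suc i) {zero}        _  _   = refl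
swap-fix (suc i) {suc x}       x≢ x≢′ = cong suc (swap-fix i (x≢ ∘ cong suc) (x≢′ ∘ cong suc))

swap-below : ∀ {i x} → x < i → swap i x ≡ x
swap-below {i} x<i = swap-fix i (<⇒≢ x<i) (<⇒≢ (m<n⇒m<1+n x<i))

swap-above : ∀ {i x} → suc i < x → swap i x ≡ x
swap-above {i} i<x = swap-fix i (>⇒≢ (<-trans (n<1+n i) i<x)) (>⇒≢ i<x)

swap-involutive : ∀ i x → swap i (swap i x) ≡ x
swap-involutive zero    zero          = refl
swap-involutive zero    (suc zero)    = refl
swap-involutive zero    (suc (suc x)) = refl
swap-involutive (suc i) zero          = refl
swap-involutive (suc i) (suc x)       = cong suc (swap-involutive i x)

swap-injective : ∀ i {x y} → swap i x ≡ swap i y → x ≡ y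
swap-injective i {x} {y} eq = trans (sym (swap-involutive i x)) (trans (cong (swap i) eq) (swap-involutive i y))

swap-≤ : ∀ {i t x} → i < t → x ≤ t → swap i x ≤ t
swap-≤ {zero}  {x = zero}        i<t       x≤t       = i<t
swap-≤ {zero}  {x = suc zero}    i<t       x≤t       = z≤n
swap-≤ {zero}  {x = suc (suc x)} i<t       x≤t       = x≤t
swap-≤ {suc i} {x = zero}        i<t       x≤t       = z≤n
swap-≤ {suc i} {x = suc x}       (s≤s i<t) (s≤s x≤t) = s≤s (swap-≤ i<t x≤t)

swap-≥ : ∀ {i t x} → t ≤ i → t ≤ x → t ≤ swap i x
swap-≥ {t = zero}                t≤i       t≤x       = z≤n
swap-≥ {suc i} {x = suc x}       (s≤s t≤i) (s≤s t≤x) = s≤s (swap-≥ t≤i t≤x)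

swap-commute : ∀ {i j} → suc i < j → ∀ x → swap i (swap j x) ≡ swap j (swap i x)
swap-commute {zero}  {suc (suc j)} _         zero          = refl
swap-commute {zero}  {suc (suc j)} _         (suc zero)    = refl
swap-commute {zero}  {suc (suc j)} _         (suc (suc x)) = refl
swap-commute {zero}  {suc zero}    (s≤s ())
swap-commute {suc i} {suc j}       (s≤s i<j) zero          = refl
swap-commute {suc i} {suc j}       (s≤s i<j) (suc x)       = cong suc (swap-commute i<j x)

swap-braid : ∀ i x → swap i (swap (suc i) (swap i x)) ≡ swap (suc i) (swap i (swap (suc i) x))
swap-braid zero    zero                = refl
swap-braid zero    (suc zero)          = refl
swap-braid zero    (suc (suc zero))    = refl
swap-braid zero    (suc (suc (suc x))) = refl
swap-braid (suc i) zero                = refl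
swap-braid (suc i) (suc x)             = cong suc (swap-braid i x)

swap-mono : ∀ i {x y} → x < y → ¬ (x ≡ i × y ≡ suc i) → swap i x < swap i y
swap-mono zero    {zero}        {suc zero}          x<y       ¬eq = contradiction (refl , refl) ¬eq
swap-mono zero    {zero}        {suc (suc y)}       x<y       ¬eq = s≤s (s≤s z≤n)
swap-mono zero    {suc zero}    {suc zero}          (s≤s ()) ¬eq
swap-mono zero    {suc zero}    {suc (suc y)}       x<y       ¬eq = z<s
swap-mono zero    {suc (suc x)} {suc zero}          (s≤s ()) ¬eq
swap-mono zero    {suc (suc x)} {suc (suc y)}       x<y       ¬eq = x<y
swap-mono (suc i) {zero}        {suc y}             x<y       ¬eq = z<s
swap-mono (suc i) {suc x}       {suc y}             (s≤s x<y) ¬eq =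
  s≤s (swap-mono i x<y λ { (refl , refl) → ¬eq (refl , refl) })

act : List ℕ → ℕ → ℕ
act []      x = x
act (i ∷ w) x = swap i (act w x)

act-++ : ∀ u v → act (u ++ v) ≗ act u ∘ act v
act-++ []      v x = refl
act-++ (i ∷ u) v x = cong (swap i) (act-++ u v x)

act-injective : ∀ w {x y} → act w x ≡ act w y → x ≡ y
act-injective []      eq = eq
act-injective (i ∷ w) eq = act-injective w (swap-injective i eq)

act-surjective : ∀ w y → ∃[ x ] act w x ≡ y
act-surjective []      y = y , refl
act-surjective (i ∷ w) y = let (x , eq) = act-surjective w (swap i y)
                           in x , trans (cong (swap i) eq) (swap-involutive i y)

-- A letter acts on positions from the left; the wire x is at position
-- act w x after w.  In a reduced word no two wires cross twice.
data Red : List ℕ → Set where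
  []  : Red []
  _∷_ : ∀ {i w} → (∀ {x y} → act w x ≡ i → act w y ≡ suc i → x < y) → Red w → Red (i ∷ w)

-- Outcome of the exchange condition: one crossing of the two wires is deleted, so that they trade
-- their final positions. Since `P` is arbitrary, `letters` carries every bound on the letters over
-- to the shorter word.
record Uncrossed (w : List ℕ) (x y : ℕ) : Set₁ where
  constructor uncrossed
  field
    word    : List ℕ
    shorter : length w ≡ suc (length word)
    left    : act word x ≡ act w y
    right   : act word y ≡ act w x
    other   : ∀ {z} → z ≢ x → z ≢ y → act word z ≡ act w z
    letters : ∀ {P : ℕ → Set} → All P w → All P word

exchange : ∀ w {x y} → x < y → act w y < act w x → Uncrossed w x y
exchange []      x<y y<x = contradiction x<y (<-asym y<x)
exchange (j ∷ w) {x} {y} x<y inv with <-cmp (act w x) (act w y)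
... | tri≈ _ eq _ = contradiction (act-injective w eq) (<⇒≢ x<y)
... | tri> _ _ gt with exchange w x<y gt
...   | uncrossed v sh l r o ls = uncrossed (j ∷ v) (cong suc sh) (cong (swap j) l) (cong (swap j) r)
          (λ z≢x z≢y → cong (swap j) (o z≢x z≢y)) λ { (p ∷ ps) → p ∷ ls ps }
exchange (j ∷ w) {x} {y} x<y inv | tri< lt _ _ with act w x ≟ j | act w y ≟ suc j
... | yes eqx | yes eqy = uncrossed w refl
        (trans eqx (sym (trans (cong (swap j) eqy) (swap-right j))))
        (trans eqy (sym (trans (cong (swap j) eqx) (swap-left j))))
        (λ {z} z≢x z≢y → sym (swap-fix j (λ eq → z≢x (act-injective w (trans eq (sym eqx))))
                                         (λ eq → z≢y (act-injective w (trans eq (sym eqy))))))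
        λ { (_ ∷ ps) → ps }
... | no  neq | _       = contradiction inv (<-asym (swap-mono j lt (neq ∘ proj₁)))
... | yes _   | no neq  = contradiction inv (<-asym (swap-mono j lt (neq ∘ proj₂)))

-- If the crossing i ∷ w makes undoes an earlier crossing of x and y,
-- then both crossings can be deleted.
uncross-cons : ∀ {i w x y} (u : Uncrossed w x y) → act w x ≡ suc i → act w y ≡ i →
               act (Uncrossed.word u) ≗ act (i ∷ w)
uncross-cons {i} {w} {x} {y} (uncrossed v _ l r o _) wx wy z with z ≟ x | z ≟ y
... | yes refl | _        = trans l (trans wy (sym (trans (cong (swap i) wx) (swap-right i))))
... | no _     | yes refl = trans r (trans wx (sym (trans (cong (swap i) wy) (swap-left i))))
... | no z≢x   | no z≢y   = trans (o z≢x z≢y)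
      (sym (swap-fix i (λ eq → z≢y (act-injective w (trans eq (sym wy))))
                       (λ eq → z≢x (act-injective w (trans eq (sym wx))))))

-- The leftmost letter of `w` crosses two wires that `v`, acting in the same way, must cross as
-- well. Exchange removes their crossing from `v` and leaves a word for the tail of `w`, to which
-- induction applies.
Red⇒minimal : ∀ {w} → Red w → ∀ v → act v ≗ act w → length w ≤ length v
Red⇒minimal []                  v eq = z≤n
Red⇒minimal {i ∷ w} (asc ∷ red) v eq =
  let (x , wx) = act-surjective w i
      (y , wy) = act-surjective w (suc i)
      vx : act v x ≡ suc i
      vx = trans (eq x) (trans (cong (swap i) wx) (swap-left i))
      vy : act v y ≡ i
      vy = trans (eq y) (trans (cong (swap i) wy) (swap-right i))
      u = exchange v (asc wx wy) (subst₂ _<_ (sym vy) (sym vx) (n<1+n i))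
  in subst (suc (length w) ≤_) (sym (Uncrossed.shorter u))
       (s≤s (Red⇒minimal red (Uncrossed.word u) λ z → trans (uncross-cons u vx vy z)
          (trans (cong (swap i) (eq z)) (swap-involutive i _))))

-- `P` restricts the competitors. Minimality in a finite symmetric group compares only words with
-- letters below its rank, and the words that exchange produces stay among these.
minimal⇒Red : ∀ {P : ℕ → Set} {w} → All P w →
              (∀ v → All P v → act v ≗ act w → length w ≤ length v) → Red w
minimal⇒Red {w = []}    _        _   = []
minimal⇒Red {P} {i ∷ w} (p ∷ ps) min =
  asc ∷ minimal⇒Red ps (λ v ps′ eq → s≤s⁻¹ (min (i ∷ v) (p ∷ ps′) (cong (swap i) ∘ eq)))
  where
  asc : ∀ {x y} → act w x ≡ i → act w y ≡ suc i → x < y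
  asc {x} {y} wx wy with <-cmp x y
  ... | tri< x<y _ _ = x<y
  ... | tri≈ _ refl _ = contradiction (trans (sym wx) wy) (<⇒≢ (n<1+n i))
  ... | tri> _ _ y<x = contradiction
          (subst (λ n → suc n ≤ length v) sh (min v (ls ps) (uncross-cons u wy wx)))
          (1+n≰n ∘ ≤-trans (n≤1+n _))
    where
    u = exchange w y<x (subst₂ _<_ (sym wx) (sym wy) (n<1+n i))
    open Uncrossed u renaming (word to v; shorter to sh; letters to ls)

Red-shortest : ∀ {v w} → Red w → act v ≗ act w → length v ≤ length w → Red v
Red-shortest {v} {w} red eq le = minimal⇒Red {P = λ _ → ⊤} (All.universal _ v)
  λ v′ _ eq′ → ≤-trans le (Red⇒minimal red v′ λ z → trans (eq′ z) (eq z))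

Red-++ʳ : ∀ u {v} → Red (u ++ v) → Red v
Red-++ʳ []      red       = red
Red-++ʳ (_ ∷ u) (_ ∷ red) = Red-++ʳ u red

-- A letter that restores the order of two crossed wires is exactly what `Red` forbids.
crossing-persists : ∀ u {v x y} → Red (u ++ v) → x < y → act v y < act v x →
                    act (u ++ v) y < act (u ++ v) x
crossing-persists []      red x<y cr = cr
crossing-persists (i ∷ u) {v} (asc ∷ red) x<y cr =
  swap-mono i (crossing-persists u red x<y cr) λ (eqy , eqx) → <-asym x<y (asc eqy eqx)

-- i ∈ w for a reduced word w means that some wire crosses the gap
-- between positions i and i+1.
crossed-gap : ∀ {w j} → Red w → j ∈ w → ∃₂ λ x y → x ≤ j × j < y × act w y < act w x

preserves-≤ : ∀ {w j} → j ∉ w → ∀ {x} → x ≤ j → act w x ≤ j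
preserves-> : ∀ {w j} → j ∉ w → ∀ {x} → j < x → j < act w x
preserves-≤ {[]}    j∉ x≤j = x≤j
preserves-≤ {i ∷ w} {j} j∉ {x} x≤j with <-cmp i j
... | tri< i<j _ _ = swap-≤ i<j (preserves-≤ {w} (j∉ ∘ there) x≤j)
... | tri≈ _ refl _ = contradiction (here refl) j∉
... | tri> _ _ j<i = let le = preserves-≤ {w} (j∉ ∘ there) x≤j
                     in subst (_≤ j) (sym (swap-below (≤-<-trans le j<i))) le
preserves-> {[]}    j∉ j<x = j<x
preserves-> {i ∷ w} {j} j∉ {x} j<x with <-cmp i j
... | tri< i<j _ _ = let lt = preserves-> {w} (j∉ ∘ there) j<x
                     in subst (j <_) (sym (swap-above (≤-<-trans i<j lt))) lt
... | tri≈ _ refl _ = contradiction (here refl) j∉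
... | tri> _ _ j<i = swap-≥ j<i (preserves-> {w} (j∉ ∘ there) j<x)

crossed-gap {i ∷ w} {j} (asc ∷ red) j∈ with _∈?_ _≟_ j w
... | yes j∈w = let (x , y , x≤j , j<y , cr) = crossed-gap red j∈w
                in x , y , x≤j , j<y , crossing-persists (i ∷ []) (asc ∷ red) (≤-<-trans x≤j j<y) cr
... | no  j∉w with j∈
...   | there j∈w = contradiction j∈w j∉w
...   | here refl =
  let (x , wx) = act-surjective w j
      (y , wy) = act-surjective w (suc j)
  in x , y , ≮⇒≥ (λ j<x → <-irrefl (sym wx) (preserves-> j∉w j<x))
       , ≰⇒> (λ y≤j → <⇒≱ (n<1+n j) (subst (_≤ j) wy (preserves-≤ j∉w y≤j)))
       , subst₂ _<_ (sym (trans (cong (swap j) wy) (swap-right j)))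
                    (sym (trans (cong (swap j) wx) (swap-left j))) (n<1+n j)

record Reduction (w : List ℕ) : Set₁ where
  constructor reduction
  field
    word    : List ℕ
    red     : Red word
    same    : act word ≗ act w
    short   : length word ≤ length w
    letters : ∀ {P : ℕ → Set} → All P w → All P word

-- The word that exchange returns is shorter but not a subterm, so the recursion runs on a bound `n`
-- for the length.
reduce : ∀ w → Reduction w
reduce w = go (length w) w ≤-refl
  where
  go : ∀ n w → length w ≤ n → Reduction w
  go n       []      _        = reduction [] [] (λ _ → refl) z≤n id
  go (suc n) (i ∷ w) (s≤s le) with go n w le
  ... | reduction w′ red same sh ls with act-surjective w′ i | act-surjective w′ (suc i)
  ...   | x , wx | y , wy with <-cmp x y
  ...     | tri< x<y _ _ = reduction (i ∷ w′)
              ((λ ex ey → subst₂ _<_ (act-injective w′ (trans wx (sym ex))) (act-injective w′ (trans wy (sym ey))) x<y) ∷ red)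
              (cong (swap i) ∘ same) (s≤s sh) λ { (p ∷ ps) → p ∷ ls ps }
  ...     | tri≈ _ refl _ = contradiction (trans (sym wx) wy) (<⇒≢ (n<1+n i))
  ...     | tri> _ _ y<x with exchange w′ y<x (subst₂ _<_ (sym wx) (sym wy) (n<1+n i))
  ...       | u@(uncrossed v sh′ _ _ _ ls′) with go n v (≤-trans (≤-trans (n≤1+n _) (≤-reflexive (sym sh′))) (≤-trans sh le))
  ...         | reduction v′ red′ same′ sh″ ls″ = reduction v′ red′
                (λ z → trans (same′ z) (trans (uncross-cons u wy wx z) (cong (swap i) (same z))))
                (≤-trans sh″ (m≤n⇒m≤1+n (≤-trans (≤-trans (n≤1+n _) (≤-reflexive (sym sh′))) sh)))
                λ { (_ ∷ ps) → ls″ (ls′ (ls ps)) }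

act-fix : ∀ {w x} → All (λ i → i ≢ x × suc i ≢ x) w → act w x ≡ x
act-fix []                     = refl
act-fix {i ∷ w} {x} ((l , r) ∷ ps) = trans (cong (swap i) (act-fix ps)) (swap-fix i (l ∘ sym) (r ∘ sym))

act-above : ∀ {t w x} → All (_< t) w → t < x → act w x ≡ x
act-above all t<x = act-fix (All.map (λ i<t → <⇒≢ (<-trans i<t t<x) , <⇒≢ (≤-<-trans i<t t<x)) all)

act-bounded : ∀ {t w x} → All (_< t) w → x ≤ t → act w x ≤ t
act-bounded []         x≤t = x≤t
act-bounded (i<t ∷ ps) x≤t = swap-≤ i<t (act-bounded ps x≤t)

-- Splitting a word into its letters below p and from p on

lo hi : ℕ → List ℕ → List ℕ
lo p = filter (_<? p)
hi p = map (_∸ p) ∘ filter (p ≤?_)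

shift : ℕ → List ℕ → List ℕ
shift p = map (p +_)

lo-++ : ∀ p u v → lo p (u ++ v) ≡ lo p u ++ lo p v
lo-++ p = List.filter-++ (_<? p)

hi-++ : ∀ p u v → hi p (u ++ v) ≡ hi p u ++ hi p v
hi-++ p u v = trans (cong (map (_∸ p)) (List.filter-++ (p ≤?_) u v)) (List.map-++ (_∸ p) (filter (p ≤?_) u) (filter (p ≤?_) v))

lo-below : ∀ {p i} w → i < p → lo p (i ∷ w) ≡ i ∷ lo p w
lo-below {p} w i<p = List.filter-accept (_<? p) i<p

lo-above : ∀ {p i} w → p ≤ i → lo p (i ∷ w) ≡ lo p w
lo-above {p} w p≤i = List.filter-reject (_<? p) (≤⇒≯ p≤i)

hi-below : ∀ {p i} w → i < p → hi p (i ∷ w) ≡ hi p w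
hi-below {p} w i<p = cong (map (_∸ p)) (List.filter-reject (p ≤?_) (<⇒≱ i<p))

hi-above : ∀ {p i} w → p ≤ i → hi p (i ∷ w) ≡ (i ∸ p) ∷ hi p w
hi-above {p} w p≤i = cong (map (_∸ p)) (List.filter-accept (p ≤?_) p≤i)

lo-all : ∀ {p w} → All (_< p) w → lo p w ≡ w
lo-all {p} = List.filter-all (_<? p)

lo-none : ∀ {p w} → All (p ≤_) w → lo p w ≡ []
lo-none {p} ps = List.filter-none (_<? p) (All.map ≤⇒≯ ps)

hi-none : ∀ {p w} → All (_< p) w → hi p w ≡ []
hi-none {p} ps = cong (map (_∸ p)) (List.filter-none (p ≤?_) (All.map <⇒≱ ps))

shift-≥ : ∀ p w → All (p ≤_) (shift p w)
shift-≥ p w = All.map⁺ (All.universal (m≤m+n p) w)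

hi-shift : ∀ p w → hi p (shift p w) ≡ w
hi-shift p w = trans (cong (map (_∸ p)) (List.filter-all (p ≤?_) (shift-≥ p w)))
  (trans (sym (List.map-∘ w)) (trans (List.map-cong (m+n∸m≡n p) w) (List.map-id w)))

length-lo-hi : ∀ p w → length w ≡ length (lo p w) + length (hi p w)
length-lo-hi p []      = refl
length-lo-hi p (i ∷ w) with <-≤-connex i p
... | inj₁ i<p rewrite lo-below w i<p | hi-below w i<p = cong suc (length-lo-hi p w)
... | inj₂ p≤i rewrite lo-above w p≤i | hi-above w p≤i =
  trans (cong suc (length-lo-hi p w)) (sym (+-suc _ _))

lo-< : ∀ p w → All (_< p) (lo p w)
lo-< p w = All.all-filter (_<? p) w

swap-shift : ∀ p i x → swap (p + i) (p + x) ≡ p + swap i x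
swap-shift zero    i x = refl
swap-shift (suc p) i x = cong suc (swap-shift p i x)

act-shift : ∀ p w x → act (shift p w) (p + x) ≡ p + act w x
act-shift p []      x = refl
act-shift p (i ∷ w) x = trans (cong (swap (p + i)) (act-shift p w x)) (swap-shift p i _)

act-shift-below : ∀ p w {x} → x < p → act (shift p w) x ≡ x
act-shift-below p w x<p = act-fix (All.map (λ p≤i → >⇒≢ (<-≤-trans x<p p≤i) , >⇒≢ (<-≤-trans x<p (m≤n⇒m≤1+n p≤i)))
                                           (shift-≥ p w))

-- No letter of w crosses the gap at t, and the letters on either side of
-- it are on the corresponding sides of p.
Split : ℕ → ℕ → ℕ → Set
Split p t i = (i < t × i < p) ⊎ (t < i × p ≤ i)

split-≤ : ∀ {p t w x} → All (Split p t) w → x ≤ t → act w x ≤ t × act w x ≡ act (lo p w) x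
split-≤ []       x≤t = x≤t , refl
split-≤ {w = i ∷ w} (inj₁ (i<t , i<p) ∷ ps) x≤t =
  let (le , eq) = split-≤ ps x≤t
  in swap-≤ i<t le , trans (cong (swap i) eq) (cong (λ v → act v _) (sym (lo-below w i<p)))
split-≤ {t = t} {w = i ∷ w} (inj₂ (t<i , p≤i) ∷ ps) x≤t =
  let (le , eq) = split-≤ ps x≤t
      fix = swap-below (≤-<-trans le t<i)
  in subst (_≤ t) (sym fix) le , trans fix (trans eq (cong (λ v → act v _) (sym (lo-above w p≤i))))

split-> : ∀ {p t w x} → All (Split p t) w → t < x → t < act w x
split-> []       t<x = t<x
split-> {t = t} (inj₁ (i<t , i<p) ∷ ps) t<x =
  let lt = split-> ps t<x
  in subst (t <_) (sym (swap-above (≤-<-trans i<t lt))) lt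
split-> (inj₂ (t<i , p≤i) ∷ ps) t<x = swap-≥ t<i (split-> ps t<x)

split-hi : ∀ {p t w x} → All (Split p t) w → t < p + x → act w (p + x) ≡ p + act (hi p w) x
split-hi []       t<x = refl
split-hi {t = t} {w = i ∷ w} (inj₁ (i<t , i<p) ∷ ps) t<x =
  trans (swap-above (≤-<-trans i<t (split-> ps t<x)))
        (trans (split-hi ps t<x) (cong (λ v → _ + act v _) (sym (hi-below w i<p))))
split-hi {p} {t} {i ∷ w} {x} (inj₂ (t<i , p≤i) ∷ ps) t<x = begin
  swap i (act w (p + x))                       ≡⟨ cong (swap i) (split-hi ps t<x) ⟩
  swap i (p + act (hi p w) x)                  ≡⟨ cong (λ j → swap j (p + act (hi p w) x)) (m+[n∸m]≡n p≤i) ⟨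
  swap (p + (i ∸ p)) (p + act (hi p w) x)      ≡⟨ swap-shift p (i ∸ p) _ ⟩
  p + act ((i ∸ p) ∷ hi p w) x                 ≡⟨ cong (λ v → p + act v x) (hi-above w p≤i) ⟨
  p + act (hi p (i ∷ w)) x                     ∎
  where open ≡-Reasoning

-- Gluing two bijections of ℕ at a point

record Bij (g : ℕ → ℕ) : Set where
  constructor bij
  field
    injective  : ∀ {x y} → g x ≡ g y → x ≡ y
    surjective : ∀ y → ∃[ x ] g x ≡ y

act-bij : ∀ w → Bij (act w)
act-bij w = bij (act-injective w) (act-surjective w)

-- In a glued bijection the values `u p` and `v 0` appear only at points that depend on the other
-- half. The comparison of two gluings leaves these values out, and bijectivity forces them.
agree-at : ∀ {g h} → Bij g → Bij h → ∀ p → (∀ {x} → x ≢ p → g x ≡ h x) → g ≗ h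
agree-at {g} {h} (bij g-inj g-surj) (bij h-inj _) p eq x with x ≟ p
... | no  x≢p  = eq x≢p
... | yes refl with g-surj (h p)
...   | y , gy with y ≟ p
...     | yes refl = gy
...     | no  y≢p  = contradiction (h-inj (trans (sym (eq y≢p)) gy)) y≢p

-- With s_i exchanging i and i+1: if u = a s_{p-1} b, with a and b not
-- involving s_{p-1}, and v, shifted up by p, is c s_p d, with c and d not
-- involving s_p, then w = a c (s_{p-1} s_p s_{p-1}) d b.
record Glue (p : ℕ) (u v w : ℕ → ℕ) : Set where
  field
    low   : ∀ {q} → q < p → u q < p → w q ≡ u q
    jump↑ : ∀ {q} → q < p → u q ≡ p → w q ≡ p + v 0
    mid   : w p ≡ p
    high  : ∀ {r} → v (suc r) ≢ 0 → w (p + suc r) ≡ p + v (suc r)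
    jump↓ : ∀ {r} → v (suc r) ≡ 0 → w (p + suc r) ≡ u p

record Bounded (n : ℕ) (g : ℕ → ℕ) : Set where
  constructor bounded
  field
    inside  : ∀ {x} → x ≤ n → g x ≤ n
    outside : ∀ {x} → n < x → g x ≡ x

act-Bounded : ∀ {t w} → All (_< t) w → Bounded t (act w)
act-Bounded all = bounded (act-bounded all) (act-above all)

module _ {p u v u′ v′ w w′} (G : Glue p u v w) (G′ : Glue p u′ v′ w′)
         (bu : Bounded p u) (bu′ : Bounded p u′) (ju : Bij u) (ju′ : Bij u′) (jv : Bij v) (jv′ : Bij v′)
         (w≗w′ : w ≗ w′) where

  private
    module G = Glue G
    module G′ = Glue G′

  glue-injectiveˡ : u ≗ u′
  glue-injectiveˡ = agree-at ju ju′ p λ {x} x≢p → go x x≢p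
    where
    go : ∀ x → x ≢ p → u x ≡ u′ x
    go x x≢p with <-cmp x p
    ... | tri≈ _ x≡p _ = contradiction x≡p x≢p
    ... | tri> _ _ p<x = trans (Bounded.outside bu p<x) (sym (Bounded.outside bu′ p<x))
    ... | tri< x<p _ _ with m≤n⇒m<n∨m≡n (Bounded.inside bu (<⇒≤ x<p)) | m≤n⇒m<n∨m≡n (Bounded.inside bu′ (<⇒≤ x<p))
    ...   | inj₁ l  | inj₁ l′ = trans (sym (G.low x<p l)) (trans (w≗w′ x) (G′.low x<p l′))
    ...   | inj₂ e  | inj₂ e′ = trans e (sym e′)
    ...   | inj₁ l  | inj₂ e′ = contradiction (subst (_< p) (trans (sym (G.low x<p l)) (trans (w≗w′ x) (G′.jump↑ x<p e′))) l) (≤⇒≯ (m≤m+n p _))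
    ...   | inj₂ e  | inj₁ l′ = contradiction (subst (_< p) (trans (sym (G′.low x<p l′)) (trans (sym (w≗w′ x)) (G.jump↑ x<p e))) l′) (≤⇒≯ (m≤m+n p _))

  glue-injectiveʳ : v ≗ v′
  glue-injectiveʳ = agree-at jv jv′ 0 λ {x} x≢0 → go x x≢0
    where
    above : ∀ {n} → n ≢ 0 → p < p + n
    above {zero}  n≢0 = contradiction refl n≢0
    above {suc n} _   = m<m+n p z<s
    go : ∀ x → x ≢ 0 → v x ≡ v′ x
    go zero    x≢0 = contradiction refl x≢0
    go (suc r) x≢0 with v (suc r) ≟ 0 | v′ (suc r) ≟ 0
    ... | yes e | yes e′ = trans e (sym e′)
    ... | no n  | no n′  = +-cancelˡ-≡ p _ _ (trans (sym (G.high n)) (trans (w≗w′ _) (G′.high n′)))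
    ... | yes e | no n′  = contradiction (Bounded.inside bu ≤-refl) (<⇒≱ (subst (p <_)
                             (trans (sym (G′.high n′)) (trans (sym (w≗w′ _)) (G.jump↓ e))) (above n′)))
    ... | no n  | yes e′ = contradiction (Bounded.inside bu′ ≤-refl) (<⇒≱ (subst (p <_)
                             (trans (sym (G.high n)) (trans (w≗w′ _) (G′.jump↓ e′))) (above n)))

-- Words that realise a gluing

Outer : ℕ → ℕ → Set
Outer p i = suc i < p ⊎ p < i

outer-split : ∀ {p i} → Outer p i → Split p p i
outer-split (inj₁ i<p) = inj₁ (<-trans (n<1+n _) i<p , <-trans (n<1+n _) i<p)
outer-split (inj₂ p<i) = inj₂ (p<i , <⇒≤ p<i)

outer-split′ : ∀ {p i} → Outer (suc p) i → Split (suc p) p i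
outer-split′ (inj₁ (s≤s i<p)) = inj₁ (i<p , m<n⇒m<1+n i<p)
outer-split′ (inj₂ p<i)       = inj₂ (<-trans (n<1+n _) p<i , <⇒≤ p<i)

outer-fix : ∀ {p w} → All (Outer p) w → act w p ≡ p
outer-fix = act-fix ∘ All.map λ { (inj₁ i<p) → <⇒≢ (<-trans (n<1+n _) i<p) , <⇒≢ i<p
                                ; (inj₂ p<i) → >⇒≢ p<i , >⇒≢ (m<n⇒m<1+n p<i) }

module OuterWord {p w} (o : All (Outer (suc p)) w) where
  private
    P = suc p
    o≤ = All.map outer-split o
    o< = All.map outer-split′ o

  ≤-lo : ∀ {x} → x ≤ P → act w x ≡ act (lo P w) x
  ≤-lo x≤ = proj₂ (split-≤ o≤ x≤)
  <-pres : ∀ {x} → x < P → act w x < P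
  <-pres (s≤s x≤) = s≤s (proj₁ (split-≤ o< x≤))
  ≤-pres : ∀ {x} → x ≤ P → act w x ≤ P
  ≤-pres x≤ = proj₁ (split-≤ o≤ x≤)
  >-pres : ∀ {x} → P < x → P < act w x
  >-pres = split-> o≤
  ≥-pres : ∀ {x} → P ≤ x → P ≤ act w x
  ≥-pres = split-> o<
  fix : act w P ≡ P
  fix = outer-fix o
  +-hi : ∀ x → act w (P + x) ≡ P + act (hi P w) x
  +-hi x = split-hi o< (s≤s (m≤m+n p x))
  hi-fix : act (hi P w) 0 ≡ 0
  hi-fix = +-cancelˡ-≡ P _ _ (trans (sym (+-hi 0)) (trans (cong (act w) (+-identityʳ P)) (trans fix (sym (+-identityʳ P)))))

-- The wire p goes up to position p+1 and returns.
Inner⁺ : ℕ → ℕ → Set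
Inner⁺ p i = i < p ⊎ suc p < i

-- During `W₁` the wire `P` waits at position `suc P`. The right-hand `P` has brought a wire from
-- above down to position `P`, and the left-hand one will lift a wire from there. By `moves` these
-- two wires differ: the first is the wire of `jump↓`, the second that of `jump↑`. In `V` the two
-- crossings shrink to the single letter 0.
module GlueUp {p W₂ W₁ W₀} (o₂ : All (Outer (suc p)) W₂) (i₁ : All (Inner⁺ (suc p)) W₁) (o₀ : All (Outer (suc p)) W₀)
         (moves : act W₁ (suc p) ≢ suc p) where
  private
    P = suc p
    module W₂ = OuterWord o₂
    module W₀ = OuterWord o₀
    s₁ : All (Split P P) W₁
    s₁ = All.map (λ { (inj₁ l) → inj₁ (l , l) ; (inj₂ g) → inj₂ (<-trans (n<1+n _) g , ≤-trans (n≤1+n _) (<⇒≤ g)) }) i₁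
    s₁′ : All (Split P (suc P)) W₁
    s₁′ = All.map (λ { (inj₁ l) → inj₁ (m<n⇒m<1+n l , l) ; (inj₂ g) → inj₂ (g , ≤-trans (n≤1+n _) (<⇒≤ g)) }) i₁
    h₂ = act (hi P W₂)
    h₁ = act (hi P W₁)
    h₀ = act (hi P W₀)
    h₁-split : All (λ i → 1 < i) (hi P W₁)
    h₁-split = All.map⁺ (All.map (λ { (inj₁ l , g) → contradiction l (≤⇒≯ g) ; (inj₂ g , _) → m+n≤o⇒m≤o∸n 2 g })
                 (All.zip (All.filter⁺ (P ≤?_) i₁ , All.all-filter (P ≤?_) W₁)))
    h₁0 : h₁ 0 ≡ 0
    h₁0 = act-fix (All.map (λ g → >⇒≢ (<-trans z<s g) , λ ()) h₁-split)
    h₁1 : h₁ 1 ≡ 1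
    h₁1 = act-fix (All.map (λ g → >⇒≢ g , >⇒≢ (m<n⇒m<1+n g)) h₁-split)
    U = act (lo P W₂ ++ lo P W₁ ++ lo P W₀)
    V = act (hi P W₂ ++ 0 ∷ hi P W₁ ++ hi P W₀)
    W = act (W₂ ++ P ∷ W₁ ++ P ∷ W₀)
    U-eq : ∀ {x} → x ≤ P → U x ≡ act W₂ (act W₁ (act W₀ x))
    U-eq {x} x≤ = trans (act-++ (lo P W₂) _ x) (trans (cong (act (lo P W₂)) (act-++ (lo P W₁) _ x))
      (trans (cong (act (lo P W₂) ∘ act (lo P W₁)) (sym (W₀.≤-lo x≤)))
      (trans (cong (act (lo P W₂)) (sym (proj₂ (split-≤ s₁ (W₀.≤-pres x≤)))))
        (sym (W₂.≤-lo (proj₁ (split-≤ s₁ (W₀.≤-pres x≤))))))))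
    V-eq : ∀ x → V x ≡ h₂ (swap 0 (h₁ (h₀ x)))
    V-eq x = trans (act-++ (hi P W₂) _ x) (cong (h₂ ∘ swap 0) (act-++ (hi P W₁) _ x))
    W-eq : ∀ x → W x ≡ act W₂ (swap P (act W₁ (swap P (act W₀ x))))
    W-eq x = trans (act-++ W₂ _ x) (cong (act W₂ ∘ swap P) (act-++ W₁ _ x))

    module _ {q} (q<p : q < P) where
      a<p : act W₀ q < P
      a<p = W₀.<-pres q<p
      W-q : W q ≡ act W₂ (swap P (act W₁ (act W₀ q)))
      W-q = trans (W-eq q) (cong (act W₂ ∘ swap P ∘ act W₁) (swap-below a<p))
      b≤p : act W₁ (act W₀ q) ≤ P
      b≤p = proj₁ (split-≤ s₁ (<⇒≤ a<p))

    l : ∀ {q} → q < P → U q < P → W q ≡ U q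
    l q<p u<p = trans (W-q q<p) (trans (cong (act W₂) (swap-below b<p)) (sym eq))
      where
      eq = U-eq (<⇒≤ q<p)
      b<p = ≰⇒> λ p≤b → <⇒≱ (subst (_< P) eq u<p) (W₂.≥-pres p≤b)

    P+0 = +-identityʳ P
    P+1 : P + 1 ≡ suc P
    P+1 = +-comm P 1

    j↑ : ∀ {q} → q < P → U q ≡ P → W q ≡ P + V 0
    j↑ {q} q<p u≡p = begin
      W q                            ≡⟨ W-q q<p ⟩
      act W₂ (swap P (act W₁ (act W₀ q))) ≡⟨ cong (act W₂ ∘ swap P) b≡p ⟩
      act W₂ (swap P P)              ≡⟨ cong (act W₂) (trans (swap-left P) (sym P+1)) ⟩
      act W₂ (P + 1)                 ≡⟨ W₂.+-hi 1 ⟩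
      P + h₂ 1                       ≡⟨ cong (λ z → P + h₂ (swap 0 z)) (trans (cong h₁ W₀.hi-fix) h₁0) ⟨
      P + h₂ (swap 0 (h₁ (h₀ 0)))    ≡⟨ cong (P +_) (V-eq 0) ⟨
      P + V 0                        ∎
      where
      open ≡-Reasoning
      b≡p : act W₁ (act W₀ q) ≡ P
      b≡p with m≤n⇒m<n∨m≡n (b≤p q<p)
      ... | inj₂ e = e
      ... | inj₁ b<p = contradiction (trans (sym (U-eq (<⇒≤ q<p))) u≡p) (<⇒≢ (W₂.<-pres b<p))

    m : W P ≡ P
    m = begin
      W P                                          ≡⟨ W-eq P ⟩
      act W₂ (swap P (act W₁ (swap P (act W₀ P)))) ≡⟨ cong (act W₂ ∘ swap P ∘ act W₁) (trans (cong (swap P) W₀.fix) (swap-left P)) ⟩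
      act W₂ (swap P (act W₁ (suc P)))             ≡⟨ cong (act W₂ ∘ swap P) (act-fix (All.map (λ { (inj₁ l) → <⇒≢ (m<n⇒m<1+n l) , <⇒≢ (s≤s l) ; (inj₂ g) → >⇒≢ g , >⇒≢ (m<n⇒m<1+n g) }) i₁)) ⟩
      act W₂ (swap P (suc P))                      ≡⟨ cong (act W₂) (swap-right P) ⟩
      act W₂ P                                     ≡⟨ W₂.fix ⟩
      P                                            ∎
      where open ≡-Reasoning

    h₀>0 : ∀ r → 0 < h₀ (suc r)
    h₀>0 r = +-cancelˡ-< P 0 _ (subst₂ _<_ (sym P+0) (W₀.+-hi (suc r)) (W₀.>-pres (m<m+n P z<s)))

    W-r : ∀ r → W (P + suc r) ≡ act W₂ (swap P (act W₁ (swap P (P + h₀ (suc r)))))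
    W-r r = trans (W-eq _) (cong (act W₂ ∘ swap P ∘ act W₁ ∘ swap P) (W₀.+-hi (suc r)))

    V-zero : ∀ r → h₀ (suc r) ≡ 1 → V (suc r) ≡ 0
    V-zero r a≡1 = trans (V-eq (suc r)) (trans (cong (h₂ ∘ swap 0 ∘ h₁) a≡1) (trans (cong (h₂ ∘ swap 0) h₁1) W₂.hi-fix))

    hh : ∀ {r} → V (suc r) ≢ 0 → W (P + suc r) ≡ P + V (suc r)
    hh {r} v≢0 = begin
      W (P + suc r)                                   ≡⟨ W-r r ⟩
      act W₂ (swap P (act W₁ (swap P (P + a))))        ≡⟨ cong (act W₂ ∘ swap P ∘ act W₁) (swap-above above) ⟩
      act W₂ (swap P (act W₁ (P + a)))                 ≡⟨ cong (act W₂) (swap-above (split-> s₁′ above)) ⟩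
      act W₂ (act W₁ (P + a))                          ≡⟨ cong (act W₂) (split-hi s₁′ above) ⟩
      act W₂ (P + h₁ a)                                ≡⟨ W₂.+-hi (h₁ a) ⟩
      P + h₂ (h₁ a)                                    ≡⟨ cong (λ z → P + h₂ z) (swap-above (+-cancelˡ-< P 1 _ (subst₂ _<_ (sym P+1) (split-hi s₁′ above) (split-> s₁′ above)))) ⟨
      P + h₂ (swap 0 (h₁ a))                           ≡⟨ cong (P +_) (V-eq (suc r)) ⟨
      P + V (suc r)                                    ∎
      where
      open ≡-Reasoning
      a = h₀ (suc r)
      above : suc P < P + a
      above with m≤n⇒m<n∨m≡n (h₀>0 r)
      ... | inj₁ 1<a = subst (_< P + a) P+1 (+-monoʳ-< P 1<a)
      ... | inj₂ 1≡a = contradiction (V-zero r (sym 1≡a)) v≢0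

    j↓ : ∀ {r} → V (suc r) ≡ 0 → W (P + suc r) ≡ U P
    j↓ {r} v≡0 = begin
      W (P + suc r)                             ≡⟨ W-r r ⟩
      act W₂ (swap P (act W₁ (swap P (P + a)))) ≡⟨ cong (act W₂ ∘ swap P ∘ act W₁) (trans (cong (swap P) (trans (cong (P +_) a≡1) P+1)) (swap-right P)) ⟩
      act W₂ (swap P (act W₁ P))                ≡⟨ cong (act W₂) (swap-below (≤∧≢⇒< (proj₁ (split-≤ s₁ ≤-refl)) moves)) ⟩
      act W₂ (act W₁ P)                         ≡⟨ cong (act W₂ ∘ act W₁) W₀.fix ⟨
      act W₂ (act W₁ (act W₀ P))                ≡⟨ U-eq ≤-refl ⟨
      U P                                       ∎
      where
      open ≡-Reasoning
      a = h₀ (suc r)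
      a≡1 : a ≡ 1
      a≡1 = act-injective (hi P W₁) (trans (swap-injective 0 {h₁ a} {1} (act-injective (hi P W₂)
              (trans (trans (sym (V-eq (suc r))) v≡0) (sym W₂.hi-fix)))) (sym h₁1))

  glue⁺ : Glue P U V W
  glue⁺ = record { low = l ; jump↑ = j↑ ; mid = m ; high = hh ; jump↓ = j↓ }

open GlueUp public using (glue⁺)

-- The wire p goes down to position p-1 and returns.
Inner⁻ : ℕ → ℕ → Set
Inner⁻ p i = suc (suc i) < p ⊎ p ≤ i

-- Mirror image of `GlueUp`: the wire waits at position `p`, one below `P`. During `W₁` it is now
-- the letters from `P` on that move the content of position `P`, and the doubled letter `p` belongs
-- to the lower half.
module GlueDown {p W₂ W₁ W₀} (o₂ : All (Outer (suc p)) W₂) (i₁ : All (Inner⁻ (suc p)) W₁) (o₀ : All (Outer (suc p)) W₀)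
         (moves : act W₁ (suc p) ≢ suc p) where
  private
    P = suc p
    module W₂ = OuterWord o₂
    module W₀ = OuterWord o₀
    s₁ : All (Split P p) W₁
    s₁ = All.map (λ { (inj₁ (s≤s l)) → inj₁ (<-trans (n<1+n _) l , m<n⇒m<1+n (<-trans (n<1+n _) l)) ; (inj₂ g) → inj₂ (g , g) }) i₁
    W₁p : act W₁ p ≡ p
    W₁p = act-fix (All.map (λ { (inj₁ (s≤s l)) → <⇒≢ (<-trans (n<1+n _) l) , <⇒≢ l ; (inj₂ g) → >⇒≢ g , >⇒≢ (m<n⇒m<1+n g) }) i₁)
    h₂ = act (hi P W₂)
    h₁ = act (hi P W₁)
    h₀ = act (hi P W₀)
    U = act (lo P W₂ ++ p ∷ lo P W₁ ++ lo P W₀)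
    V = act (hi P W₂ ++ hi P W₁ ++ hi P W₀)
    W = act (W₂ ++ p ∷ W₁ ++ p ∷ W₀)
    P+0 = +-identityʳ P
    lo₁P : act (lo P W₁) P ≡ P
    lo₁P = act-fix (All.map (λ { (inj₁ l , g) → <⇒≢ g , <⇒≢ (<-trans (n<1+n _) l) ; (inj₂ g , l) → contradiction l (≤⇒≯ g) })
                 (All.zip (All.filter⁺ (_<? P) i₁ , All.all-filter (_<? P) W₁)))
    U-eq : ∀ {x} → x ≤ P → U x ≡ act (lo P W₂) (swap p (act (lo P W₁) (act W₀ x)))
    U-eq {x} x≤ = trans (act-++ (lo P W₂) _ x) (cong (act (lo P W₂) ∘ swap p) (trans (act-++ (lo P W₁) _ x)
      (cong (act (lo P W₁)) (sym (W₀.≤-lo x≤)))))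
    U-eq′ : ∀ {x} → x < P → U x ≡ act W₂ (swap p (act W₁ (act W₀ x)))
    U-eq′ {x} x<p = trans (U-eq (<⇒≤ x<p)) (trans (cong (act (lo P W₂) ∘ swap p) (sym eq)) (sym (W₂.≤-lo (swap-≤ ≤-refl (m≤n⇒m≤1+n le)))))
      where
      le = proj₁ (split-≤ s₁ (s≤s⁻¹ (W₀.<-pres x<p)))
      eq = proj₂ (split-≤ s₁ (s≤s⁻¹ (W₀.<-pres x<p)))
    V-eq : ∀ x → V x ≡ h₂ (h₁ (h₀ x))
    V-eq x = trans (act-++ (hi P W₂) _ x) (cong h₂ (act-++ (hi P W₁) _ x))
    W-eq : ∀ x → W x ≡ act W₂ (swap p (act W₁ (swap p (act W₀ x))))
    W-eq x = trans (act-++ W₂ _ x) (cong (act W₂ ∘ swap p) (act-++ W₁ _ x))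

    W₁P-above : P < act W₁ P
    W₁P-above = ≤∧≢⇒< (split-> s₁ (n<1+n p)) (moves ∘ sym)

    module _ {q} (q<p : q < P) (a≡p : act W₀ q ≡ p) where
      U-top : U q ≡ P
      U-top = trans (U-eq′ q<p) (trans (cong (act W₂) (trans (cong (swap p) (trans (cong (act W₁) a≡p) W₁p)) (swap-left p))) W₂.fix)
      W-top : W q ≡ P + V 0
      W-top = begin
        W q                                          ≡⟨ W-eq q ⟩
        act W₂ (swap p (act W₁ (swap p (act W₀ q)))) ≡⟨ cong (act W₂ ∘ swap p ∘ act W₁) (trans (cong (swap p) a≡p) (swap-left p)) ⟩
        act W₂ (swap p (act W₁ P))                   ≡⟨ cong (act W₂) (swap-above W₁P-above) ⟩
        act W₂ (act W₁ P)                            ≡⟨ cong (act W₂ ∘ act W₁) P+0 ⟨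
        act W₂ (act W₁ (P + 0))                      ≡⟨ cong (act W₂) (split-hi s₁ (s≤s (m≤m+n p 0))) ⟩
        act W₂ (P + h₁ 0)                            ≡⟨ W₂.+-hi (h₁ 0) ⟩
        P + h₂ (h₁ 0)                                ≡⟨ cong (λ z → P + h₂ (h₁ z)) W₀.hi-fix ⟨
        P + h₂ (h₁ (h₀ 0))                           ≡⟨ cong (P +_) (V-eq 0) ⟨
        P + V 0                                      ∎
        where open ≡-Reasoning

    module _ {q} (q<p : q < P) (a≢p : act W₀ q ≢ p) where
      a<p : act W₀ q < p
      a<p = ≤∧≢⇒< (s≤s⁻¹ (W₀.<-pres q<p)) a≢p
      b<p : act W₁ (act W₀ q) < p
      b<p = ≤∧≢⇒< (proj₁ (split-≤ s₁ (<⇒≤ a<p))) λ e → a≢p (act-injective W₁ (trans e (sym W₁p)))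
      U-same : U q ≡ act W₂ (act W₁ (act W₀ q))
      U-same = trans (U-eq′ q<p) (cong (act W₂) (swap-below b<p))
      U-low : U q < P
      U-low = subst (_< P) (sym U-same) (W₂.<-pres (m<n⇒m<1+n b<p))
      W-same : W q ≡ U q
      W-same = trans (W-eq q) (trans (cong (act W₂ ∘ swap p ∘ act W₁) (swap-below a<p))
                 (trans (cong (act W₂) (swap-below b<p)) (sym U-same)))

    l : ∀ {q} → q < P → U q < P → W q ≡ U q
    l {q} q<p u<p with act W₀ q ≟ p
    ... | yes e = contradiction (U-top q<p e) (<⇒≢ u<p)
    ... | no n  = W-same q<p n

    j↑ : ∀ {q} → q < P → U q ≡ P → W q ≡ P + V 0
    j↑ {q} q<p u≡p with act W₀ q ≟ p
    ... | yes e = W-top q<p e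
    ... | no n  = contradiction u≡p (<⇒≢ (U-low q<p n))

    m : W P ≡ P
    m = begin
      W P                                          ≡⟨ W-eq P ⟩
      act W₂ (swap p (act W₁ (swap p (act W₀ P)))) ≡⟨ cong (act W₂ ∘ swap p ∘ act W₁) (trans (cong (swap p) W₀.fix) (swap-right p)) ⟩
      act W₂ (swap p (act W₁ p))                   ≡⟨ cong (act W₂) (trans (cong (swap p) W₁p) (swap-left p)) ⟩
      act W₂ P                                     ≡⟨ W₂.fix ⟩
      P                                            ∎
      where open ≡-Reasoning

    W-r : ∀ r → W (P + suc r) ≡ act W₂ (swap p (P + h₁ (h₀ (suc r))))
    W-r r = trans (W-eq _) (cong (act W₂ ∘ swap p) (trans (cong (act W₁) (trans
        (swap-above (W₀.>-pres (m<m+n P z<s))) (W₀.+-hi (suc r)))) (split-hi s₁ (s≤s (m≤m+n p _)))))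

    hh : ∀ {r} → V (suc r) ≢ 0 → W (P + suc r) ≡ P + V (suc r)
    hh {r} v≢0 = trans (W-r r) (trans (cong (act W₂) (swap-above (m<m+n P (n≢0⇒n>0 b≢0))))
                   (trans (W₂.+-hi _) (cong (P +_) (sym (V-eq (suc r))))))
      where
      b≢0 : h₁ (h₀ (suc r)) ≢ 0
      b≢0 e = v≢0 (trans (V-eq (suc r)) (trans (cong h₂ e) W₂.hi-fix))

    j↓ : ∀ {r} → V (suc r) ≡ 0 → W (P + suc r) ≡ U P
    j↓ {r} v≡0 = begin
      W (P + suc r)                             ≡⟨ W-r r ⟩
      act W₂ (swap p (P + h₁ (h₀ (suc r))))     ≡⟨ cong (act W₂ ∘ swap p) (trans (cong (P +_) b≡0) P+0) ⟩
      act W₂ (swap p P)                         ≡⟨ cong (act W₂) (swap-right p) ⟩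
      act W₂ p                                  ≡⟨ W₂.≤-lo (n≤1+n p) ⟩
      act (lo P W₂) p                           ≡⟨ cong (act (lo P W₂)) (swap-right p) ⟨
      act (lo P W₂) (swap p P)                  ≡⟨ cong (act (lo P W₂) ∘ swap p) (trans (cong (act (lo P W₁)) W₀.fix) lo₁P) ⟨
      act (lo P W₂) (swap p (act (lo P W₁) (act W₀ P))) ≡⟨ U-eq ≤-refl ⟨
      U P                                       ∎
      where
      open ≡-Reasoning
      b≡0 : h₁ (h₀ (suc r)) ≡ 0
      b≡0 = act-injective (hi P W₂) (trans (sym (V-eq (suc r))) (trans v≡0 (sym W₂.hi-fix)))

  glue⁻ : Glue P U V W
  glue⁻ = record { low = l ; jump↑ = j↑ ; mid = m ; high = hh ; jump↓ = j↓ }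

open GlueDown public using (glue⁻)

-- Uniqueness of the glued bijection, and the cut in it

above⇒suc : ∀ {P x} → P < x → ∃[ r ] x ≡ P + suc r
above⇒suc {P} {x} P<x with x ∸ P | m<n⇒0<n∸m P<x | m+[n∸m]≡n (<⇒≤ P<x)
... | suc r | _ | eq = r , sym eq


module _ {P u v w w′} (G : Glue P u v w) (G′ : Glue P u v w′) (bu : Bounded P u) where
  private
    module G = Glue G
    module G′ = Glue G′

  -- This is how a word assembled from words of `u` and `v` is recognised as a word of a given
  -- gluing.
  glue-functional : w ≗ w′
  glue-functional x with <-cmp x P
  ... | tri≈ _ refl _ = trans G.mid (sym G′.mid)
  ... | tri< x<P _ _ with m≤n⇒m<n∨m≡n (Bounded.inside bu (<⇒≤ x<P))
  ...   | inj₁ l = trans (G.low x<P l) (sym (G′.low x<P l))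
  ...   | inj₂ e = trans (G.jump↑ x<P e) (sym (G′.jump↑ x<P e))
  glue-functional x | tri> _ _ P<x with above⇒suc P<x
  ... | r , refl with v (suc r) ≟ 0
  ...   | yes e = trans (G.jump↓ e) (sym (G′.jump↓ e))
  ...   | no n  = trans (G.high n) (sym (G′.high n))

-- The middle entry of a 321-pattern of a permutation avoiding 3421, 4312
-- and 4321.
record Cut (w : ℕ → ℕ) (p : ℕ) : Set where
  field
    fixed    : w p ≡ p
    x y      : ℕ
    x<p      : x < p
    p<wx     : p < w x
    unique-x : ∀ {z} → z < p → p < w z → z ≡ x
    p<y      : p < y
    wy<p     : w y < p
    unique-y : ∀ {z} → p < z → w z < p → z ≡ y

-- The wires passing `P` are the one that `u` sends to `P` and the one that `v` sends to 0. The
-- conditions on `u P` and `v 0` keep both away from `P` itself.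
glue⇒cut : ∀ {P u v w} → Glue P u v w → Bounded P u → Bij u → Bij v → u P ≢ P → v 0 ≢ 0 → Cut w P
glue⇒cut {P} {u} {v} {w} G bu (bij u-inj u-surj) (bij v-inj v-surj) uP≢ v0≢ = record
  { fixed = G.mid
  ; x = x ; y = P + r
  ; x<p = x<P
  ; p<wx = subst (P <_) (sym (G.jump↑ x<P ux)) (m<m+n P (n≢0⇒n>0 v0≢))
  ; unique-x = λ {z} z<P P<wz → case m≤n⇒m<n∨m≡n (Bounded.inside bu (<⇒≤ z<P)) of λ
      { (inj₁ l) → contradiction P<wz (<-asym (subst (_< P) (sym (G.low z<P l)) l))
      ; (inj₂ e) → u-inj (trans e (sym ux)) }
  ; p<y = m<m+n P (n≢0⇒n>0 r≢0)
  ; wy<p = below r vr r≢0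
  ; unique-y = λ {z} P<z wz<P → uniq z P<z wz<P
  }
  where
  module G = Glue G
  x = proj₁ (u-surj P)
  ux = proj₂ (u-surj P)
  r = proj₁ (v-surj 0)
  vr = proj₂ (v-surj 0)
  r≢0 : r ≢ 0
  r≢0 e = v0≢ (trans (cong v (sym e)) vr)
  x<P : x < P
  x<P with <-cmp x P
  ... | tri< l _ _ = l
  ... | tri≈ _ e _ = contradiction (trans (cong u (sym e)) ux) uP≢
  ... | tri> _ _ g = contradiction (trans (sym (Bounded.outside bu g)) ux) (>⇒≢ g)
  below : ∀ r → v r ≡ 0 → r ≢ 0 → w (P + r) < P
  below zero    _  r≢0 = contradiction refl r≢0
  below (suc r) vr _   = subst (_< P) (sym (G.jump↓ vr)) (≤∧≢⇒< (Bounded.inside bu ≤-refl) uP≢)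
  uniq : ∀ z → P < z → w z < P → z ≡ P + r
  uniq z P<z wz<P with above⇒suc P<z
  ... | r′ , refl with v (suc r′) ≟ 0
  ...   | yes e = cong (P +_) (v-inj (trans e (sym vr)))
  ...   | no n  = contradiction (≤-trans (m≤m+n P _) (≤-reflexive (sym (G.high n)))) (<⇒≱ wz<P)

-- Decomposing a reduced word at a cut

splitLast : ∀ {P : ℕ → Set} → (∀ i → Dec (P i)) → ∀ w →
            All (¬_ ∘ P) w ⊎ ∃[ u ] ∃[ i ] ∃[ v ] w ≡ u ++ i ∷ v × P i × All (¬_ ∘ P) v
splitLast P? []      = inj₁ []
splitLast P? (i ∷ w) with splitLast P? w
... | inj₂ (u , j , v , eq , p , ps) = inj₂ (i ∷ u , j , v , cong (i ∷_) eq , p , ps)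
... | inj₁ ps with P? i
...   | yes p = inj₂ ([] , i , w , refl , p , ps)
...   | no ¬p = inj₁ (¬p ∷ ps)

splitFirst : ∀ {P : ℕ → Set} → (∀ i → Dec (P i)) → ∀ w →
             All (¬_ ∘ P) w ⊎ ∃[ u ] ∃[ i ] ∃[ v ] w ≡ u ++ i ∷ v × P i × All (¬_ ∘ P) u
splitFirst P? []      = inj₁ []
splitFirst P? (i ∷ w) with P? i
... | yes p = inj₂ ([] , i , w , refl , p , [])
... | no ¬p with splitFirst P? w
...   | inj₁ ps = inj₁ (¬p ∷ ps)
...   | inj₂ (u , j , v , eq , p , ps) = inj₂ (i ∷ u , j , v , cong (i ∷_) eq , p , ¬p ∷ ps)

data Decomposition (p : ℕ) : List ℕ → Set where
  up   : ∀ {W₂ W₁ W₀} → All (Outer (suc p)) W₂ → All (Inner⁺ (suc p)) W₁ → All (Outer (suc p)) W₀ →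
         act W₁ (suc p) ≢ suc p → Decomposition p (W₂ ++ suc p ∷ W₁ ++ suc p ∷ W₀)
  down : ∀ {W₂ W₁ W₀} → All (Outer (suc p)) W₂ → All (Inner⁻ (suc p)) W₁ → All (Outer (suc p)) W₀ →
         act W₁ (suc p) ≢ suc p → Decomposition p (W₂ ++ p ∷ W₁ ++ p ∷ W₀)

outer-letter : ∀ {p i} → ¬ (i ≡ p ⊎ suc i ≡ p) → Outer p i
outer-letter {p} {i} ¬t with <-cmp (suc i) p
... | tri< l _ _ = inj₁ l
... | tri≈ _ e _ = contradiction (inj₂ e) ¬t
... | tri> _ _ (s≤s g) = inj₂ (≤∧≢⇒< g (¬t ∘ inj₁ ∘ sym))

inner⁺-letter : ∀ {p i} → ¬ (i ≡ suc p ⊎ suc i ≡ suc p) → Inner⁺ p i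
inner⁺-letter ¬t with outer-letter ¬t
... | inj₁ l = inj₁ (s<s⁻¹ l)
... | inj₂ g = inj₂ g

inner⁻-letter : ∀ {p i} → ¬ (i ≡ p ⊎ suc i ≡ p) → Inner⁻ (suc p) i
inner⁻-letter ¬t with outer-letter ¬t
... | inj₁ l = inj₁ (s≤s l)
... | inj₂ g = inj₂ g

-- The only wires that cross the wire p are those of the two wires that
-- the cut singles out, so following the wire p through the word leaves
-- little freedom.
module Trace {p w} (red : Red w) (cut : Cut (act w) (suc p)) where
  open Cut cut
  private
    P = suc p

    touches? : ∀ q i → Dec (i ≡ q ⊎ suc i ≡ q)
    touches? q i = (i ≟ q) ⊎-dec (suc i ≟ q)

    untouched : ∀ {q u} → All (λ i → ¬ (i ≡ q ⊎ suc i ≡ q)) u → act u q ≡ q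
    untouched = act-fix ∘ All.map λ ¬t → ¬t ∘ inj₁ , ¬t ∘ inj₂

    from-above : ∀ u {v z} → w ≡ u ++ v → P < z → act v z < act v P → z ≡ y
    from-above u refl P<z cr = unique-y P<z (subst (_ <_) fixed (crossing-persists u red P<z cr))

    from-below : ∀ u {v z} → w ≡ u ++ v → z < P → act v P < act v z → z ≡ x
    from-below u refl z<P cr = unique-x z<P (subst (_< _) fixed (crossing-persists u red z<P cr))

    sufRed : ∀ u {v} → w ≡ u ++ v → Red v
    sufRed u refl = Red-++ʳ u red

    step : ∀ {i v z z′} → Red (i ∷ v) → act v z ≡ i → act v z′ ≡ suc i → z < z′
    step (asc ∷ _) = asc

    -- Once `x` and `y` have passed, a further letter at the wire `P` would cross it with a wire
    -- that has to be one of these two, but each is already on its far side.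
    finish : ∀ W₂ {C} → w ≡ W₂ ++ C → act C P ≡ P → act C y < P → P < act C x → All (Outer P) W₂
    finish W₂ {C} eq atP yC xC with splitLast (touches? P) W₂
    ... | inj₁ ps = All.map outer-letter ps
    ... | inj₂ (D , j , E , refl , tj , ps) = ⊥-elim (absurd tj)
      where
      eq′ : w ≡ D ++ j ∷ E ++ C
      eq′ = trans eq (List.++-assoc D (j ∷ E) C)
      redj : Red (j ∷ E ++ C)
      redj = sufRed D eq′
      redE : Red (E ++ C)
      redE = case redj of λ { (_ ∷ r) → r }
      atE : act (E ++ C) P ≡ P
      atE = trans (act-++ E C P) (trans (cong (act E) atP) (untouched ps))
      yE : act (E ++ C) y < P
      yE = subst (_ <_) atE (crossing-persists E redE p<y (subst (_ <_) (sym atP) yC))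
      xE : P < act (E ++ C) x
      xE = subst (_< _) atE (crossing-persists E redE x<p (subst (_< _) (sym atP) xC))
      absurd : j ≡ P ⊎ suc j ≡ P → ⊥
      absurd (inj₁ refl) =
        let (z , ez) = act-surjective (E ++ C) (suc P)
            z≡y = from-above D eq′ (step redj atE ez)
                    (subst₂ _<_ (sym (trans (cong (swap P) ez) (swap-right P))) (sym (trans (cong (swap P) atE) (swap-left P))) (n<1+n P))
        in <-asym yE (subst (P <_) (sym (trans (cong (act (E ++ C)) (sym z≡y)) ez)) (n<1+n P))
      absurd (inj₂ refl) =
        let (z , ez) = act-surjective (E ++ C) p
            z≡x = from-below D eq′ (step redj ez atE)
                    (subst₂ _<_ (sym (trans (cong (swap p) atE) (swap-right p))) (sym (trans (cong (swap p) ez) (swap-left p))) (n<1+n p))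
        in <-asym xE (subst (_< P) (sym (trans (cong (act (E ++ C)) (sym z≡x)) ez)) (n<1+n p))

    go-up : ∀ A {W₀} → w ≡ A ++ P ∷ W₀ → All (Outer P) W₀ → Decomposition p w
    go-up A {W₀} eq o₀ with splitLast (touches? (suc P)) A
    -- Without another letter touching it, the wire would end at `suc P`, although `P` is fixed.
    ... | inj₁ ps = ⊥-elim (1+n≢n (trans (sym (trans (cong (λ v → act v P) eq) (trans (act-++ A _ P)
            (trans (cong (act A) (trans (cong (swap P) (outer-fix o₀)) (swap-left P))) (untouched ps))))) fixed))
    ... | inj₂ (W₂ , j , W₁ , refl , tj , ps) = second tj
      where
      C₀ = P ∷ W₀
      C₁ = W₁ ++ C₀
      red₀ = sufRed (W₂ ++ j ∷ W₁) eq
      eq₁ : w ≡ W₂ ++ j ∷ C₁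
      eq₁ = trans eq (List.++-assoc W₂ (j ∷ W₁) C₀)
      redj = sufRed W₂ eq₁
      red₁ : Red C₁
      red₁ = case redj of λ { (_ ∷ r) → r }
      at₀ : act C₀ P ≡ suc P
      at₀ = trans (cong (swap P) (outer-fix o₀)) (swap-left P)
      y₀ : act C₀ y ≡ P
      y₀ = let (z , ez) = act-surjective W₀ (suc P)
               zP = trans (cong (swap P) ez) (swap-right P)
               z≡y = from-above (W₂ ++ j ∷ W₁) eq (step red₀ (outer-fix o₀) ez) (subst₂ _<_ (sym zP) (sym at₀) (n<1+n P))
           in trans (cong (act C₀) (sym z≡y)) zP
      at₁ : act C₁ P ≡ suc P
      at₁ = trans (act-++ W₁ C₀ P) (trans (cong (act W₁) at₀) (untouched ps))
      y₁ : act C₁ y < act C₁ P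
      y₁ = crossing-persists W₁ red₁ p<y (subst₂ _<_ (sym y₀) (sym at₀) (n<1+n P))
      second : j ≡ suc P ⊎ suc j ≡ suc P → Decomposition p w
      -- Climbing further would cross another wire coming from above. It would have to be `y`, which
      -- lies below already.
      second (inj₁ refl) = ⊥-elim
        (let (z , ez) = act-surjective C₁ (suc (suc P))
             z≡y = from-above W₂ eq₁ (step redj at₁ ez)
                     (subst₂ _<_ (sym (trans (cong (swap (suc P)) ez) (swap-right (suc P)))) (sym (trans (cong (swap (suc P)) at₁) (swap-left (suc P)))) (n<1+n (suc P)))
         in <-asym (subst₂ _<_ (trans (cong (act C₁) (sym z≡y)) ez) at₁ y₁) (n<1+n (suc P)))
      second (inj₂ refl) = subst (Decomposition p) (sym eq₁)
        (up (finish W₂ eq₁ (trans (cong (swap P) at₁) (swap-right P)) y₂ x₂) (All.map inner⁺-letter ps) o₀ moves)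
        where
        at₂ = trans (cong (swap P) at₁) (swap-right P)
        y₂ : act (P ∷ C₁) y < P
        y₂ = subst (act (P ∷ C₁) y <_) at₂ (crossing-persists (P ∷ []) redj p<y y₁)
        x₂ : P < act (P ∷ C₁) x
        x₂ = let (z , ez) = act-surjective C₁ P
                 zP = trans (cong (swap P) ez) (swap-left P)
                 z≡x = from-below W₂ eq₁ (step redj ez at₁) (subst₂ _<_ (sym at₂) (sym zP) (n<1+n P))
             in subst (P <_) (sym (trans (cong (act (P ∷ C₁)) (sym z≡x)) zP)) (n<1+n P)
        -- If `W₁` kept position `P`, the second crossing would be with `y` again and undo the
        -- first.
        moves : act W₁ P ≢ P
        moves e = <-asym p<y (step redj (trans (act-++ W₁ C₀ y) (trans (cong (act W₁) y₀) e)) at₁)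

    go-down : ∀ A {W₀} → w ≡ A ++ p ∷ W₀ → All (Outer P) W₀ → Decomposition p w
    go-down A {W₀} eq o₀ with splitLast (touches? p) A
    ... | inj₁ ps = ⊥-elim (1+n≢n (trans (sym fixed) (trans (cong (λ v → act v P) eq) (trans (act-++ A _ P)
            (trans (cong (act A) (trans (cong (swap p) (outer-fix o₀)) (swap-right p))) (untouched ps))))))
    ... | inj₂ (W₂ , j , W₁ , refl , tj , ps) = second tj
      where
      C₀ = p ∷ W₀
      C₁ = W₁ ++ C₀
      red₀ = sufRed (W₂ ++ j ∷ W₁) eq
      eq₁ : w ≡ W₂ ++ j ∷ C₁
      eq₁ = trans eq (List.++-assoc W₂ (j ∷ W₁) C₀)
      redj = sufRed W₂ eq₁
      red₁ : Red C₁
      red₁ = case redj of λ { (_ ∷ r) → r }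
      at₀ : act C₀ P ≡ p
      at₀ = trans (cong (swap p) (outer-fix o₀)) (swap-right p)
      x₀ : act C₀ x ≡ P
      x₀ = let (z , ez) = act-surjective W₀ p
               zP = trans (cong (swap p) ez) (swap-left p)
               z≡x = from-below (W₂ ++ j ∷ W₁) eq (step red₀ ez (outer-fix o₀)) (subst₂ _<_ (sym at₀) (sym zP) (n<1+n p))
           in trans (cong (act C₀) (sym z≡x)) zP
      at₁ : act C₁ P ≡ p
      at₁ = trans (act-++ W₁ C₀ P) (trans (cong (act W₁) at₀) (untouched ps))
      x₁ : act C₁ P < act C₁ x
      x₁ = crossing-persists W₁ red₁ x<p (subst₂ _<_ (sym at₀) (sym x₀) (n<1+n p))
      second : j ≡ p ⊎ suc j ≡ p → Decomposition p w
      second (inj₂ refl) = ⊥-elim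
        (let (z , ez) = act-surjective C₁ j
             z≡x = from-below W₂ eq₁ (step redj ez at₁)
                     (subst₂ _<_ (sym (trans (cong (swap j) at₁) (swap-right j))) (sym (trans (cong (swap j) ez) (swap-left j))) (n<1+n j))
         in <-asym (subst₂ _<_ at₁ (trans (cong (act C₁) (sym z≡x)) ez) x₁) (n<1+n j))
      second (inj₁ refl) = subst (Decomposition p) (sym eq₁)
        (down (finish W₂ eq₁ at₂ y₂ x₂) (All.map inner⁻-letter ps) o₀ moves)
        where
        at₂ : act (p ∷ C₁) P ≡ P
        at₂ = trans (cong (swap p) at₁) (swap-left p)
        x₂ : P < act (p ∷ C₁) x
        x₂ = subst (_< act (p ∷ C₁) x) at₂ (crossing-persists (p ∷ []) redj x<p x₁)
        y₂ : act (p ∷ C₁) y < P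
        y₂ = let (z , ez) = act-surjective C₁ P
                 zP = trans (cong (swap p) ez) (swap-right p)
                 z≡y = from-above W₂ eq₁ (step redj at₁ ez) (subst₂ _<_ (sym zP) (sym at₂) (n<1+n p))
             in subst (_< P) (sym (trans (cong (act (p ∷ C₁)) (sym z≡y)) zP)) (n<1+n p)
        moves : act W₁ P ≢ P
        moves e = <-asym x<p (step redj at₁ (trans (act-++ W₁ C₀ x) (trans (cong (act W₁) x₀) e)))

  decompose : Decomposition p w
  -- Words act from the right, so this finds the first letter to act on the wire `P`. There is one,
  -- because `x` ends above `P` and hence the letter `P` occurs.
  decompose with splitLast (touches? P) w
  ... | inj₁ ps = ⊥-elim (<⇒≱ p<wx (preserves-≤ {w} (λ P∈ → All.lookup ps P∈ (inj₁ refl)) (<⇒≤ x<p)))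
  ... | inj₂ (A , _ , W₀ , eq , inj₁ refl , ps) = go-up A eq (All.map outer-letter ps)
  ... | inj₂ (A , _ , W₀ , eq , inj₂ refl , ps) = go-down A eq (All.map outer-letter ps)

open Trace public using (decompose)

-- Letter counts and fully commutative words

count : ℕ → List ℕ → ℕ
count i = length ∘ filter (i ≟_)

count-++ : ∀ i u v → count i (u ++ v) ≡ count i u + count i v
count-++ i u v = trans (cong length (List.filter-++ (i ≟_) u v)) (List.length-++ (filter (i ≟_) u))

count-here : ∀ i w → count i (i ∷ w) ≡ suc (count i w)
count-here i w = cong length (List.filter-accept (i ≟_) {xs = w} refl)

count-skip : ∀ {i j} w → j ≢ i → count i (j ∷ w) ≡ count i w
count-skip {i} w j≢i = cong length (List.filter-reject (i ≟_) {xs = w} (j≢i ∘ sym))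

count-none : ∀ {i w} → All (_≢ i) w → count i w ≡ 0
count-none {i} ps = cong length (List.filter-none (i ≟_) (All.map (λ n → n ∘ sym) ps))

count-∈ : ∀ {i w} → i ∈ w → 0 < count i w
count-∈ {i} {w} (here refl) = subst (0 <_) (sym (count-here i _)) z<s
count-∈ {i} {j ∷ w} (there i∈) with j ≟ i
... | yes refl = subst (0 <_) (sym (count-here i w)) z<s
... | no j≢i   = subst (0 <_) (sym (count-skip w j≢i)) (count-∈ i∈)

act-congʳ : ∀ u {v v′} → act v ≗ act v′ → act (u ++ v) ≗ act (u ++ v′)
act-congʳ u {v} {v′} eq x = trans (act-++ u v x) (trans (cong (act u) (eq x)) (sym (act-++ u v′ x)))

Far : ℕ → ℕ → Set
Far i k = suc k < i ⊎ suc i < k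

far-commute : ∀ {i k} → Far i k → ∀ x → swap k (swap i x) ≡ swap i (swap k x)
far-commute (inj₁ k<i) x = swap-commute k<i x
far-commute (inj₂ i<k) x = sym (swap-commute i<k x)

far-move : ∀ {i v} → All (Far i) v → ∀ u → act (v ++ i ∷ u) ≗ act (i ∷ v ++ u)
far-move []                     u x = refl
far-move {i} {k ∷ v} (f ∷ fs) u x = trans (cong (swap k) (far-move fs u x)) (far-commute f _)

far-cancel : ∀ {i v} → All (Far i) v → ∀ u → act (i ∷ v ++ i ∷ u) ≗ act (v ++ u)
far-cancel {i} fs u x = trans (cong (swap i) (far-move fs u x)) (swap-involutive i _)

-- The two `i` meet by commutations and cancel, which shortens the word by two.
¬Red-repeat : ∀ {i v u t} → All (Far i) v → ¬ Red (u ++ i ∷ v ++ i ∷ t)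
¬Red-repeat {i} {v} {u} {t} fs red = 1+n≰n (≤-trans (s≤s (n≤1+n _)) (subst₂ _≤_ len refl
  (Red⇒minimal (Red-++ʳ u red) (v ++ t) (λ x → sym (far-cancel fs t x)))))
  where
  len : length (i ∷ v ++ i ∷ t) ≡ suc (suc (length (v ++ t)))
  len = cong suc (trans (List.length-++ v) (trans (+-suc _ _) (cong suc (sym (List.length-++ v)))))

-- Full commutativity enters through letter counts: commutation moves preserve them, whereas a braid
-- move changes them.
record FCWord (w : List ℕ) : Set where
  constructor fcWord
  field
    red    : Red w
    counts : ∀ v → act v ≗ act w → length v ≡ length w → ∀ i → count i v ≡ count i w

Adjacent : ℕ → ℕ → Set
Adjacent i j = suc i ≡ j ⊎ i ≡ suc j

adjacent-braid : ∀ {i j} → Adjacent i j → ∀ x → swap i (swap j (swap i x)) ≡ swap j (swap i (swap j x))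
adjacent-braid (inj₁ refl) x = swap-braid _ x
adjacent-braid (inj₂ refl) x = sym (swap-braid _ x)

adjacent-≢ : ∀ {i j} → Adjacent i j → j ≢ i
adjacent-≢ (inj₁ refl) = 1+n≢n
adjacent-≢ (inj₂ refl) = 1+n≢n ∘ sym

far-≢ : ∀ {i k} → Far i k → k ≢ i
far-≢ (inj₁ k<i) = <⇒≢ (<-trans (n<1+n _) k<i)
far-≢ (inj₂ i<k) = >⇒≢ (<-trans (n<1+n _) i<k)

-- In a fully commutative word two consecutive i's whose neighbours in
-- between are all equal to j enclose two consecutive j's without an i
-- in between: no j would contradict reducedness, a single one would give
-- a braid, and the two sides of a braid differ in the number of i's.
¬fc-consecutive : ∀ {w i j} α {β γ} → FCWord w → w ≡ α ++ i ∷ β ++ i ∷ γ → Adjacent i j →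
                  All (λ k → k ≡ j ⊎ Far i k) β →
                  (∀ α {β γ} → w ≡ α ++ j ∷ β ++ j ∷ γ → All (λ k → k ≢ j × k ≢ i) β → ⊥) → ⊥
¬fc-consecutive {i = i} {j} α {β} {γ} fc refl adj all rec with splitFirst (_≟ j) β
... | inj₁ none = ¬Red-repeat {u = α} (All.map (λ { (inj₁ e , n) → contradiction e n ; (inj₂ f , _) → f }) (All.zip (all , none))) (FCWord.red fc)
... | inj₂ (β₁ , _ , β′ , refl , refl , none₁) with splitFirst (_≟ j) β′
...   | inj₂ (β₂ , _ , β₃ , refl , refl , none₂) =
  rec (α ++ i ∷ β₁) eq (All.map (λ { (n , inj₁ e) → contradiction e n ; (n , inj₂ f) → n , far-≢ f })
        (All.zip (none₂ , All.++⁻ˡ β₂ (All.tail (All.++⁻ʳ β₁ all)))))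
  where
  open ≡-Reasoning
  eq : α ++ i ∷ (β₁ ++ j ∷ β₂ ++ j ∷ β₃) ++ i ∷ γ ≡ (α ++ i ∷ β₁) ++ j ∷ β₂ ++ j ∷ β₃ ++ i ∷ γ
  eq = begin
    α ++ i ∷ (β₁ ++ j ∷ β₂ ++ j ∷ β₃) ++ i ∷ γ    ≡⟨ cong (λ z → α ++ i ∷ z) (List.++-assoc β₁ _ _) ⟩
    α ++ i ∷ β₁ ++ j ∷ (β₂ ++ j ∷ β₃) ++ i ∷ γ    ≡⟨ cong (λ z → α ++ i ∷ β₁ ++ j ∷ z) (List.++-assoc β₂ _ _) ⟩
    α ++ i ∷ β₁ ++ j ∷ β₂ ++ j ∷ β₃ ++ i ∷ γ      ≡⟨ List.++-assoc α (i ∷ β₁) _ ⟨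
    (α ++ i ∷ β₁) ++ j ∷ β₂ ++ j ∷ β₃ ++ i ∷ γ    ∎
...   | inj₁ none₂ = 1+n≢n (sym (trans (sym count′) (trans (FCWord.counts fc w′ same len i) count₀)))
  where
  fars : ∀ {v} → All (_≢ j) v → All (λ k → k ≡ j ⊎ Far i k) v → All (Far i) v
  fars n f = All.map (λ { (n , inj₁ e) → contradiction e n ; (n , inj₂ f) → f }) (All.zip (n , f))
  far₁ = fars none₁ (All.++⁻ˡ β₁ all)
  far₂ = fars none₂ (All.tail (All.++⁻ʳ β₁ all))
  -- In `w′` both `i` have been commuted up to the single `j`, and the braid is replaced by its
  -- other side, which has one `i` fewer.
  w w′ : List ℕ
  w  = α ++ i ∷ (β₁ ++ j ∷ β′) ++ i ∷ γ
  w′ = α ++ β₁ ++ j ∷ i ∷ j ∷ β′ ++ γ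
  same : act w′ ≗ act w
  same = act-congʳ α λ x → begin
    act (β₁ ++ j ∷ i ∷ j ∷ β′ ++ γ) x          ≡⟨ act-congʳ β₁ (λ z → sym (adjacent-braid adj _)) x ⟩
    act (β₁ ++ i ∷ j ∷ i ∷ β′ ++ γ) x          ≡⟨ far-move far₁ (j ∷ i ∷ β′ ++ γ) x ⟩
    act (i ∷ β₁ ++ j ∷ i ∷ β′ ++ γ) x          ≡⟨ cong (swap i) (act-congʳ β₁ (λ z → cong (swap j) (far-move far₂ γ z)) x) ⟨
    act (i ∷ β₁ ++ j ∷ β′ ++ i ∷ γ) x          ≡⟨ cong (λ z → act (i ∷ z) x) (List.++-assoc β₁ _ _) ⟨
    act (i ∷ (β₁ ++ j ∷ β′) ++ i ∷ γ) x        ∎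
    where
    open ≡-Reasoning
  L : List ℕ → ℕ
  L = length
  len : L w′ ≡ L w
  len = begin
    L w′                                                 ≡⟨ List.length-++ α ⟩
    L α + L (β₁ ++ j ∷ i ∷ j ∷ β′ ++ γ)                  ≡⟨ cong (L α +_) inner ⟩
    L α + L (i ∷ (β₁ ++ j ∷ β′) ++ i ∷ γ)                ≡⟨ List.length-++ α ⟨
    L w                                                  ∎
    where
    open ≡-Reasoning
    inner : L (β₁ ++ j ∷ i ∷ j ∷ β′ ++ γ) ≡ L (i ∷ (β₁ ++ j ∷ β′) ++ i ∷ γ)
    inner = begin
      L (β₁ ++ j ∷ i ∷ j ∷ β′ ++ γ)        ≡⟨ List.length-++ β₁ ⟩
      L β₁ + suc (suc (suc (L (β′ ++ γ))))  ≡⟨ +-suc (L β₁) _ ⟩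
      suc (L β₁ + suc (suc (L (β′ ++ γ))))  ≡⟨ cong (λ z → suc (L β₁ + suc z)) (sym (trans (List.length-++ β′) (trans (+-suc (L β′) _) (cong suc (sym (List.length-++ β′)))))) ⟩
      suc (L β₁ + suc (L (β′ ++ i ∷ γ)))    ≡⟨ cong suc (List.length-++ β₁) ⟨
      suc (L (β₁ ++ j ∷ β′ ++ i ∷ γ))       ≡⟨ cong (suc ∘ L) (List.++-assoc β₁ _ _) ⟨
      L (i ∷ (β₁ ++ j ∷ β′) ++ i ∷ γ)      ∎
  c = count i
  j≢i = adjacent-≢ adj
  c₁ : c β₁ ≡ 0
  c₁ = count-none (All.map far-≢ far₁)
  c₂ : c β′ ≡ 0
  c₂ = count-none (All.map far-≢ far₂)
  count′ : c w′ ≡ c α + suc (c γ)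
  count′ = trans (count-++ i α _) (cong (c α +_) (trans (count-++ i β₁ _) (trans (cong (_+ c (j ∷ i ∷ j ∷ β′ ++ γ)) c₁)
    (trans (count-skip _ j≢i) (trans (count-here i _) (cong suc (trans (count-skip _ j≢i)
      (trans (count-++ i β′ γ) (cong (_+ c γ) c₂)))))))))
  count₀ : c w ≡ suc (c α + suc (c γ))
  count₀ = trans (count-++ i α _) (trans (cong (c α +_) (trans (count-here i _) (cong suc
    (trans (count-++ i (β₁ ++ j ∷ β′) _) (trans (cong₂ _+_ zero′ (count-here i γ)) refl))))) (+-suc _ _))
    where
    zero′ : c (β₁ ++ j ∷ β′) ≡ 0
    zero′ = trans (count-++ i β₁ _) (trans (cong (_+ c (j ∷ β′)) c₁) (trans (count-skip β′ j≢i) c₂))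

-- Descent through the columns: a pair of `i` without `suc i` in between forces a pair of `i - 1`
-- without `i` in between. It ends at column 0, where there is no lower neighbour left.
¬fc-up : ∀ {w} i α {β γ} → FCWord w → w ≡ α ++ i ∷ β ++ i ∷ γ → All (λ k → k ≢ i × k ≢ suc i) β → ⊥
¬fc-up zero    α fc refl all = ¬Red-repeat {u = α} (All.map far all) (FCWord.red fc)
  where
  far : ∀ {k} → k ≢ 0 × k ≢ 1 → Far 0 k
  far {zero}        (n , _) = contradiction refl n
  far {suc zero}    (_ , n) = contradiction refl n
  far {suc (suc k)} _       = inj₂ (s≤s z<s)
¬fc-up (suc i) α fc eq all = ¬fc-consecutive α fc eq (inj₂ refl) (All.map cond all) λ α → ¬fc-up i α fc
  where
  cond : ∀ {k} → k ≢ suc i × k ≢ suc (suc i) → k ≡ i ⊎ Far (suc i) k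
  cond {k} (n , n′) with <-cmp k i
  ... | tri< l _ _ = inj₂ (inj₁ (s≤s l))
  ... | tri≈ _ e _ = inj₁ e
  ... | tri> _ _ g = inj₂ (inj₂ (≤∧≢⇒< (≤∧≢⇒< g (n ∘ sym)) (n′ ∘ sym)))

-- Here the same argument ascends, and the bound `m` on the letters ends it; `n` in `go` bounds the
-- number of columns still ahead.
¬fc-down : ∀ {w m} → FCWord w → All (_< m) w → ∀ i α {β γ} → w ≡ α ++ i ∷ β ++ i ∷ γ →
           All (λ k → k ≢ i × suc k ≢ i) β → ⊥
¬fc-down {w} {m} fc <m i α = go m i α (m≤n+m m i)
  where
  go : ∀ n i α {β γ} → m ≤ i + n → w ≡ α ++ i ∷ β ++ i ∷ γ → All (λ k → k ≢ i × suc k ≢ i) β → ⊥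
  go zero    i α le refl all = <⇒≱ (All.head (All.++⁻ʳ α <m)) (subst (m ≤_) (+-identityʳ i) le)
  go (suc n) i α le eq all = ¬fc-consecutive α fc eq (inj₁ refl) (All.map cond all)
      λ α eq′ all′ → go n (suc i) α (subst (m ≤_) (+-suc i n) le) eq′ (All.map (λ (a , b) → a , b ∘ suc-injective) all′)
    where
    cond : ∀ {k} → k ≢ i × suc k ≢ i → k ≡ suc i ⊎ Far i k
    cond {k} (n , n′) with <-cmp k (suc i)
    ... | tri≈ _ e _ = inj₁ e
    ... | tri> _ _ g = inj₂ (inj₂ g)
    ... | tri< l _ _ = inj₂ (inj₁ (≤∧≢⇒< (≤∧≢⇒< (s≤s⁻¹ l) n) n′))

-- Reduced words of a glued permutation

-- Whether A extends C to a reduced word depends only on the order of the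
-- wires at the positions that A moves.
Red-transfer : ∀ {Q : ℕ → Set} A {C D} → All (λ i → Q i × Q (suc i)) A → Red (A ++ C) → Red D →
               (∀ {a b a′ b′} → Q (act C a) → Q (act C b) → act C a ≡ act D a′ → act C b ≡ act D b′ → a < b → a′ < b′) →
               Red (A ++ D)
Red-transfer []          _  _           redD _ = redD
Red-transfer {Q} (i ∷ A) {C} {D} ((qi , qi′) ∷ qs) (asc ∷ red) redD tr = asc′ ∷ Red-transfer A qs red redD tr
  where
  back : ∀ {A} → All (λ i → Q i × Q (suc i)) A → ∀ {z} → Q (act A z) → Q z
  back []                  q = q
  back {i ∷ A} ((qi , qi′) ∷ qs) {z} q = back qs (unswap (act A z) q)
    where
    unswap : ∀ x → Q (swap i x) → Q x
    unswap x q with x ≟ i | x ≟ suc i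
    ... | yes refl | _        = qi
    ... | no _     | yes refl = qi′
    ... | no n     | no n′    = subst Q (swap-fix i n n′) q
  asc′ : ∀ {x y} → act (A ++ D) x ≡ i → act (A ++ D) y ≡ suc i → x < y
  asc′ {x} {y} ex ey =
    let (a , ea) = act-surjective C (act D x)
        (b , eb) = act-surjective C (act D y)
        ex′ = trans (trans (act-++ A C a) (trans (cong (act A) ea) (sym (act-++ A D x)))) ex
        ey′ = trans (trans (act-++ A C b) (trans (cong (act A) eb) (sym (act-++ A D y)))) ey
    in tr (back qs (subst Q (sym (trans (sym (act-++ A C a)) ex′)) qi))
          (back qs (subst Q (sym (trans (sym (act-++ A C b)) ey′)) qi′)) ea eb (asc ex′ ey′)

-- One letter changes the length of a shortest word by at most one. A word for `i ∷ w` with one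
-- letter less than the reduced `w` is therefore shortest.
uncrossed-Red : ∀ {w x y i} → Red w → (u : Uncrossed w x y) → act (Uncrossed.word u) ≗ act (i ∷ w) → Red (Uncrossed.word u)
uncrossed-Red {w} {i = i} red u eq = minimal⇒Red {P = λ _ → ⊤} (All.universal _ word) λ v _ eq′ →
  s≤s⁻¹ (subst (_≤ suc (length v)) shorter (Red⇒minimal red (i ∷ v) λ z →
    trans (cong (swap i) (trans (eq′ z) (eq z))) (swap-involutive i _)))
  where open Uncrossed u

∉⇒All : ∀ {i : ℕ} {w} → i ∉ w → All (_≢ i) w
∉⇒All i∉ = All.tabulate λ { j∈ refl → i∉ j∈ }

Red-shift : ∀ p {w} → Red w → Red (shift p w)
Red-shift p []          = []
Red-shift p {i ∷ w} (asc ∷ red) = asc′ ∷ Red-shift p red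
  where
  from : ∀ {x} → p ≤ act (shift p w) x → ∃[ r ] x ≡ p + r
  from {x} le with <-≤-connex x p
  ... | inj₁ x<p = contradiction (subst (p ≤_) (act-shift-below p w x<p) le) (<⇒≱ x<p)
  ... | inj₂ p≤x = x ∸ p , sym (m+[n∸m]≡n p≤x)
  asc′ : ∀ {x y} → act (shift p w) x ≡ p + i → act (shift p w) y ≡ suc (p + i) → x < y
  asc′ ex ey with from (subst (p ≤_) (sym ex) (m≤m+n p i)) | from (subst (p ≤_) (sym ey) (m≤n⇒m≤1+n (m≤m+n p i)))
  ... | a , refl | b , refl = +-monoʳ-< p (asc (+-cancelˡ-≡ p _ _ (trans (sym (act-shift p w a)) ex))
                                              (+-cancelˡ-≡ p _ _ (trans (trans (sym (act-shift p w b)) ey) (sym (+-suc p i)))))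

record SplitAt (i : ℕ) (P : ℕ → Set) (w : List ℕ) : Set where
  constructor splitAt
  field
    A B  : List ℕ
    allA : All P A
    allB : All P B
    same : act (A ++ i ∷ B) ≗ act w
    len  : length (A ++ i ∷ B) ≡ length w

splitAt-cons : ∀ {i P j w v} → P j → act v ≗ act (j ∷ w) → length w ≡ suc (length v) → SplitAt i P v → SplitAt i P w
splitAt-cons {j = j} pj eq l (splitAt A B allA allB same len) =
  splitAt (j ∷ A) B (pj ∷ allA) allB (λ x → trans (cong (swap j) (trans (same x) (eq x))) (swap-involutive j _))
          (trans (cong suc len) (sym l))

-- Multiplication from the left by `j`, `j - 1`, ..., 0 brings the wire 0 down from its final
-- position `suc j`, each step removing a letter. What remains is a reduced word fixing 0, in which
-- no letter 0 can occur. So `A` is `j`, ..., 1 and `B` is the remainder.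
split-first : ∀ j v → Red v → act v 0 ≡ suc j → SplitAt 0 (0 <_) v
split-first j v red v0 with act-surjective v j
... | zero  , vz = contradiction (trans (sym v0) vz) 1+n≢n
... | suc z , vz with exchange v {0} {suc z} z<s (subst₂ _<_ (sym vz) (sym v0) (n<1+n j))
...   | u with uncross-cons u v0 vz
split-first zero v red v0 | suc z , vz | u | eq =
  splitAt [] word [] (All.map n≢0⇒n>0 (∉⇒All 0∉)) (λ x → trans (cong (swap 0) (eq x)) (swap-involutive 0 _)) (sym shorter)
  where
  open Uncrossed u
  0∉ : 0 ∉ word
  0∉ 0∈ with crossed-gap (uncrossed-Red red u eq) 0∈
  ... | zero , _ , _ , _ , cr = n≮0 (subst (act word _ <_) (trans (eq 0) (cong (swap 0) v0)) cr)
split-first (suc j) v red v0 | suc z , vz | u | eq =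
  splitAt-cons z<s eq shorter (split-first j word (uncrossed-Red red u eq) (trans (eq 0) (trans (cong (swap (suc j)) v0) (swap-right (suc j)))))
  where open Uncrossed u

-- The mirror image of `split-first`: the letters `r`, ..., `p` lift the wire `suc p` from its final
-- position `r` back to `suc p`. The number `d` counts the steps before the letter `p`.
split-last : ∀ {p} d u r → d + r ≡ p → All (_< suc p) u → Red u → act u (suc p) ≡ r → SplitAt p (_< p) u
split-last {p} d u r d+r all red uP with act-surjective u (suc r)
... | z , uz with <-cmp z (suc p)
...   | tri≈ _ refl _ = contradiction (trans (sym uz) uP) 1+n≢n
...   | tri> _ _ g = contradiction (≤-<-trans (s≤s (m≤n+m r d)) (subst₂ _<_ (cong suc (sym d+r)) (trans (sym (act-above all g)) uz) g)) (<-irrefl refl)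
...   | tri< l _ _ with exchange u {z} {suc p} l (subst₂ _<_ (sym uP) (sym uz) (n<1+n r))
...     | t with uncross-cons t uz uP
split-last {p} zero u r refl all red uP | z , uz | tri< l _ _ | t | eq =
  splitAt [] word [] (All.map (λ (a , b) → ≤∧≢⇒< (s≤s⁻¹ a) b) (All.zip (all′ , ∉⇒All p∉)))
    (λ x → trans (cong (swap p) (eq x)) (swap-involutive p _)) (sym shorter)
  where
  open Uncrossed t
  all′ = letters all
  fixP : act word (suc p) ≡ suc p
  fixP = trans (eq (suc p)) (trans (cong (swap p) uP) (swap-left p))
  p∉ : p ∉ word
  p∉ p∈ with crossed-gap (uncrossed-Red red t eq) p∈
  ... | x , y , x≤p , p<y , cr = <⇒≱ cr (≤-trans (act-bounded all′ (m≤n⇒m≤1+n x≤p)) (go p<y))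
    where
    go : p < y → suc p ≤ act word y
    go p<y with m≤n⇒m<n∨m≡n p<y
    ... | inj₁ lt = ≤-trans p<y (≤-reflexive (sym (act-above all′ lt)))
    ... | inj₂ refl = ≤-reflexive (sym fixP)
split-last {p} (suc d) u r d+r all red uP | z , uz | tri< l _ _ | t | eq =
  splitAt-cons (subst (r <_) d+r (s≤s (m≤n+m r d))) eq shorter
    (split-last d word (suc r) (trans (+-suc d r) d+r) (letters all) (uncrossed-Red red t eq)
      (trans (eq (suc p)) (trans (cong (swap r) uP) (swap-left r))))
  where open Uncrossed t

glue-resp : ∀ {p u u′ v v′ w w′} → u ≗ u′ → v ≗ v′ → w ≗ w′ → Glue p u v w → Glue p u′ v′ w′
glue-resp eu ev ew G = record
  { low   = λ q<p l → trans (sym (ew _)) (trans (G.low q<p (subst (_< _) (sym (eu _)) l)) (eu _))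
  ; jump↑ = λ q<p e → trans (sym (ew _)) (trans (G.jump↑ q<p (trans (eu _) e)) (cong (_ +_) (ev 0)))
  ; mid   = trans (sym (ew _)) G.mid
  ; high  = λ n → trans (sym (ew _)) (trans (G.high (n ∘ trans (sym (ev _)))) (cong (_ +_) (ev _)))
  ; jump↓ = λ e → trans (sym (ew _)) (trans (G.jump↓ (trans (ev _) e)) (eu _))
  }
  where module G = Glue G

-- A heap inside `u` is a factor of a particular word of `u`, and it stays a factor only if that
-- word enters the word of the gluing uncut. The same goes for `v`. Only the other half may be
-- rearranged, and it is rearranged so that the letter at the gluing point occurs in it once.
module GluedWords {p u v} (redu : Red u) (allu : All (_< suc p) u) (uP≢ : act u (suc p) ≢ suc p)
                  (redv : Red v) (v0≢ : act v 0 ≢ 0) where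
  private
    P = suc p

  split-v : SplitAt 0 (0 <_) v
  split-v with act v 0 in e
  ... | zero  = contradiction refl v0≢
  ... | suc j = split-first j v redv e

  split-u : SplitAt p (_< p) u
  split-u = split-last (p ∸ act u P) u (act u P) (m∸n+n≡m (s≤s⁻¹ (≤∧≢⇒< (act-bounded allu ≤-refl) uP≢))) allu redu refl

  -- Around u: the word A 0 B of v becomes A P u P B.
  module Around-u (sp : SplitAt 0 (0 <_) v) where
    private
      open SplitAt sp

      A⁺ B⁺ C D : List ℕ
      A⁺ = shift P A
      B⁺ = shift P B
      C  = P ∷ B⁺
      D  = P ∷ u ++ C

      above : ∀ {w} → All (0 <_) w → All (P <_) (shift P w)
      above = All.map⁺ ∘ All.map (λ g → m<m+n P g)

      B-fix : ∀ {z} → z ≤ P → act B⁺ z ≡ z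
      B-fix z≤P = act-fix (All.map (λ g → >⇒≢ (≤-<-trans z≤P g) , >⇒≢ (m<n⇒m<1+n (≤-<-trans z≤P g))) (above allB))

      B-pres : ∀ {z} → P < z → P < act B⁺ z
      B-pres = preserves-> {B⁺} (λ P∈ → <-irrefl refl (All.lookup (above allB) P∈))

      C-below : ∀ {z} → z < P → act C z ≡ z
      C-below z<P = trans (cong (swap P) (B-fix (<⇒≤ z<P))) (swap-below z<P)

      C-P : act C P ≡ suc P
      C-P = trans (cong (swap P) (B-fix ≤-refl)) (swap-left P)

      redAC : Red (A⁺ ++ C)
      redAC = subst Red (trans (List.map-++ (P +_) A (0 ∷ B)) (cong (λ i → A⁺ ++ i ∷ B⁺) (+-identityʳ P)))
                (Red-shift P (Red-shortest redv same (≤-reflexive len)))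

      -- Among the positions up to `P`, `C` changes only the wire at `P`, and it puts one from above
      -- `P` there. So `u` meets the wires in the same order as without `C`.
      red₁ : Red (u ++ C)
      red₁ = Red-transfer {Q = _≤ P} u {[]} {C} (All.map (λ l → <⇒≤ l , l) allu) (subst Red (sym (List.++-identityʳ u)) redu)
               (Red-++ʳ A⁺ redAC) tr
        where
        tr : ∀ {a b a′ b′} → a ≤ P → b ≤ P → a ≡ act C a′ → b ≡ act C b′ → a < b → a′ < b′
        tr {a} {b} {a′} {b′} a≤ b≤ ea eb a<b =
          subst (_< b′) (act-injective C (trans (C-below a<P) ea)) (b-part (<-≤-connex b′ P))
          where
          a<P = <-≤-trans a<b b≤
          b-part : b′ < P ⊎ P ≤ b′ → a < b′
          b-part (inj₁ l) = subst (a <_) (trans eb (C-below l)) a<b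
          b-part (inj₂ g) = <-≤-trans a<P g

      u-above : ∀ {z} → P < z → act u z ≡ z
      u-above = act-above allu

      uC-P : act (u ++ C) P ≡ suc P
      uC-P = trans (act-++ u C P) (trans (cong (act u) C-P) (u-above (n<1+n P)))

      -- Position `P` now holds a wire below `P`, because `u` moves `P`, and position `suc P` holds
      -- the wire `P` itself.
      red₂ : Red D
      red₂ = asc ∷ red₁
        where
        asc : ∀ {a b} → act (u ++ C) a ≡ P → act (u ++ C) b ≡ suc P → a < b
        asc {a} {b} ea eb = subst (a <_) (act-injective (u ++ C) (trans uC-P (sym eb))) a<P
          where
          ea′ : act u (act C a) ≡ P
          ea′ = trans (sym (act-++ u C a)) ea
          a<P : a < P
          a<P with <-cmp (act C a) P
          ... | tri< l _ _ = subst (_< P) (act-injective C (C-below l)) l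
          ... | tri≈ _ e _ = contradiction (trans (cong (act u) (sym e)) ea′) uP≢
          ... | tri> _ _ g = contradiction (trans (sym (u-above g)) ea′) (>⇒≢ g)

      C-view : ∀ z → P < act C z → (z ≡ P × act C z ≡ suc P) ⊎ (P < z × suc P < act B⁺ z × act C z ≡ act B⁺ z)
      C-view z P<Cz with <-cmp z P
      ... | tri< l _ _ = contradiction (subst (P <_) (C-below l) P<Cz) (<-asym l)
      ... | tri≈ _ refl _ = inj₁ (refl , C-P)
      ... | tri> _ _ g with m≤n⇒m<n∨m≡n (B-pres g)
      ...   | inj₁ l = inj₂ (g , l , swap-above l)
      ...   | inj₂ e = contradiction (subst (P <_) (trans (cong (swap P) (sym e)) (swap-right P)) P<Cz) (<-irrefl refl)

      D-eq : ∀ z → act D z ≡ swap P (act u (act C z))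
      D-eq z = cong (swap P) (act-++ u C z)

      D-view : ∀ z → P < act D z → (z < P × act D z ≡ suc P) ⊎ (P < z × suc P < act B⁺ z × act D z ≡ act B⁺ z)
      D-view z P<Dz with <-cmp z P
      ... | tri≈ _ refl _ = contradiction (subst (P <_) (trans (cong (swap P) uC-P) (swap-right P)) P<Dz) (<-irrefl refl)
      ... | tri< l _ _ with m≤n⇒m<n∨m≡n (act-bounded allu (<⇒≤ l))
      ...   | inj₁ l′ = contradiction (subst (P <_) (trans (D-eq z) (trans (cong (swap P ∘ act u) (C-below l)) (swap-below l′))) P<Dz) (<-asym l′)
      ...   | inj₂ e  = inj₁ (l , trans (D-eq z) (trans (cong (swap P) (trans (cong (act u) (C-below l)) e)) (swap-left P)))
      D-view z P<Dz | tri> _ _ g with m≤n⇒m<n∨m≡n (B-pres g)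
      ...   | inj₁ l = inj₂ (g , l , trans (D-eq z) (trans (cong (swap P ∘ act u) (swap-above l))
                         (trans (cong (swap P) (u-above (<-trans (n<1+n P) l))) (swap-above l))))
      ...   | inj₂ e = contradiction (subst (P <_) (trans (D-eq z) (trans (cong (swap P ∘ act u) (trans (cong (swap P) (sym e)) (swap-right P)))
                         (swap-below u<P))) P<Dz) (<-asym u<P)
        where u<P = ≤∧≢⇒< (act-bounded allu ≤-refl) uP≢

      -- Above position `P` the words `C` and `D` differ only at `suc P`: there `C` has the wire `P`
      -- and `D` a wire below `P`. Either is smaller than all the others above.
      tr₃ : ∀ {a b a′ b′} → P < act C a → P < act C b → act C a ≡ act D a′ → act C b ≡ act D b′ → a < b → a′ < b′
      tr₃ {a} {b} {a′} {b′} Pa Pb ea eb a<b with D-view a′ (subst (P <_) ea Pa) | D-view b′ (subst (P <_) eb Pb)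
      ... | inj₁ (_ , da)     | inj₁ (_ , db) = contradiction (act-injective C (trans ea (trans da (trans (sym db) (sym eb))))) (<⇒≢ a<b)
      ... | inj₁ (a′<P , _)   | inj₂ (P<b′ , _) = <-trans a′<P P<b′
      ... | inj₂ (P<a′ , la , da) | vb with C-view a Pa | C-view b Pb
      ...   | inj₁ (_ , ca) | _ = contradiction (trans (sym da) (trans (sym ea) ca)) (>⇒≢ la)
      ...   | inj₂ (P<a , _ , ca) | inj₁ (refl , _) = contradiction a<b (<-asym P<a)
      ...   | inj₂ (P<a , _ , ca) | inj₂ (P<b , lb , cb) with vb
      ...     | inj₁ (_ , db) = contradiction (trans (sym db) (trans (sym eb) cb)) (<⇒≢ lb)
      ...     | inj₂ (_ , _ , db) = subst₂ _<_ (act-injective B⁺ (trans (sym ca) (trans ea da))) (act-injective B⁺ (trans (sym cb) (trans eb db))) a<b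

    left right word : List ℕ
    left  = A⁺ ++ P ∷ []
    right = C
    word  = A⁺ ++ D

    red : Red word
    red = Red-transfer {Q = P <_} A⁺ {C} {D} (All.map (λ g → g , m<n⇒m<1+n g) (above allA)) redAC red₂ tr₃

    factor : word ≡ left ++ u ++ right
    factor = sym (List.++-assoc A⁺ (P ∷ []) (u ++ C))

    glue : Glue P (act u) (act v) (act word)
    glue = glue-resp (λ x → cong (λ z → act z x) lo-eq) (λ x → trans (cong (λ z → act z x) hi-eq) (same x)) (λ _ → refl)
      (glue⁺ {p} {A⁺} {u} {B⁺} (All.map inj₂ (above allA)) (All.map inj₁ allu) (All.map inj₂ (above allB)) uP≢)
      where
      lo-eq : lo P A⁺ ++ lo P u ++ lo P B⁺ ≡ u
      lo-eq = trans (cong₂ _++_ (lo-none (shift-≥ P A)) (cong₂ _++_ (lo-all allu) (lo-none (shift-≥ P B)))) (List.++-identityʳ u)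
      hi-eq : hi P A⁺ ++ 0 ∷ hi P u ++ hi P B⁺ ≡ A ++ 0 ∷ B
      hi-eq = cong₂ (λ a b → a ++ 0 ∷ b) (hi-shift P A) (cong₂ _++_ (hi-none allu) (hi-shift P B))

    length-word : length word ≡ suc (length u + length v)
    length-word = begin
      length (A⁺ ++ P ∷ u ++ C)                          ≡⟨ List.length-++ A⁺ ⟩
      length A⁺ + suc (length (u ++ C))                  ≡⟨ cong₂ (λ a b → a + suc b) (List.length-map (P +_) A) (List.length-++ u) ⟩
      length A + suc (length u + suc (length B⁺))        ≡⟨ +-suc (length A) _ ⟩
      suc (length A + (length u + suc (length B⁺)))      ≡⟨ cong (λ z → suc (length A + (length u + suc z))) (List.length-map (P +_) B) ⟩
      suc (length A + (length u + suc (length B)))       ≡⟨ cong suc (x+[y+z]≡y+[x+z] (length A) (length u) _) ⟩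
      suc (length u + (length A + suc (length B)))       ≡⟨ cong (λ z → suc (length u + z)) (trans (sym (List.length-++ A)) len) ⟩
      suc (length u + length v)                          ∎
      where
      open ≡-Reasoning
      x+[y+z]≡y+[x+z] : ∀ x y z → x + (y + z) ≡ y + (x + z)
      x+[y+z]≡y+[x+z] x y z = trans (sym (+-assoc x y z)) (trans (cong (_+ z) (+-comm x y)) (+-assoc y x z))

  -- Around v: the word A p B of u becomes A p v p B.
  module Around-v (sp : SplitAt p (_< p) u) where
    private
      open SplitAt sp

      v⁺ C D : List ℕ
      v⁺ = shift P v
      C  = p ∷ B
      D  = p ∷ v⁺ ++ C

      B-fix : ∀ {z} → P ≤ z → act B z ≡ z
      B-fix P≤z = act-above allB P≤z

      B-pres : ∀ {z} → z ≤ p → act B z ≤ p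
      B-pres = act-bounded allB

      C-above : ∀ {z} → P < z → act C z ≡ z
      C-above P<z = trans (cong (swap p) (B-fix (<⇒≤ P<z))) (swap-above P<z)

      C-P : act C P ≡ p
      C-P = trans (cong (swap p) (B-fix ≤-refl)) (swap-right p)

      redAC : Red (A ++ C)
      redAC = Red-shortest redu same (≤-reflexive len)

      v-below : ∀ {z} → z < P → act v⁺ z ≡ z
      v-below = act-shift-below P v

      v-P : P < act v⁺ P
      v-P = subst₂ (λ a b → a < act v⁺ b) (+-identityʳ P) (+-identityʳ P)
              (subst (P + 0 <_) (sym (act-shift P v 0)) (+-monoʳ-< P (n≢0⇒n>0 v0≢)))

      v-≥ : ∀ {z} → P ≤ z → P ≤ act v⁺ z
      v-≥ {z} P≤z = subst (λ z → P ≤ act v⁺ z) (m+[n∸m]≡n P≤z) (≤-trans (m≤m+n P _) (≤-reflexive (sym (act-shift P v _))))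

      red₁ : Red (v⁺ ++ C)
      red₁ = Red-transfer {Q = P ≤_} v⁺ {[]} {C} (All.map (λ l → l , m≤n⇒m≤1+n l) (shift-≥ P v))
               (subst Red (sym (List.++-identityʳ v⁺)) (Red-shift P redv)) (Red-++ʳ A redAC) tr
        where
        tr : ∀ {a b a′ b′} → P ≤ a → P ≤ b → a ≡ act C a′ → b ≡ act C b′ → a < b → a′ < b′
        tr {a} {b} {a′} {b′} P≤a P≤b ea eb a<b =
          subst (a′ <_) (act-injective C (trans (C-above P<b) eb)) (a-part (≤-<-connex a′ P))
          where
          P<b = ≤-<-trans P≤a a<b
          a-part : a′ ≤ P ⊎ P < a′ → a′ < b
          a-part (inj₁ l) = ≤-<-trans l P<b
          a-part (inj₂ g) = subst (_< b) (trans ea (C-above g)) a<b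

      vC-P : act (v⁺ ++ C) P ≡ p
      vC-P = trans (act-++ v⁺ C P) (trans (cong (act v⁺) C-P) (v-below (n<1+n p)))

      red₂ : Red D
      red₂ = asc ∷ red₁
        where
        asc : ∀ {a b} → act (v⁺ ++ C) a ≡ p → act (v⁺ ++ C) b ≡ P → a < b
        asc {a} {b} ea eb = subst (_< b) (act-injective (v⁺ ++ C) (trans vC-P (sym ea))) P<b
          where
          eb′ : act v⁺ (act C b) ≡ P
          eb′ = trans (sym (act-++ v⁺ C b)) eb
          P<b : P < b
          P<b with <-cmp (act C b) P
          ... | tri> _ _ g = subst (P <_) (act-injective C (C-above g)) g
          ... | tri≈ _ e _ = contradiction (trans (cong (act v⁺) (sym e)) eb′) (>⇒≢ v-P)
          ... | tri< l _ _ = contradiction (trans (sym (v-below l)) eb′) (<⇒≢ l)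

      C-view : ∀ z → act C z ≤ p → (z ≡ P × act C z ≡ p) ⊎ (z < P × act B z < p × act C z ≡ act B z)
      C-view z Cz≤p with <-cmp z P
      ... | tri> _ _ g = contradiction (subst (_≤ p) (C-above g) Cz≤p) (<⇒≱ (<-trans (n<1+n p) g))
      ... | tri≈ _ refl _ = inj₁ (refl , C-P)
      ... | tri< l _ _ with m≤n⇒m<n∨m≡n (B-pres (s≤s⁻¹ l))
      ...   | inj₁ l′ = inj₂ (l , l′ , swap-below l′)
      ...   | inj₂ e  = contradiction (subst (_≤ p) (trans (cong (swap p) e) (swap-left p)) Cz≤p) 1+n≰n

      D-eq : ∀ z → act D z ≡ swap p (act v⁺ (act C z))
      D-eq z = cong (swap p) (act-++ v⁺ C z)

      D-view : ∀ z → act D z ≤ p → (P < z × act D z ≡ p) ⊎ (z < P × act B z < p × act D z ≡ act B z)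
      D-view z Dz≤p with <-cmp z P
      ... | tri≈ _ refl _ = contradiction (subst (_≤ p) (trans (cong (swap p) vC-P) (swap-left p)) Dz≤p) 1+n≰n
      ... | tri> _ _ g with m≤n⇒m<n∨m≡n (v-≥ (<⇒≤ g))
      ...   | inj₁ l′ = contradiction (subst (_≤ p) (trans (D-eq z) (trans (cong (swap p ∘ act v⁺) (C-above g)) (swap-above l′))) Dz≤p) (<⇒≱ (<-trans (n<1+n p) l′))
      ...   | inj₂ e  = inj₁ (g , trans (D-eq z) (trans (cong (swap p) (trans (cong (act v⁺) (C-above g)) (sym e))) (swap-right p)))
      D-view z Dz≤p | tri< l _ _ with m≤n⇒m<n∨m≡n (B-pres (s≤s⁻¹ l))
      ...   | inj₁ l′ = inj₂ (l , l′ , trans (D-eq z) (trans (cong (swap p ∘ act v⁺) (swap-below l′))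
                          (trans (cong (swap p) (v-below (m<n⇒m<1+n l′))) (swap-below l′))))
      ...   | inj₂ e  = contradiction (subst (_≤ p) (trans (D-eq z) (trans (cong (swap p ∘ act v⁺) (trans (cong (swap p) e) (swap-left p)))
                          (swap-above v-P))) Dz≤p) (<⇒≱ (<-trans (n<1+n p) v-P))

      -- Up to position `p` the words `C` and `D` differ only at `p`: there `C` has the wire `P` and
      -- `D` a wire above `P`. Either is larger than all the others.
      tr₃ : ∀ {a b a′ b′} → act C a ≤ p → act C b ≤ p → act C a ≡ act D a′ → act C b ≡ act D b′ → a < b → a′ < b′
      tr₃ {a} {b} {a′} {b′} Pa Pb ea eb a<b with C-view a Pa | C-view b Pb | D-view a′ (subst (_≤ p) ea Pa) | D-view b′ (subst (_≤ p) eb Pb)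
      ... | inj₁ (refl , _) | inj₁ (refl , _) | _ | _ = contradiction a<b (<-irrefl refl)
      ... | inj₁ (refl , _) | inj₂ (b<P , _) | _ | _ = contradiction a<b (<-asym b<P)
      ... | inj₂ (_ , la , ca) | _ | inj₁ (_ , da) | _ = contradiction (trans (sym ca) (trans ea da)) (<⇒≢ la)
      ... | inj₂ (_ , la , ca) | _ | inj₂ (a′<P , _ , da) | inj₁ (P<b′ , _) = <-trans a′<P P<b′
      ... | inj₂ (_ , la , ca) | inj₁ (_ , cb) | inj₂ (a′<P , _ , da) | inj₂ (_ , lb , db) = contradiction (trans (sym db) (trans (sym eb) cb)) (<⇒≢ lb)
      ... | inj₂ (_ , la , ca) | inj₂ (_ , _ , cb) | inj₂ (a′<P , _ , da) | inj₂ (_ , lb , db) =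
        subst₂ _<_ (act-injective B (trans (sym ca) (trans ea da))) (act-injective B (trans (sym cb) (trans eb db))) a<b

    left right word : List ℕ
    left  = A ++ p ∷ []
    right = C
    word  = A ++ D

    red : Red word
    red = Red-transfer {Q = _≤ p} A {C} {D} (All.map (λ l → <⇒≤ l , l) allA) redAC red₂ tr₃

    factor : word ≡ left ++ shift P v ++ right
    factor = sym (List.++-assoc A (p ∷ []) (v⁺ ++ C))

    glue : Glue P (act u) (act v) (act word)
    glue = glue-resp (λ x → trans (cong (λ z → act z x) lo-eq) (same x)) (λ x → cong (λ z → act z x) hi-eq) (λ _ → refl)
      (glue⁻ {p} {A} {v⁺} {B} (All.map (inj₁ ∘ s≤s) allA) (All.map inj₂ (shift-≥ P v)) (All.map (inj₁ ∘ s≤s) allB) (>⇒≢ v-P))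
      where
      lo-eq : lo P A ++ p ∷ lo P v⁺ ++ lo P B ≡ A ++ p ∷ B
      lo-eq = cong₂ (λ a b → a ++ p ∷ b) (lo-all (All.map m<n⇒m<1+n allA))
                (cong₂ _++_ (lo-none (shift-≥ P v)) (lo-all (All.map m<n⇒m<1+n allB)))
      hi-eq : hi P A ++ hi P v⁺ ++ hi P B ≡ v
      hi-eq = trans (cong₂ _++_ (hi-none (All.map m<n⇒m<1+n allA))
                (cong₂ _++_ (hi-shift P v) (hi-none (All.map m<n⇒m<1+n allB)))) (List.++-identityʳ v)

-- Factors of reduced words under gluing

record Contains (Q : List ℕ → Set) (g : ℕ → ℕ) : Set where
  constructor contains
  field
    heap   : List ℕ
    isQ    : Q heap
    before : List ℕ
    offset : ℕ
    after  : List ℕ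
    red    : Red (before ++ shift offset heap ++ after)
    same   : act (before ++ shift offset heap ++ after) ≗ g

Contains-resp : ∀ {Q g g′} → g ≗ g′ → Contains Q g → Contains Q g′
Contains-resp eq (contains H q X c Y red same) = contains H q X c Y red (λ x → trans (same x) (eq x))

record HeapShape (k : ℕ) (H : List ℕ) : Set where
  field
    fc       : FCWord H
    letters  : All (_< k) H
    internal : ∀ i → 0 < i → suc i < k → 2 ≤ count i H
    k≢2      : k ≢ 2

split-≡ : ∀ (X : List ℕ) {Z} W {j V} → X ++ Z ≡ W ++ j ∷ V →
          (∃[ X′ ] X ≡ W ++ j ∷ X′ × X′ ++ Z ≡ V) ⊎ (∃[ Z′ ] Z ≡ Z′ ++ j ∷ V × X ++ Z′ ≡ W)
split-≡ []      W       eq = inj₂ (W , eq , refl)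
split-≡ (x ∷ X) []      eq = inj₁ (X , cong (_∷ X) (List.∷-injectiveˡ eq) , List.∷-injectiveʳ eq)
split-≡ (x ∷ X) (i ∷ W) eq with split-≡ X W (List.∷-injectiveʳ eq)
... | inj₁ (X′ , e , e′) = inj₁ (X′ , cong₂ _∷_ (List.∷-injectiveˡ eq) e , e′)
... | inj₂ (Z′ , e , e′) = inj₂ (Z′ , e , cong₂ _∷_ (List.∷-injectiveˡ eq) e′)

-- A letter `j` outside `H` can be deleted without breaking the factor `H`. The constructors tell
-- which of the two can go; in `inH` neither can.
data Located (X H Y W₂ : List ℕ) (j : ℕ) (W₁ W₀ : List ℕ) : Set where
  inX : ∀ {X′} → X ≡ W₂ ++ j ∷ X′ → X′ ++ H ++ Y ≡ W₁ ++ j ∷ W₀ → Located X H Y W₂ j W₁ W₀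
  inY  : ∀ {Y′} → Y ≡ Y′ ++ j ∷ W₀ → X ++ H ++ Y′ ≡ W₂ ++ j ∷ W₁ → Located X H Y W₂ j W₁ W₀
  inH : ∀ {α γ} → H ≡ α ++ j ∷ W₁ ++ j ∷ γ → Located X H Y W₂ j W₁ W₀

locate : ∀ X H Y W₂ j W₁ W₀ → X ++ H ++ Y ≡ W₂ ++ j ∷ W₁ ++ j ∷ W₀ → Located X H Y W₂ j W₁ W₀
locate X H Y W₂ j W₁ W₀ eq with split-≡ X W₂ eq
... | inj₁ (X′ , e , e′) = inX e e′
... | inj₂ (Z′ , e , e′) with split-≡ H (Z′ ++ j ∷ W₁) (trans e (sym (List.++-assoc Z′ (j ∷ W₁) (j ∷ W₀))))
...   | inj₁ (γ , f , f′) = inH {α = Z′} {γ} (trans f (List.++-assoc Z′ (j ∷ W₁) (j ∷ γ)))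
...   | inj₂ (Y′ , f , f′) = inY f (trans (cong (X ++_) f′) (trans (sym (List.++-assoc X Z′ (j ∷ W₁))) (cong (_++ j ∷ W₁) e′)))

two-occurrences : ∀ {i} w → 2 ≤ count i w → ∃[ α ] ∃[ β ] ∃[ γ ] w ≡ α ++ i ∷ β ++ i ∷ γ × All (_≢ i) β
two-occurrences {i} w le with splitFirst (_≟ i) w
... | inj₁ none = contradiction (subst (2 ≤_) (count-none none) le) λ ()
... | inj₂ (α , _ , w′ , refl , refl , none) with splitFirst (_≟ i) w′
...   | inj₂ (β , _ , γ , refl , refl , none′) = α , β , γ , refl , none′
...   | inj₁ none′ = contradiction (subst (2 ≤_) eq le) λ { (s≤s ()) }
  where
  eq : count i (α ++ i ∷ w′) ≡ 1
  eq = trans (count-++ i α _) (cong₂ _+_ (count-none none) (trans (count-here i w′) (cong suc (count-none none′))))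

count-split : ∀ i u {v} → 0 < count i (u ++ i ∷ v)
count-split i u {v} = subst (0 <_) (sym (trans (count-++ i u _) (trans (cong (count i u +_) (count-here i v)) (+-suc _ _)))) z<s

-- The letter `j` is the one by which the wire of the cut makes its two crossings, and `j′` is the
-- other letter next to that wire's position, which occurs in `W₁` only. Neither can occur twice in
-- `H`.
module Straddle {j j′ : ℕ} {X H Y W₂ W₁ W₀ : List ℕ} (eq : X ++ H ++ Y ≡ W₂ ++ j ∷ W₁ ++ j ∷ W₀) (j′≢j : j′ ≢ j)
                (j₂ : All (_≢ j) W₂) (j₁ : All (_≢ j) W₁) (j₀ : All (_≢ j) W₀)
                (j′₂ : All (_≢ j′) W₂) (j′₀ : All (_≢ j′) W₀)
                (apart : ∀ {α γ} → H ≡ α ++ j ∷ W₁ ++ j ∷ γ → ⊥)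
                (between : ∀ {α β γ} → H ≡ α ++ j′ ∷ β ++ j′ ∷ γ → All (_≢ j′) β → All (_≢ j) β → ⊥) where
  private
    c = count j

    total : c (X ++ H ++ Y) ≡ 2
    total = trans (cong c eq) (trans (count-++ j W₂ _) (trans (cong₂ _+_ (count-none j₂) (count-here j _))
      (cong suc (trans (count-++ j W₁ _) (cong₂ _+_ (count-none j₁) (trans (count-here j _) (cong suc (count-none j₀))))))))

    total′ : c X + (c H + c Y) ≡ 2
    total′ = trans (cong (c X +_) (sym (count-++ j H Y))) (trans (sym (count-++ j X _)) total)

  count-centre : ¬ 2 ≤ count j H
  count-centre 2≤ with locate X H Y W₂ j W₁ W₀ eq
  ... | inX refl _ = contradiction (subst (3 ≤_) total′ (+-mono-≤ (count-split j W₂) (≤-trans 2≤ (m≤m+n _ (c Y))))) λ { (s≤s (s≤s ())) }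
  ... | inY {Y′} refl _ = contradiction (subst (3 ≤_) total′ (≤-trans (+-mono-≤ 2≤ (count-split j Y′)) (m≤n+m _ (c X)))) λ { (s≤s (s≤s ())) }
  ... | inH {α} {γ} e = apart {α} {γ} e

  count-side : ¬ 2 ≤ count j′ H
  count-side 2≤ with two-occurrences H 2≤
  ... | α , β , γ , refl , none with _∈?_ _≟_ j β
  ...   | no j∉β = between {α} {β} {γ} refl none (∉⇒All j∉β)
  -- Both `j′` lie inside `W₁`, so one `j` precedes and one follows them. With the one in between
  -- there would be three.
  ...   | yes j∈β = contradiction (≤-trans (+-mono-≤ left (+-mono-≤ (count-∈ j∈β) right)) (≤-reflexive total″)) λ { (s≤s (s≤s ())) }
    where
    skip : ∀ w → c (j′ ∷ w) ≡ c w
    skip w = count-skip w j′≢j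
    open ≡-Reasoning
    total″ : c (X ++ α) + (c β + c (γ ++ Y)) ≡ 2
    total″ = begin
      c (X ++ α) + (c β + c (γ ++ Y))                 ≡⟨ cong (λ z → c (X ++ α) + (c β + z)) (skip _) ⟨
      c (X ++ α) + (c β + c (j′ ∷ γ ++ Y))            ≡⟨ cong (c (X ++ α) +_) (count-++ j β _) ⟨
      c (X ++ α) + c (β ++ j′ ∷ γ ++ Y)               ≡⟨ cong (c (X ++ α) +_) (skip _) ⟨
      c (X ++ α) + c (j′ ∷ β ++ j′ ∷ γ ++ Y)          ≡⟨ count-++ j (X ++ α) _ ⟨
      c ((X ++ α) ++ j′ ∷ β ++ j′ ∷ γ ++ Y)           ≡⟨ cong c assoc ⟨
      c (X ++ (α ++ j′ ∷ β ++ j′ ∷ γ) ++ Y)           ≡⟨ total ⟩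
      2                                               ∎
      where
      assoc : X ++ (α ++ j′ ∷ β ++ j′ ∷ γ) ++ Y ≡ (X ++ α) ++ j′ ∷ β ++ j′ ∷ γ ++ Y
      assoc = trans (cong (X ++_) (trans (List.++-assoc α _ Y) (cong (λ z → α ++ j′ ∷ z) (List.++-assoc β _ Y)))) (sym (List.++-assoc X α _))
    eqˡ : (X ++ α) ++ (j′ ∷ β ++ j′ ∷ γ) ++ Y ≡ W₂ ++ j ∷ W₁ ++ j ∷ W₀
    eqˡ = trans (trans (List.++-assoc X α _) (cong (X ++_) (sym (List.++-assoc α _ Y)))) eq
    eqʳ : (X ++ α ++ j′ ∷ β) ++ (j′ ∷ γ) ++ Y ≡ (W₂ ++ j ∷ W₁) ++ j ∷ W₀
    eqʳ = trans (trans (List.++-assoc X _ _) (cong (X ++_) (trans (sym (List.++-assoc (α ++ j′ ∷ β) (j′ ∷ γ) Y))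
            (cong (_++ Y) (List.++-assoc α (j′ ∷ β) _))))) (trans eq (sym (List.++-assoc W₂ _ _)))
    left : 1 ≤ c (X ++ α)
    left with split-≡ (X ++ α) W₂ eqˡ
    ... | inj₁ (_ , e , _) = subst (λ z → 0 < c z) (sym e) (count-split j W₂)
    ... | inj₂ ([] , e , _) = contradiction (List.∷-injectiveˡ e) j′≢j
    ... | inj₂ (i ∷ _ , e , e′) = contradiction (sym (List.∷-injectiveˡ e))
            (All.head (All.++⁻ʳ (X ++ α) (subst (All (_≢ j′)) (sym e′) j′₂)))
    right : 1 ≤ c (γ ++ Y)
    right with split-≡ (X ++ α ++ j′ ∷ β) (W₂ ++ j ∷ W₁) eqʳ
    ... | inj₁ (X′ , _ , e′) = contradiction refl (All.head (All.++⁻ʳ X′ (subst (All (_≢ j′)) (sym e′) j′₀)))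
    ... | inj₂ ([] , e , _) = contradiction (List.∷-injectiveˡ e) j′≢j
    ... | inj₂ (i ∷ Z′ , e , _) = subst (λ z → 0 < c z) (sym (List.∷-injectiveʳ e)) (count-split j Z′)

unshift : ℕ → List ℕ → List ℕ
unshift c = map (_∸ c)

unshift-shift : ∀ c w → unshift c (shift c w) ≡ w
unshift-shift c w = trans (sym (List.map-∘ w)) (trans (List.map-cong (m+n∸m≡n c) w) (List.map-id w))

count-shift : ∀ c i w → count (c + i) (shift c w) ≡ count i w
count-shift c i []      = refl
count-shift c i (j ∷ w) with j ≟ i
... | yes refl = trans (count-here (c + i) _) (trans (cong suc (count-shift c i w)) (sym (count-here i w)))
... | no j≢i   = trans (count-skip _ (j≢i ∘ +-cancelˡ-≡ c _ _)) (trans (count-shift c i w) (sym (count-skip w j≢i)))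

unshift-split : ∀ c {w} α {i β γ} → shift c w ≡ α ++ i ∷ β ++ i ∷ γ →
                w ≡ unshift c α ++ (i ∸ c) ∷ unshift c β ++ (i ∸ c) ∷ unshift c γ × c ≤ i × All (c ≤_) β
unshift-split c {w} α {i} {β} {γ} eq =
  trans (sym (unshift-shift c w)) (trans (cong (unshift c) eq)
    (trans (List.map-++ (_∸ c) α _) (cong (λ z → unshift c α ++ (i ∸ c) ∷ z) (List.map-++ (_∸ c) β _)))) ,
  All.head r , All.++⁻ˡ β (All.tail r)
  where r = All.++⁻ʳ α (subst (All (c ≤_)) eq (shift-≥ c w))

¬fc-up-shift : ∀ c {w} → FCWord w → ∀ α {i β γ} → shift c w ≡ α ++ i ∷ β ++ i ∷ γ → All (λ k → k ≢ i × k ≢ suc i) β → ⊥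
¬fc-up-shift c fc α {i} eq all with unshift-split c α eq
... | eq′ , c≤i , c≤β = ¬fc-up (i ∸ c) (unshift c α) fc eq′ (All.map⁺ (All.map
        (λ { {k} (c≤k , n , n′) → (λ e → n (∸-cancelʳ-≡ c≤k c≤i e)) ,
                                  (λ e → n′ (∸-cancelʳ-≡ c≤k (m≤n⇒m≤1+n c≤i) (trans e (sym (+-∸-assoc 1 c≤i))))) }) (All.zip (c≤β , all))))

¬fc-down-shift : ∀ c {w m} → FCWord w → All (_< m) w → ∀ α {i β γ} → shift c w ≡ α ++ i ∷ β ++ i ∷ γ →
                 All (λ k → k ≢ i × suc k ≢ i) β → ⊥
¬fc-down-shift c fc <m α {i} eq all with unshift-split c α eq
... | eq′ , c≤i , c≤β = ¬fc-down fc <m (i ∸ c) (unshift c α) eq′ (All.map⁺ (All.map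
        (λ { {k} (c≤k , n , n′) → (λ e → n (∸-cancelʳ-≡ c≤k c≤i e)) ,
                                  (λ e → n′ (∸-cancelʳ-≡ (m≤n⇒m≤1+n c≤k) c≤i (trans (+-∸-assoc 1 c≤k) e))) }) (All.zip (c≤β , all))))

-- A heap reaching across the gluing point has one of the columns s_{p-1}
-- and s_p as an internal column, since these are not all its columns.
straddle-count : ∀ {k H} → HeapShape k H → ∀ {c p} → c < suc p → suc p < c + k →
                 2 ≤ count p (shift c H) ⊎ 2 ≤ count (suc p) (shift c H)
straddle-count {k} {H} sh {c} {p} (s≤s c≤p) P<c+k with m≤n⇒m<n∨m≡n c≤p
... | inj₁ c<p with above⇒suc c<p
...   | d , refl = inj₁ (subst (2 ≤_) (sym (count-shift c (suc d) H))
          (internal (suc d) z<s (+-cancelˡ-< c _ _ (subst (_< c + k) (sym (+-suc c (suc d))) P<c+k))))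
  where open HeapShape sh
straddle-count {k} {H} sh {c} (s≤s c≤p) P<c+k | inj₂ refl =
  inj₂ (subst (2 ≤_) (trans (sym (count-shift c 1 H)) (cong (λ z → count z (shift c H)) (+-comm c 1)))
    (internal 1 z<s (≤∧≢⇒< (+-cancelˡ-< c 1 k (subst (_< c + k) (+-comm 1 c) P<c+k)) (k≢2 ∘ sym))))
  where open HeapShape sh

-- A letter from `n` on would let some wire pass upwards beyond a fixed point. It would end at a
-- fixed point other than itself, against injectivity.
bounded-letters : ∀ {n w} → Red w → (∀ {x} → n < x → act w x ≡ x) → All (_< n) w
bounded-letters {n} {w} red fix = All.tabulate λ {j} j∈ → ≰⇒> λ n≤j →
  let (x , y , x≤j , j<y , cr) = crossed-gap red j∈
      y<wx = subst (_< act w x) (fix (≤-<-trans n≤j j<y)) cr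
      wx≡x = act-injective w (fix (≤-<-trans n≤j (<-trans j<y y<wx)))
  in <-asym j<y (<-≤-trans (subst (y <_) wx≡x y<wx) x≤j)

length-remove : ∀ (u : List ℕ) {i v} → length (u ++ i ∷ v) ≡ suc (length (u ++ v))
length-remove u = trans (List.length-++ u) (trans (+-suc _ _) (cong suc (sym (List.length-++ u))))

module GlueContains {p u v g} (redu : Red u) (allu : All (_< suc p) u) (uP≢ : act u (suc p) ≢ suc p)
                    (redv : Red v) (v0≢ : act v 0 ≢ 0) (G : Glue (suc p) (act u) (act v) g) where
  private
    P = suc p
    bu = act-Bounded allu

  module _ {Q : List ℕ → Set} where

    -- The word of `u` that exhibits the heap takes the place of the given one, so that the heap's
    -- factor survives the gluing.
    contains-glue⇐ˡ : Contains Q (act u) → Contains Q g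
    contains-glue⇐ˡ (contains H q X c Y red same) = contains H q (left ++ X) c (Y ++ right)
      (subst Red eq W.red)
      λ x → trans (cong (λ z → act z x) (sym eq)) (glue-functional (glue-resp same (λ _ → refl) (λ _ → refl) W.glue) G bu x)
      where
      u′ = X ++ shift c H ++ Y
      allu′ : All (_< P) u′
      allu′ = bounded-letters red λ P<x → trans (same _) (Bounded.outside bu P<x)
      module GW = GluedWords {p} {u′} {v} red allu′ (uP≢ ∘ trans (sym (same P))) redv v0≢
      module W = GW.Around-u GW.split-v
      open W using (left; right)
      eq : W.word ≡ (left ++ X) ++ shift c H ++ Y ++ right
      eq = trans W.factor (trans (cong (left ++_) (trans (List.++-assoc X (shift c H ++ Y) right) (cong (X ++_) (List.++-assoc (shift c H) Y right))))
             (sym (List.++-assoc left X _)))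

    contains-glue⇐ʳ : Contains Q (act v) → Contains Q g
    contains-glue⇐ʳ (contains H q X c Y red same) = contains H q (left ++ shift P X) (P + c) (shift P Y ++ right)
      (subst Red eq W.red)
      λ x → trans (cong (λ z → act z x) (sym eq)) (glue-functional (glue-resp (λ _ → refl) same (λ _ → refl) W.glue) G bu x)
      where
      v′ = X ++ shift c H ++ Y
      module GW = GluedWords {p} {u} {v′} redu allu uP≢ red (v0≢ ∘ trans (sym (same 0)))
      module W = GW.Around-v GW.split-u
      open W using (left; right)
      shift-eq : shift P v′ ≡ shift P X ++ shift (P + c) H ++ shift P Y
      shift-eq = trans (List.map-++ (P +_) X _) (cong (shift P X ++_) (trans (List.map-++ (P +_) (shift c H) Y)
        (cong (_++ shift P Y) (trans (sym (List.map-∘ H)) (List.map-cong (λ i → sym (+-assoc P c i)) H)))))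
      eq : W.word ≡ (left ++ shift P X) ++ shift (P + c) H ++ shift P Y ++ right
      eq = trans W.factor (trans (cong (λ z → left ++ z ++ right) shift-eq) (trans (cong (left ++_)
             (trans (List.++-assoc (shift P X) _ right) (cong (shift P X ++_) (List.++-assoc (shift (P + c) H) _ right))))
             (sym (List.++-assoc left (shift P X) _))))

    module _ {k} (shape : ∀ {H} → Q H → HeapShape k H) where

      private
        -- Lengths are additive under gluing, so both halves of a
        -- reduced word of g are reduced.
        module Halves {w} (redw : Red w) (samew : act w ≗ g) uw vw (same-u : act uw ≗ act u) (same-v : act vw ≗ act v)
                      (lengths : length w ≡ suc (length uw + length vw)) where
          module GW = GluedWords redu allu uP≢ redv v0≢
          module W = GW.Around-u GW.split-v
          total : length uw + length vw ≤ length u + length v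
          total = s≤s⁻¹ (subst₂ _≤_ lengths W.length-word
            (Red⇒minimal redw W.word λ x → trans (glue-functional W.glue G bu x) (sym (samew x))))
          u-short : length uw ≤ length u
          u-short = +-cancelʳ-≤ (length v) _ _ (≤-trans (+-monoʳ-≤ (length uw) (Red⇒minimal redv vw same-v)) total)
          v-short : length vw ≤ length v
          v-short = +-cancelˡ-≤ (length u) _ _ (≤-trans (+-monoˡ-≤ (length vw) (Red⇒minimal redu uw same-u)) total)
          inˡ : ∀ {H} → Q H → ∀ X c Y → act (X ++ shift c H ++ Y) ≗ act uw → length (X ++ shift c H ++ Y) ≡ length uw → Contains Q (act u)
          inˡ {H} q X c Y same len = contains H q X c Y (Red-shortest redu same′ (≤-trans (≤-reflexive len) u-short)) same′
            where same′ = λ x → trans (same x) (same-u x)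
          inʳ : ∀ {H} → Q H → ∀ X c Y → act (X ++ shift c H ++ Y) ≗ act vw → length (X ++ shift c H ++ Y) ≡ length vw → Contains Q (act v)
          inʳ {H} q X c Y same len = contains H q X c Y (Red-shortest redv same′ (≤-trans (≤-reflexive len) v-short)) same′
            where same′ = λ x → trans (same x) (same-v x)

        lo-factor : ∀ {k H} X c Y → All (_< k) H → c + k ≤ P → lo P (X ++ shift c H ++ Y) ≡ lo P X ++ shift c H ++ lo P Y
        lo-factor {k} {H} X c Y all le = trans (lo-++ P X _) (cong (lo P X ++_) (trans (lo-++ P (shift c H) Y)
          (cong (_++ lo P Y) (lo-all (All.map⁺ (All.map (λ h<k → <-≤-trans (+-monoʳ-< c h<k) le) all))))))

        hi-factor : ∀ {H} X d Y → hi P (X ++ shift (P + d) H ++ Y) ≡ hi P X ++ shift d H ++ hi P Y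
        hi-factor {H} X d Y = trans (hi-++ P X _) (cong (hi P X ++_) (trans (hi-++ P (shift (P + d) H) Y)
          (cong (_++ hi P Y) (trans (cong (hi P) (trans (List.map-cong (+-assoc P d) H) (List.map-∘ H))) (hi-shift P (shift d H))))))

        position : ∀ c k → c + k ≤ P ⊎ (∃[ d ] c ≡ P + d) ⊎ (c < P × P < c + k)
        position c k with <-≤-connex P (c + k) | <-≤-connex c P
        ... | inj₂ le | _       = inj₁ le
        ... | inj₁ _  | inj₂ ge = inj₂ (inj₁ (c ∸ P , sym (m+[n∸m]≡n ge)))
        ... | inj₁ g  | inj₁ l  = inj₂ (inj₂ (l , g))

        outer-≢P : ∀ {w} → All (Outer P) w → All (_≢ P) w
        outer-≢P = All.map λ { (inj₁ l) → <⇒≢ (<-trans (n<1+n _) l) ; (inj₂ g) → >⇒≢ g }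

        outer-≢p : ∀ {w} → All (Outer P) w → All (_≢ p) w
        outer-≢p = All.map λ { (inj₁ l) → <⇒≢ (s<s⁻¹ l) ; (inj₂ g) → >⇒≢ (<-trans (n<1+n _) g) }

        assoc₃ : ∀ (A B C D : List ℕ) → (A ++ B ++ C) ++ D ≡ A ++ B ++ C ++ D
        assoc₃ A B C D = trans (List.++-assoc A (B ++ C) D) (cong (A ++_) (List.++-assoc B C D))

        hi-P : ∀ w → hi P (P ∷ w) ≡ 0 ∷ hi P w
        hi-P w = trans (hi-above {P} w ≤-refl) (cong (_∷ hi P w) (n∸n≡0 P))

        module CaseUp {W₂ W₁ W₀} (o₂ : All (Outer P) W₂) (i₁ : All (Inner⁺ P) W₁) (o₀ : All (Outer P) W₀) (moves : act W₁ P ≢ P)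
                      {H} (q : Q H) X c Y (eq : W₂ ++ P ∷ W₁ ++ P ∷ W₀ ≡ X ++ shift c H ++ Y)
                      (redw : Red (W₂ ++ P ∷ W₁ ++ P ∷ W₀)) (samew : act (W₂ ++ P ∷ W₁ ++ P ∷ W₀) ≗ g) where
          private
            module S = HeapShape (shape q)
            w uw vw : List ℕ
            w = W₂ ++ P ∷ W₁ ++ P ∷ W₀
            uw = lo P W₂ ++ lo P W₁ ++ lo P W₀
            vw = hi P W₂ ++ 0 ∷ hi P W₁ ++ hi P W₀
            Gw = glue⁺ {p} {W₂} {W₁} {W₀} o₂ i₁ o₀ moves
            all-uw : All (_< P) uw
            all-uw = All.++⁺ (lo-< P W₂) (All.++⁺ (lo-< P W₁) (lo-< P W₀))
            same-u : act uw ≗ act u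
            same-u = glue-injectiveˡ Gw G (act-Bounded all-uw) bu (act-bij uw) (act-bij u) (act-bij vw) (act-bij v) samew
            same-v : act vw ≗ act v
            same-v = glue-injectiveʳ Gw G (act-Bounded all-uw) bu (act-bij uw) (act-bij u) (act-bij vw) (act-bij v) samew
            lo-w : lo P w ≡ uw
            lo-w = trans (lo-++ P W₂ (P ∷ W₁ ++ P ∷ W₀)) (cong (lo P W₂ ++_) (trans (lo-above {P} {P} (W₁ ++ P ∷ W₀) ≤-refl) (trans (lo-++ P W₁ (P ∷ W₀)) (cong (lo P W₁ ++_) (lo-above {P} {P} W₀ ≤-refl)))))
            hi-tail : hi P (W₁ ++ P ∷ W₀) ≡ hi P W₁ ++ 0 ∷ hi P W₀
            hi-tail = trans (hi-++ P W₁ _) (cong (hi P W₁ ++_) (hi-P W₀))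
            hi-w : hi P w ≡ hi P W₂ ++ 0 ∷ hi P W₁ ++ 0 ∷ hi P W₀
            hi-w = trans (hi-++ P W₂ (P ∷ W₁ ++ P ∷ W₀)) (cong (hi P W₂ ++_) (trans (hi-P _) (cong (0 ∷_) hi-tail)))
            assocv : ∀ t → hi P W₂ ++ 0 ∷ hi P W₁ ++ t ≡ (hi P W₂ ++ 0 ∷ hi P W₁) ++ t
            assocv t = sym (List.++-assoc (hi P W₂) (0 ∷ hi P W₁) t)
            len-hi : length (hi P w) ≡ suc (length vw)
            len-hi = trans (cong length (trans hi-w (assocv _))) (trans (length-remove (hi P W₂ ++ 0 ∷ hi P W₁)) (cong (suc ∘ length) (sym (assocv _))))
            lengths : length w ≡ suc (length uw + length vw)
            lengths = trans (length-lo-hi P w) (trans (cong₂ (λ a b → length a + b) lo-w len-hi) (+-suc _ _))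
            open Halves redw samew uw vw same-u same-v lengths
            -- The wire waits at `suc P` throughout `W₁`, so no letter `suc P` separates the two
            -- `P`. A fully commutative factor cannot contain both.
            apart : ∀ {α γ} → shift c H ≡ α ++ P ∷ W₁ ++ P ∷ γ → ⊥
            apart {α} e = ¬fc-up-shift c S.fc α e (All.map (λ { (inj₁ l) → <⇒≢ l , <⇒≢ (m<n⇒m<1+n l) ; (inj₂ g) → >⇒≢ (<-trans (n<1+n _) g) , >⇒≢ g }) i₁)
            between : ∀ {α β γ} → shift c H ≡ α ++ p ∷ β ++ p ∷ γ → All (_≢ p) β → All (_≢ P) β → ⊥
            between {α} e a b = ¬fc-up-shift c S.fc α e (All.zip (a , b))
            i₁-≢P : All (_≢ P) W₁
            i₁-≢P = All.map (λ { (inj₁ l) → <⇒≢ l ; (inj₂ g) → >⇒≢ (<-trans (n<1+n _) g) }) i₁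
            far₁ : All (Far 0) (hi P W₁)
            far₁ = All.map⁺ (All.map (λ { (inj₁ l , g) → contradiction l (≤⇒≯ g) ; (inj₂ g , _) → inj₂ (m+n≤o⇒m≤o∸n 2 g) })
                     (All.zip (All.filter⁺ (P ≤?_) i₁ , All.all-filter (P ≤?_) W₁)))
            -- The word `vw` keeps the left-hand `P`. When that one lies to the left of the heap, it
            -- is deleted and the right-hand one kept: the upper letters of `W₁` commute with it, so
            -- the permutation is the same.
            moved : act (hi P W₂ ++ hi P W₁ ++ 0 ∷ hi P W₀) ≗ act vw
            moved = act-congʳ (hi P W₂) (far-move far₁ (hi P W₀))
            moved-len : length (hi P W₂ ++ hi P W₁ ++ 0 ∷ hi P W₀) ≡ length vw
            moved-len = trans (cong length (sym (List.++-assoc (hi P W₂) (hi P W₁) _))) (trans (length-remove (hi P W₂ ++ hi P W₁))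
              (trans (cong (suc ∘ length) (List.++-assoc (hi P W₂) (hi P W₁) _)) (sym (length-remove (hi P W₂)))))

          case-up : Contains Q (act u) ⊎ Contains Q (act v)
          case-up with position c k
          ... | inj₁ le = inj₁ (inˡ q (lo P X) c (lo P Y) (λ x → cong (λ z → act z x) e) (cong length e))
            where e = trans (sym (lo-factor X c Y S.letters le)) (trans (cong (lo P) (sym eq)) lo-w)
          ... | inj₂ (inj₂ (c<P , P<c+k)) = ⊥-elim ([ count-side , count-centre ]′ (straddle-count (shape q) c<P P<c+k))
            where open Straddle {P} {p} {X} {shift c H} {Y} {W₂} {W₁} {W₀} (sym eq) (1+n≢n ∘ sym) (outer-≢P o₂) i₁-≢P (outer-≢P o₀)
                                (outer-≢p o₂) (outer-≢p o₀) (λ {α} {γ} → apart {α} {γ}) (λ {α} {β} {γ} → between {α} {β} {γ})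
          ... | inj₂ (inj₁ (d , refl)) with locate X (shift c H) Y W₂ P W₁ W₀ (sym eq)
          ...   | inH {α} e = ⊥-elim (apart {α} e)
          ...   | inX {X′} _ e = inj₂ (inʳ q (hi P W₂ ++ hi P X′) d (hi P Y)
                    (λ x → trans (cong (λ z → act z x) e′) (moved x)) (trans (cong length e′) moved-len))
            where
            e′ : (hi P W₂ ++ hi P X′) ++ shift d H ++ hi P Y ≡ hi P W₂ ++ hi P W₁ ++ 0 ∷ hi P W₀
            e′ = trans (List.++-assoc (hi P W₂) (hi P X′) _) (cong (hi P W₂ ++_) (trans (sym (hi-factor X′ d Y)) (trans (cong (hi P) e) hi-tail)))
          ...   | inY {Y′} _ e = inj₂ (inʳ q (hi P X) d (hi P Y′ ++ hi P W₀)
                    (λ x → cong (λ z → act z x) e′) (cong length e′))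
            where
            e′ : hi P X ++ shift d H ++ hi P Y′ ++ hi P W₀ ≡ vw
            e′ = trans (sym (assoc₃ (hi P X) (shift d H) (hi P Y′) (hi P W₀))) (trans (cong (_++ hi P W₀)
                   (trans (sym (hi-factor X d Y′)) (trans (cong (hi P) e) (trans (hi-++ P W₂ (P ∷ W₁)) (cong (hi P W₂ ++_) (hi-P W₁))))))
                   (sym (assocv _)))

        module CaseDown {W₂ W₁ W₀} (o₂ : All (Outer P) W₂) (i₁ : All (Inner⁻ P) W₁) (o₀ : All (Outer P) W₀) (moves : act W₁ P ≢ P)
                      {H} (q : Q H) X c Y (eq : W₂ ++ p ∷ W₁ ++ p ∷ W₀ ≡ X ++ shift c H ++ Y)
                      (redw : Red (W₂ ++ p ∷ W₁ ++ p ∷ W₀)) (samew : act (W₂ ++ p ∷ W₁ ++ p ∷ W₀) ≗ g) where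
          private
            module S = HeapShape (shape q)
            w uw vw : List ℕ
            w = W₂ ++ p ∷ W₁ ++ p ∷ W₀
            uw = lo P W₂ ++ p ∷ lo P W₁ ++ lo P W₀
            vw = hi P W₂ ++ hi P W₁ ++ hi P W₀
            Gw = glue⁻ {p} {W₂} {W₁} {W₀} o₂ i₁ o₀ moves
            all-uw : All (_< P) uw
            all-uw = All.++⁺ (lo-< P W₂) (n<1+n p ∷ All.++⁺ (lo-< P W₁) (lo-< P W₀))
            same-u : act uw ≗ act u
            same-u = glue-injectiveˡ Gw G (act-Bounded all-uw) bu (act-bij uw) (act-bij u) (act-bij vw) (act-bij v) samew
            same-v : act vw ≗ act v
            same-v = glue-injectiveʳ Gw G (act-Bounded all-uw) bu (act-bij uw) (act-bij u) (act-bij vw) (act-bij v) samew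
            hi-w : hi P w ≡ vw
            hi-w = trans (hi-++ P W₂ (p ∷ W₁ ++ p ∷ W₀)) (cong (hi P W₂ ++_) (trans (hi-below {P} {p} (W₁ ++ p ∷ W₀) (n<1+n p)) (trans (hi-++ P W₁ (p ∷ W₀)) (cong (hi P W₁ ++_) (hi-below {P} {p} W₀ (n<1+n p))))))
            lo-p : ∀ t → lo P (p ∷ t) ≡ p ∷ lo P t
            lo-p t = lo-below {P} {p} t (n<1+n p)
            lo-tail : lo P (W₁ ++ p ∷ W₀) ≡ lo P W₁ ++ p ∷ lo P W₀
            lo-tail = trans (lo-++ P W₁ _) (cong (lo P W₁ ++_) (lo-p W₀))
            lo-w : lo P w ≡ lo P W₂ ++ p ∷ lo P W₁ ++ p ∷ lo P W₀
            lo-w = trans (lo-++ P W₂ (p ∷ W₁ ++ p ∷ W₀)) (cong (lo P W₂ ++_) (trans (lo-p _) (cong (p ∷_) lo-tail)))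
            assocu : ∀ t → lo P W₂ ++ p ∷ lo P W₁ ++ t ≡ (lo P W₂ ++ p ∷ lo P W₁) ++ t
            assocu t = sym (List.++-assoc (lo P W₂) (p ∷ lo P W₁) t)
            len-lo : length (lo P w) ≡ suc (length uw)
            len-lo = trans (cong length (trans lo-w (assocu _))) (trans (length-remove (lo P W₂ ++ p ∷ lo P W₁)) (cong (suc ∘ length) (sym (assocu _))))
            lengths : length w ≡ suc (length uw + length vw)
            lengths = trans (length-lo-hi P w) (cong₂ (λ a b → a + length b) len-lo hi-w)
            open Halves redw samew uw vw same-u same-v lengths
            apart : ∀ {α γ} → shift c H ≡ α ++ p ∷ W₁ ++ p ∷ γ → ⊥
            apart {α} e = ¬fc-down-shift c S.fc S.letters α e (All.map (λ { (inj₁ (s≤s l)) → <⇒≢ (<-trans (n<1+n _) l) , <⇒≢ l ; (inj₂ g) → >⇒≢ g , >⇒≢ (m<n⇒m<1+n g) }) i₁)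
            between : ∀ {α β γ} → shift c H ≡ α ++ P ∷ β ++ P ∷ γ → All (_≢ P) β → All (_≢ p) β → ⊥
            between {α} e a b = ¬fc-down-shift c S.fc S.letters α e (All.zipWith (λ (x , y) → x , y ∘ suc-injective) (a , b))
            i₁-≢p : All (_≢ p) W₁
            i₁-≢p = All.map (λ { (inj₁ (s≤s l)) → <⇒≢ (<-trans (n<1+n _) l) ; (inj₂ g) → >⇒≢ g }) i₁
            far₁ : All (Far p) (lo P W₁)
            far₁ = All.map (λ { (inj₁ (s≤s l) , _) → inj₁ l ; (inj₂ g , l) → contradiction l (≤⇒≯ g) })
                     (All.zip (All.filter⁺ (_<? P) i₁ , All.all-filter (_<? P) W₁))
            moved : act (lo P W₂ ++ lo P W₁ ++ p ∷ lo P W₀) ≗ act uw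
            moved = act-congʳ (lo P W₂) (far-move far₁ (lo P W₀))
            moved-len : length (lo P W₂ ++ lo P W₁ ++ p ∷ lo P W₀) ≡ length uw
            moved-len = trans (cong length (sym (List.++-assoc (lo P W₂) (lo P W₁) _))) (trans (length-remove (lo P W₂ ++ lo P W₁))
              (trans (cong (suc ∘ length) (List.++-assoc (lo P W₂) (lo P W₁) _)) (sym (length-remove (lo P W₂)))))

          case-down : Contains Q (act u) ⊎ Contains Q (act v)
          case-down with position c k
          ... | inj₂ (inj₁ (d , refl)) = inj₂ (inʳ q (hi P X) d (hi P Y) (λ x → cong (λ z → act z x) e) (cong length e))
            where e = trans (sym (hi-factor X d Y)) (trans (cong (hi P) (sym eq)) hi-w)
          ... | inj₂ (inj₂ (c<P , P<c+k)) = ⊥-elim ([ count-centre , count-side ]′ (straddle-count (shape q) c<P P<c+k))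
            where open Straddle {p} {P} {X} {shift c H} {Y} {W₂} {W₁} {W₀} (sym eq) 1+n≢n (outer-≢p o₂) i₁-≢p (outer-≢p o₀)
                                (outer-≢P o₂) (outer-≢P o₀) (λ {α} {γ} → apart {α} {γ}) (λ {α} {β} {γ} → between {α} {β} {γ})
          ... | inj₁ le with locate X (shift c H) Y W₂ p W₁ W₀ (sym eq)
          ...   | inH {α} e = ⊥-elim (apart {α} e)
          ...   | inX {X′} _ e = inj₁ (inˡ q (lo P W₂ ++ lo P X′) c (lo P Y)
                    (λ x → trans (cong (λ z → act z x) e′) (moved x)) (trans (cong length e′) moved-len))
            where
            e′ : (lo P W₂ ++ lo P X′) ++ shift c H ++ lo P Y ≡ lo P W₂ ++ lo P W₁ ++ p ∷ lo P W₀
            e′ = trans (List.++-assoc (lo P W₂) (lo P X′) _) (cong (lo P W₂ ++_) (trans (sym (lo-factor X′ c Y S.letters le)) (trans (cong (lo P) e) lo-tail)))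
          ...   | inY {Y′} _ e = inj₁ (inˡ q (lo P X) c (lo P Y′ ++ lo P W₀)
                    (λ x → cong (λ z → act z x) e′) (cong length e′))
            where
            e′ : lo P X ++ shift c H ++ lo P Y′ ++ lo P W₀ ≡ uw
            e′ = trans (sym (assoc₃ (lo P X) (shift c H) (lo P Y′) (lo P W₀))) (trans (cong (_++ lo P W₀)
                   (trans (sym (lo-factor X c Y′ S.letters le)) (trans (cong (lo P) e) (trans (lo-++ P W₂ (p ∷ W₁)) (cong (lo P W₂ ++_) (lo-p W₁))))))
                   (sym (assocu _)))

      contains-glue⇒ : Contains Q g → Contains Q (act u) ⊎ Contains Q (act v)
      contains-glue⇒ (contains H q X c Y red same) = go (decompose red cut) refl red same
        where
        cut : Cut (act (X ++ shift c H ++ Y)) P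
        cut = glue⇒cut (glue-resp (λ _ → refl) (λ _ → refl) (λ x → sym (same x)) G) bu (act-bij u) (act-bij v) uP≢ v0≢
        go : ∀ {w} → Decomposition p w → w ≡ X ++ shift c H ++ Y → Red w → act w ≗ g → Contains Q (act u) ⊎ Contains Q (act v)
        go (up o₂ i₁ o₀ m)   eq red same = CaseUp.case-up o₂ i₁ o₀ m q X c Y eq red same
        go (down o₂ i₁ o₀ m) eq red same = CaseDown.case-down o₂ i₁ o₀ m q X c Y eq red same

-- Permutations of Fin as permutations of ℕ

ext : ∀ {m} → Permutation′ m → ℕ → ℕ
ext {m} w x with x <? m
... | yes x<m = toℕ (w ⟨$⟩ʳ fromℕ< x<m)
... | no  _   = x

ext-toℕ : ∀ {m} (w : Permutation′ m) x → ext w (toℕ x) ≡ toℕ (w ⟨$⟩ʳ x)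
ext-toℕ {m} w x with toℕ x <? m
... | yes x<m = cong (toℕ ∘ (w ⟨$⟩ʳ_)) (Fin.fromℕ<-toℕ x x<m)
... | no  x≮m = contradiction (Fin.toℕ<n x) x≮m

ext-outside : ∀ {m} (w : Permutation′ m) {x} → m ≤ x → ext w x ≡ x
ext-outside {m} w {x} m≤x with x <? m
... | yes x<m = contradiction x<m (≤⇒≯ m≤x)
... | no  _   = refl

fin-or-outside : ∀ m x → (∃[ i ] x ≡ toℕ {m} i) ⊎ m ≤ x
fin-or-outside m x with <-≤-connex x m
... | inj₁ x<m = inj₁ (fromℕ< x<m , sym (Fin.toℕ-fromℕ< x<m))
... | inj₂ m≤x = inj₂ m≤x

ext-ext : ∀ {m} (w : Permutation′ m) {g : ℕ → ℕ} → (∀ i → g (toℕ i) ≡ toℕ (w ⟨$⟩ʳ i)) → (∀ {x} → m ≤ x → g x ≡ x) → g ≗ ext w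
ext-ext {m} w {g} in-eq out-eq x with fin-or-outside m x
... | inj₁ (i , refl) = trans (in-eq i) (sym (ext-toℕ w i))
... | inj₂ m≤x        = trans (out-eq m≤x) (sym (ext-outside w m≤x))

ext-cong : ∀ {m} {w w′ : Permutation′ m} → w ≈ w′ → ext w ≗ ext w′
ext-cong {w = w} {w′} eq = ext-ext w′ (λ i → trans (ext-toℕ w i) (cong toℕ (eq i))) (ext-outside w)

ext-reflects : ∀ {m} {w w′ : Permutation′ m} → ext w ≗ ext w′ → w ≈ w′
ext-reflects {w = w} {w′} eq i = Fin.toℕ-injective (trans (sym (ext-toℕ w i)) (trans (eq (toℕ i)) (ext-toℕ w′ i)))

ext-Bounded : ∀ {m} (w : Permutation′ (suc m)) → Bounded m (ext w)
ext-Bounded {m} w = bounded inside (ext-outside w)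
  where
  inside : ∀ {x} → x ≤ m → ext w x ≤ m
  inside {x} x≤m with fin-or-outside (suc m) x
  ... | inj₁ (i , refl) = subst (_≤ m) (sym (ext-toℕ w i)) (s≤s⁻¹ (Fin.toℕ<n (w ⟨$⟩ʳ i)))
  ... | inj₂ m<x = contradiction x≤m (<⇒≱ m<x)

flip : ∀ {m} → Permutation′ m → Permutation′ m
flip w = permutation (w ⟨$⟩ˡ_) (w ⟨$⟩ʳ_) (λ _ → inverseˡ w) (λ _ → inverseʳ w)

ext-flipʳ : ∀ {m} (w : Permutation′ m) → ext w ∘ ext (flip w) ≗ id
ext-flipʳ {m} w x with fin-or-outside m x
... | inj₁ (i , refl) = trans (cong (ext w) (ext-toℕ (flip w) i)) (trans (ext-toℕ w _) (cong toℕ (inverseʳ w)))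
... | inj₂ m≤x = trans (cong (ext w) (ext-outside (flip w) m≤x)) (ext-outside w m≤x)

ext-flipˡ : ∀ {m} (w : Permutation′ m) → ext (flip w) ∘ ext w ≗ id
ext-flipˡ {m} w x with fin-or-outside m x
... | inj₁ (i , refl) = trans (cong (ext (flip w)) (ext-toℕ w i)) (trans (ext-toℕ (flip w) _) (cong toℕ (inverseˡ w)))
... | inj₂ m≤x = trans (cong (ext (flip w)) (ext-outside w m≤x)) (ext-outside (flip w) m≤x)

ext-Bij : ∀ {m} (w : Permutation′ m) → Bij (ext w)
ext-Bij w = bij (λ {x} {y} e → trans (sym (ext-flipˡ w x)) (trans (cong (ext (flip w)) e) (ext-flipˡ w y)))
                (λ y → ext (flip w) y , ext-flipʳ w y)

fin-swap : ∀ {m} (i : Fin m) x → toℕ (s i ⟨$⟩ʳ x) ≡ swap (toℕ i) (toℕ x)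
fin-swap i x with x Fin.≟ inject₁ i
... | yes refl = sym (trans (cong (swap (toℕ i)) (Fin.toℕ-inject₁ i)) (swap-left (toℕ i)))
... | no n with x Fin.≟ suc i
...   | yes refl = trans (Fin.toℕ-inject₁ i) (sym (swap-right (toℕ i)))
...   | no n′ = sym (swap-fix (toℕ i) (λ e → n (Fin.toℕ-injective (trans e (sym (Fin.toℕ-inject₁ i))))) (n′ ∘ Fin.toℕ-injective))

letters : ∀ {m} → Word m → List ℕ
letters = map toℕ

letters-< : ∀ {m} (𝐰 : Word m) → All (_< m) (letters 𝐰)
letters-< 𝐰 = All.map⁺ (All.universal Fin.toℕ<n 𝐰)

letters⁻¹ : ∀ {m w} → All (_< m) w → ∃[ 𝐰 ] letters {m} 𝐰 ≡ w
letters⁻¹ []       = [] , refl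
letters⁻¹ (l ∷ ls) = let (𝐰 , eq) = letters⁻¹ ls in fromℕ< l ∷ 𝐰 , cong₂ _∷_ (Fin.toℕ-fromℕ< l) eq

act-letters-toℕ : ∀ {m} (𝐰 : Word m) x → act (letters 𝐰) (toℕ x) ≡ toℕ (⟦ 𝐰 ⟧ ⟨$⟩ʳ x)
act-letters-toℕ []      x = refl
act-letters-toℕ (i ∷ 𝐰) x = trans (cong (swap (toℕ i)) (act-letters-toℕ 𝐰 x)) (sym (fin-swap i _))

act-letters : ∀ {m} (𝐰 : Word m) → act (letters 𝐰) ≗ ext ⟦ 𝐰 ⟧
act-letters 𝐰 = ext-ext ⟦ 𝐰 ⟧ (act-letters-toℕ 𝐰) (act-above (letters-< 𝐰))

RedWord : ∀ {m} → Permutation′ m → List ℕ → Set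
RedWord w 𝐰 = Red 𝐰 × act 𝐰 ≗ ext w

reducedFor⇒ : ∀ {m} {w : Permutation′ (suc m)} {𝐰} → ReducedFor w 𝐰 → RedWord w (letters 𝐰)
reducedFor⇒ {m} {w} {𝐰} (reduced rep min) =
  minimal⇒Red (letters-< 𝐰) shortest , λ x → trans (act-letters 𝐰 x) (ext-cong {w = ⟦ 𝐰 ⟧} {w} rep x)
  where
  shortest : ∀ v → All (_< m) v → act v ≗ act (letters 𝐰) → length (letters 𝐰) ≤ length v
  shortest v all eq with letters⁻¹ all
  ... | 𝐯 , refl = subst₂ _≤_ (sym (List.length-map toℕ 𝐰)) (sym (List.length-map toℕ 𝐯))
    (min 𝐯 λ i → trans (ext-reflects {w = ⟦ 𝐯 ⟧} {⟦ 𝐰 ⟧} (λ x → trans (sym (act-letters 𝐯 x)) (trans (eq x) (act-letters 𝐰 x))) i) (rep i))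

reducedFor⇐ : ∀ {m} {w : Permutation′ (suc m)} {𝐰} → RedWord w (letters 𝐰) → ReducedFor w 𝐰
reducedFor⇐ {m} {w} {𝐰} (red , eq) = reduced rep λ 𝐯 rep′ →
  subst₂ _≤_ (List.length-map toℕ 𝐰) (List.length-map toℕ 𝐯) (Red⇒minimal red (letters 𝐯) λ x →
    trans (act-letters 𝐯 x) (trans (ext-cong {w = ⟦ 𝐯 ⟧} {w} rep′ x) (sym (eq x))))
  where
  rep : ⟦ 𝐰 ⟧ ≈ w
  rep = ext-reflects {w = ⟦ 𝐰 ⟧} {w} λ x → trans (sym (act-letters 𝐰 x)) (eq x)

redWord-letters : ∀ {m} {w : Permutation′ (suc m)} {v} → RedWord w v → All (_< m) v
redWord-letters {w = w} (red , eq) = bounded-letters red λ m<x → trans (eq _) (ext-outside w m<x)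

redWord-exists : ∀ {m} (w : Permutation′ (suc m)) → ∃[ v ] RedWord w v
redWord-exists w =
  let (𝐰 , rep) = Finiteness.word w
      r = reduce (letters 𝐰)
  in Reduction.word r , Reduction.red r , λ x → trans (Reduction.same r x) (trans (act-letters 𝐰 x) (ext-cong {w = ⟦ 𝐰 ⟧} {w} rep x))

-- Convex subposets of heaps are factors

commute-swap : ∀ {m} {i j : Fin m} → Commute i j → ∀ x → swap (toℕ i) (swap (toℕ j) x) ≡ swap (toℕ j) (swap (toℕ i) x)
commute-swap {m} {i} {j} com x with fin-or-outside (suc m) x
... | inj₁ (y , refl) = begin
  swap (toℕ i) (swap (toℕ j) (toℕ y))    ≡⟨ cong (swap (toℕ i)) (fin-swap j y) ⟨
  swap (toℕ i) (toℕ (s j ⟨$⟩ʳ y))        ≡⟨ fin-swap i _ ⟨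
  toℕ (s i ⟨$⟩ʳ (s j ⟨$⟩ʳ y))            ≡⟨ cong toℕ (com y) ⟨
  toℕ (s j ⟨$⟩ʳ (s i ⟨$⟩ʳ y))            ≡⟨ fin-swap j _ ⟩
  swap (toℕ j) (toℕ (s i ⟨$⟩ʳ y))        ≡⟨ cong (swap (toℕ j)) (fin-swap i y) ⟩
  swap (toℕ j) (swap (toℕ i) (toℕ y))    ∎
  where open ≡-Reasoning
... | inj₂ m<x = trans (cong (swap (toℕ i)) (out j)) (trans (out i) (sym (trans (cong (swap (toℕ j)) (out i)) (out j))))
  where
  out : ∀ (i : Fin m) → swap (toℕ i) x ≡ x
  out i = swap-above (<-≤-trans (s≤s (Fin.toℕ<n i)) m<x)

Commute? : ∀ {m} (i j : Fin m) → Dec (Commute i j)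
Commute? i j = (s i ∘ₚ s j) Finiteness.≈? (s j ∘ₚ s i)

commute-through : ∀ {m} {i : Fin m} 𝐮 → (∀ {j} → j ∈ 𝐮 → Commute i j) → ∀ v →
                  act (toℕ i ∷ letters 𝐮 ++ v) ≗ act (letters 𝐮 ++ toℕ i ∷ v)
commute-through []      com v x = refl
commute-through {i = i} (j ∷ 𝐮) com v x =
  trans (commute-swap (com (here refl)) _) (cong (swap (toℕ j)) (commute-through 𝐮 (com ∘ there) v x))

tabulate-pull : ∀ {m n} (u : Fin (suc n) → Fin m) a → (∀ b → b Fin.< a → Commute (u b) (u a)) → ∀ v →
                act (letters (tabulate u) ++ v) ≗ act (toℕ (u a) ∷ letters (tabulate (u ∘ Fin.punchIn a)) ++ v)
tabulate-pull u zero com v x = refl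
tabulate-pull {n = suc n} u (suc a) com v x =
  trans (cong (swap (toℕ (u zero))) (tabulate-pull (u ∘ suc) a (λ b b<a → com (suc b) (s≤s b<a)) v x))
        (commute-swap (com zero z<s) _)

module _ {m : ℕ} where
  open import Relation.Binary.Construct.Closure.Transitive as TC using ([_]; _∷_)

  heap-< : ∀ (𝐰 : Word m) {a b} → Heap 𝐰 a b → a Fin.< b
  heap-< 𝐰 [ a<b , _ ]       = a<b
  heap-< 𝐰 ((a<c , _) ∷ hp) = <-trans a<c (heap-< 𝐰 hp)

  heap-suc⁺ : ∀ {i} (𝐰 : Word m) {a b} → Heap 𝐰 a b → Heap (i ∷ 𝐰) (suc a) (suc b)
  heap-suc⁺ 𝐰 [ a<b , nc ]      = [ s≤s a<b , nc ]
  heap-suc⁺ 𝐰 ((a<c , nc) ∷ hp) = (s≤s a<c , nc) ∷ heap-suc⁺ 𝐰 hp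

  heap-suc⁻ : ∀ {i} (𝐰 : Word m) {a b} → Heap (i ∷ 𝐰) (suc a) (suc b) → Heap 𝐰 a b
  heap-suc⁻ 𝐰 [ s≤s a<b , nc ] = [ a<b , nc ]
  heap-suc⁻ 𝐰 (_∷_ {y = suc c} (s≤s a<c , nc) hp) = (a<c , nc) ∷ heap-suc⁻ 𝐰 hp

  -- The field `below` records why a letter was moved to the left: it lies under the subset without
  -- belonging to it. This is what later letters need in order to commute past `A`. The subset is
  -- given by a function `u` and not by a word, because peeling off the first letter of `𝐰` may
  -- delete any index of `u`.
  record Factor (𝐰 : Word m) {n} (u : Fin n → Fin m) (e : Fin n → Fin (length 𝐰)) : Set where
    constructor mkFactor
    field
      A B   : Word m
      same  : act (letters 𝐰) ≗ act (letters A ++ letters (tabulate u) ++ letters B)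
      len   : length 𝐰 ≡ length A + (n + length B)
      below : ∀ {j} → j ∈ A → ∃[ y ] lookup 𝐰 y ≡ j × (∀ c → e c ≢ y) × ∃[ b ] Heap 𝐰 y (e b)

  private
    lower : ∀ {n} (x : Fin (suc n)) → x ≢ zero → ∃[ y ] suc y ≡ x
    lower zero    n = contradiction refl n
    lower (suc y) _ = y , refl

    punchIn-mono : ∀ {n} (a : Fin (suc n)) {x y : Fin n} → x Fin.< y → Fin.punchIn a x Fin.< Fin.punchIn a y
    punchIn-mono zero    x<y = s≤s x<y
    punchIn-mono (suc a) {zero}  {suc y} x<y = z<s
    punchIn-mono (suc a) {suc x} {suc y} (s≤s x<y) = s≤s (punchIn-mono a x<y)

    punchIn-or : ∀ {n} (a c : Fin (suc n)) → a ≡ c ⊎ ∃[ x ] Fin.punchIn a x ≡ c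
    punchIn-or a c with a Fin.≟ c
    ... | yes e = inj₁ e
    ... | no n  = inj₂ (Fin.punchOut n , Fin.punchIn-punchOut n)

  -- The elements below the convex subset are moved to its left, all
  -- others to its right.
  factor : ∀ (𝐰 : Word m) {n} (u : Fin n → Fin m) (e : Fin n → Fin (length 𝐰)) →
           (∀ a b → e a ≡ e b → a ≡ b) → (∀ a → lookup 𝐰 (e a) ≡ u a) →
           (∀ a b → a Fin.< b → ¬ Commute (u a) (u b) → e a Fin.< e b) →
           (∀ a b y → Heap 𝐰 (e a) y → Heap 𝐰 y (e b) → ∃[ c ] e c ≡ y) → Factor 𝐰 u e
  factor [] {zero}  u e _ _ _ _ = mkFactor [] [] (λ _ → refl) refl λ ()
  factor [] {suc n} u e _ _ _ _ with e zero
  ... | ()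
  factor (i ∷ 𝐰) {n} u e inj lab mono conv with Fin.any? (λ a → e a Fin.≟ zero)
  ... | no none = extend (Fin.any? λ b → Finiteness.heap? (i ∷ 𝐰) zero (e b))
    where
    e′ : Fin n → Fin (length 𝐰)
    e′ a = proj₁ (lower (e a) (λ ea → none (a , ea)))
    e′-suc : ∀ a → suc (e′ a) ≡ e a
    e′-suc a = proj₂ (lower (e a) (λ ea → none (a , ea)))
    F : Factor 𝐰 u e′
    F = factor 𝐰 u e′ (λ a b eq → inj a b (trans (sym (e′-suc a)) (trans (cong suc eq) (e′-suc b))))
          (λ a → trans (cong (lookup (i ∷ 𝐰)) (e′-suc a)) (lab a))
          (λ a b a<b nc → s≤s⁻¹ (subst₂ Fin._<_ (sym (e′-suc a)) (sym (e′-suc b)) (mono a b a<b nc)))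
          (λ a b y h h′ → let (c , eq) = conv a b (suc y) (subst (λ z → Heap (i ∷ 𝐰) z (suc y)) (e′-suc a) (heap-suc⁺ 𝐰 h))
                                                          (subst (Heap (i ∷ 𝐰) (suc y)) (e′-suc b) (heap-suc⁺ 𝐰 h′))
                          in c , Fin.suc-injective (trans (e′-suc c) eq))
    open Factor F
    below′ : ∀ {j} → j ∈ A → ∃[ y ] lookup 𝐰 y ≡ j × (∀ c → e c ≢ suc y) × ∃[ b ] Heap (i ∷ 𝐰) (suc y) (e b)
    below′ j∈ = let (y , ly , ny , b , h) = below j∈
                in y , ly , (λ c eq → ny c (Fin.suc-injective (trans (e′-suc c) eq))) , b , subst (Heap (i ∷ 𝐰) (suc y)) (e′-suc b) (heap-suc⁺ 𝐰 h)
    extend : Dec (∃[ b ] Heap (i ∷ 𝐰) zero (e b)) → Factor (i ∷ 𝐰) u e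
    extend (yes (b , h)) = mkFactor (i ∷ A) B (cong (swap (toℕ i)) ∘ same) (cong suc len) λ
      { (here refl) → zero , refl , (λ c ec → none (c , ec)) , b , h
      ; (there j∈) → let (y , r) = below′ j∈ in suc y , r }
    extend (no ¬h) = mkFactor A (i ∷ B) same′
        (trans (cong suc len) (trans (sym (+-suc (length A) _)) (cong (length A +_) (sym (+-suc n _)))))
        (λ j∈ → let (y , r) = below′ j∈ in suc y , r)
      where
      -- A letter of `A` not commuting with `i` would place position `zero` below the subset too.
      comA : ∀ {j} → j ∈ A → Commute i j
      comA {j} j∈ with Commute? i j
      ... | yes c = c
      ... | no nc with below′ j∈
      ...   | y , refl , _ , b , h = contradiction (b , (z<s , nc) ∷ h) ¬h
      comU : ∀ {j} → j ∈ tabulate u → Commute i j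
      comU {j} j∈ with Commute? i j
      ... | yes c = c
      ... | no nc with tabulate∈ j∈
        where
        open import Data.List.Membership.Propositional.Properties using (∈-tabulate⁻)
        tabulate∈ : j ∈ tabulate u → ∃[ b ] j ≡ u b
        tabulate∈ = ∈-tabulate⁻
      ...   | b , refl = contradiction (b , [ subst (Fin._<_ {suc (length 𝐰)} zero) (e′-suc b) (z<s {toℕ (e′ b)}) , subst (λ z → ¬ Commute i z) (sym (lab b)) nc ]) ¬h
      same′ : act (letters (i ∷ 𝐰)) ≗ act (letters A ++ letters (tabulate u) ++ toℕ i ∷ letters B)
      same′ x = trans (cong (swap (toℕ i)) (same x)) (trans (commute-through A comA _ x)
        (act-congʳ (letters A) (commute-through (tabulate u) comU (letters B)) x))
  factor (i ∷ 𝐰) {zero}  u e inj lab mono conv | yes (() , _)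
  factor (i ∷ 𝐰) {suc n} u e inj lab mono conv | yes (a , ea) =
    mkFactor A B same′ (trans (cong suc len) (sym (+-suc (length A) _))) (λ j∈ → let (y , r) = below′ j∈ in suc y , r)
    where
    π : Fin n → Fin (suc n)
    π = Fin.punchIn a
    ne : ∀ x → e (π x) ≢ zero
    ne x eq = Fin.punchInᵢ≢i a x (inj _ _ (trans eq (sym ea)))
    e′ : Fin n → Fin (length 𝐰)
    e′ x = proj₁ (lower (e (π x)) (ne x))
    e′-suc : ∀ x → suc (e′ x) ≡ e (π x)
    e′-suc x = proj₂ (lower (e (π x)) (ne x))
    conv′ : ∀ x z y → Heap 𝐰 (e′ x) y → Heap 𝐰 y (e′ z) → ∃[ c ] e′ c ≡ y
    conv′ x z y h h′ with conv (π x) (π z) (suc y) (subst (λ z → Heap (i ∷ 𝐰) z (suc y)) (e′-suc x) (heap-suc⁺ 𝐰 h))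
                                                   (subst (Heap (i ∷ 𝐰) (suc y)) (e′-suc z) (heap-suc⁺ 𝐰 h′))
    ... | c , eq with punchIn-or a c
    ...   | inj₁ refl = contradiction (trans (sym ea) eq) λ ()
    ...   | inj₂ (c′ , refl) = c′ , Fin.suc-injective (trans (e′-suc c′) eq)
    F : Factor 𝐰 (u ∘ π) e′
    F = factor 𝐰 (u ∘ π) e′ (λ x y eq → Fin.punchIn-injective a x y (inj _ _ (trans (sym (e′-suc x)) (trans (cong suc eq) (e′-suc y)))))
          (λ x → trans (cong (lookup (i ∷ 𝐰)) (e′-suc x)) (lab (π x)))
          (λ x y x<y nc → s≤s⁻¹ (subst₂ Fin._<_ (sym (e′-suc x)) (sym (e′-suc y)) (mono _ _ (punchIn-mono a x<y) nc)))
          conv′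
    open Factor F
    i≡ : i ≡ u a
    i≡ = trans (cong (lookup (i ∷ 𝐰)) (sym ea)) (lab a)
    below′ : ∀ {j} → j ∈ A → ∃[ y ] lookup 𝐰 y ≡ j × (∀ c → e c ≢ suc y) × ∃[ b ] Heap (i ∷ 𝐰) (suc y) (e b)
    below′ j∈ with below j∈
    ... | y , ly , ny , b , h = y , ly , avoid , π b , subst (Heap (i ∷ 𝐰) (suc y)) (e′-suc b) (heap-suc⁺ 𝐰 h)
      where
      avoid : ∀ c → e c ≢ suc y
      avoid c eq with punchIn-or a c
      ... | inj₁ refl = contradiction (trans (sym ea) eq) λ ()
      ... | inj₂ (c′ , refl) = ny c′ (Fin.suc-injective (trans (e′-suc c′) eq))
    -- Here such a letter would lie between two elements of the subset, and convexity would make it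
    -- an element.
    comA : ∀ {j} → j ∈ A → Commute i j
    comA {j} j∈ with Commute? i j
    ... | yes c = c
    ... | no nc with below′ j∈
    ...   | y , refl , ny , b , h = contradiction (proj₂ inside) (ny (proj₁ inside))
      where inside = conv a b (suc y) (subst (λ z → Heap (i ∷ 𝐰) z (suc y)) (sym ea) [ z<s , nc ]) h
    comU : ∀ b → b Fin.< a → Commute (u b) (u a)
    comU b b<a with Commute? (u b) (u a)
    ... | yes c = c
    ... | no nc = contradiction (subst (e b Fin.<_) ea (mono b a b<a nc)) λ ()
    same′ : act (letters (i ∷ 𝐰)) ≗ act (letters A ++ letters (tabulate u) ++ letters B)
    same′ x = trans (cong (swap (toℕ i)) (same x)) (trans (commute-through A comA _ x) (act-congʳ (letters A)
      (λ z → trans (cong (λ j → swap (toℕ j) (act (letters (tabulate (u ∘ π)) ++ letters B) z)) i≡)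
        (sym (tabulate-pull u a comU (letters B) z))) x))

  convex⇒factor : ∀ {𝐮 𝐰 : Word m} {e} → IsConvexEmbedding 𝐮 𝐰 e → ∃₂ λ A B →
                  act (letters 𝐰) ≗ act (letters A ++ letters 𝐮 ++ letters B) × length (letters 𝐰) ≡ length (letters A ++ letters 𝐮 ++ letters B)
  convex⇒factor {𝐮} {𝐰} {e} (convexEmbedding inj lab ord conv) =
    A , B , (λ x → trans (same x) (cong (λ v → act (letters A ++ letters v ++ letters B) x) (List.tabulate-lookup 𝐮))) ,
    trans (List.length-map toℕ 𝐰) (trans len (sym (trans (List.length-++ (letters A)) (cong₂ _+_ (List.length-map toℕ A)
      (trans (List.length-++ (letters 𝐮)) (cong₂ _+_ (List.length-map toℕ 𝐮) (List.length-map toℕ B)))))))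
    where
    F : Factor 𝐰 (lookup 𝐮) e
    F = factor 𝐰 (lookup 𝐮) e (λ _ _ → inj) lab (λ a b a<b nc → heap-< 𝐰 (Equivalence.to (ord a b) [ a<b , nc ])) conv
    open Factor F

  convex-∷ : ∀ {i} {𝐮 𝐰 : Word m} {e} → IsConvexEmbedding 𝐮 𝐰 e → IsConvexEmbedding 𝐮 (i ∷ 𝐰) (suc ∘ e)
  convex-∷ {i} {𝐮} {𝐰} {e} (convexEmbedding inj lab ord conv) = convexEmbedding (inj ∘ Fin.suc-injective) lab
    (λ a b → mk⇔ (heap-suc⁺ 𝐰 ∘ Equivalence.to (ord a b)) (Equivalence.from (ord a b) ∘ heap-suc⁻ 𝐰))
    conv′
    where
    conv′ : ∀ a b y → Heap (i ∷ 𝐰) (suc (e a)) y → Heap (i ∷ 𝐰) y (suc (e b)) → ∃[ c ] suc (e c) ≡ y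
    conv′ a b zero    h h′ = contradiction (heap-< (i ∷ 𝐰) h) λ ()
    conv′ a b (suc y) h h′ = let (c , eq) = conv a b y (heap-suc⁻ 𝐰 h) (heap-suc⁻ 𝐰 h′) in c , cong suc eq

  private
    inˡ : ∀ (𝐮 : Word m) B → Fin (length 𝐮) → Fin (length (𝐮 ++ B))
    inˡ (_ ∷ 𝐮) B zero    = zero
    inˡ (_ ∷ 𝐮) B (suc a) = suc (inˡ 𝐮 B a)

    toℕ-inˡ : ∀ 𝐮 B a → toℕ (inˡ 𝐮 B a) ≡ toℕ a
    toℕ-inˡ (_ ∷ 𝐮) B zero    = refl
    toℕ-inˡ (_ ∷ 𝐮) B (suc a) = cong suc (toℕ-inˡ 𝐮 B a)

    lookup-inˡ : ∀ 𝐮 B a → lookup (𝐮 ++ B) (inˡ 𝐮 B a) ≡ lookup 𝐮 a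
    lookup-inˡ (_ ∷ 𝐮) B zero    = refl
    lookup-inˡ (_ ∷ 𝐮) B (suc a) = lookup-inˡ 𝐮 B a

    inˡ-down : ∀ 𝐮 B {y} b → y Fin.< inˡ 𝐮 B b → ∃[ c ] inˡ 𝐮 B c ≡ y
    inˡ-down (_ ∷ 𝐮) B {zero}  b       _         = zero , refl
    inˡ-down (_ ∷ 𝐮) B {suc y} (suc b) (s≤s y<b) = let (c , eq) = inˡ-down 𝐮 B b y<b in suc c , cong suc eq

    inˡ-gen⁺ : ∀ 𝐮 B {a b} → Generating 𝐮 a b → Generating (𝐮 ++ B) (inˡ 𝐮 B a) (inˡ 𝐮 B b)
    inˡ-gen⁺ 𝐮 B {a} {b} (a<b , nc) = subst₂ _<_ (sym (toℕ-inˡ 𝐮 B a)) (sym (toℕ-inˡ 𝐮 B b)) a<b ,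
      subst₂ (λ i j → ¬ Commute i j) (sym (lookup-inˡ 𝐮 B a)) (sym (lookup-inˡ 𝐮 B b)) nc

    inˡ-gen⁻ : ∀ 𝐮 B {a b} → Generating (𝐮 ++ B) (inˡ 𝐮 B a) (inˡ 𝐮 B b) → Generating 𝐮 a b
    inˡ-gen⁻ 𝐮 B {a} {b} (a<b , nc) = subst₂ _<_ (toℕ-inˡ 𝐮 B a) (toℕ-inˡ 𝐮 B b) a<b ,
      subst₂ (λ i j → ¬ Commute i j) (lookup-inˡ 𝐮 B a) (lookup-inˡ 𝐮 B b) nc

    inˡ-heap⁺ : ∀ 𝐮 B {a b} → Heap 𝐮 a b → Heap (𝐮 ++ B) (inˡ 𝐮 B a) (inˡ 𝐮 B b)
    inˡ-heap⁺ 𝐮 B [ g ]    = [ inˡ-gen⁺ 𝐮 B g ]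
    inˡ-heap⁺ 𝐮 B (g ∷ h) = inˡ-gen⁺ 𝐮 B g ∷ inˡ-heap⁺ 𝐮 B h

    inˡ-heap⁻ : ∀ 𝐮 B {a b x} → inˡ 𝐮 B a ≡ x → Heap (𝐮 ++ B) x (inˡ 𝐮 B b) → Heap 𝐮 a b
    inˡ-heap⁻ 𝐮 B refl [ g ] = [ inˡ-gen⁻ 𝐮 B g ]
    inˡ-heap⁻ 𝐮 B {a} {b} refl (_∷_ {y = y} g h) with inˡ-down 𝐮 B {y} b (heap-< (𝐮 ++ B) h)
    ... | c , refl = inˡ-gen⁻ 𝐮 B g ∷ inˡ-heap⁻ 𝐮 B refl h

  convex-++ : ∀ A (𝐮 B : Word m) → ∃[ e ] IsConvexEmbedding 𝐮 (A ++ 𝐮 ++ B) e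
  convex-++ []      𝐮 B = inˡ 𝐮 B , convexEmbedding
    (λ {a} {b} eq → Fin.toℕ-injective (trans (sym (toℕ-inˡ 𝐮 B a)) (trans (cong toℕ eq) (toℕ-inˡ 𝐮 B b))))
    (lookup-inˡ 𝐮 B) (λ a b → mk⇔ (inˡ-heap⁺ 𝐮 B) (inˡ-heap⁻ 𝐮 B refl))
    (λ a b y _ h → inˡ-down 𝐮 B b (heap-< (𝐮 ++ B) h))
  convex-++ (i ∷ A) 𝐮 B = let (e , c) = convex-++ A 𝐮 B in suc ∘ e , convex-∷ c

-- Coxeter embeddings are shifts

iter : ℕ → (ℕ → ℕ) → ℕ → ℕ
iter zero    f x = x
iter (suc q) f x = iter q f (f x)

iter-fix : ∀ q {f : ℕ → ℕ} {x} → f x ≡ x → iter q f x ≡ x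
iter-fix zero    eq = refl
iter-fix (suc q) {f} eq = trans (cong (iter q f) eq) (iter-fix q eq)

swaps : ℕ → ℕ → ℕ → ℕ
swaps i j = swap j ∘ swap i

toℕ-power : ∀ {m} (i j : Fin m) q x → toℕ (((s i ∘ₚ s j) ^ₚ q) ⟨$⟩ʳ x) ≡ iter q (swaps (toℕ i) (toℕ j)) (toℕ x)
toℕ-power i j zero    x = refl
toℕ-power i j (suc q) x = trans (toℕ-power i j q _)
  (cong (iter q _) (trans (fin-swap j _) (cong (swap (toℕ j)) (fin-swap i x))))

HasOrder : ℕ → ℕ → ℕ → Set
HasOrder q i j = ∀ n → iter q (swaps i j) n ≡ n

order⇔ : ∀ {m} (i j : Fin m) q → ((s i ∘ₚ s j) ^ₚ q ≈ Data.Fin.Permutation.id) ⇔ HasOrder q (toℕ i) (toℕ j)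
order⇔ {m} i j q = mk⇔ to λ h x → Fin.toℕ-injective (trans (toℕ-power i j q x) (h (toℕ x)))
  where
  to : ((s i ∘ₚ s j) ^ₚ q ≈ Data.Fin.Permutation.id) → HasOrder q (toℕ i) (toℕ j)
  to h n with fin-or-outside (suc m) n
  ... | inj₁ (x , refl) = trans (sym (toℕ-power i j q x)) (cong toℕ (h x))
  ... | inj₂ m<n = iter-fix q (trans (cong (swap (toℕ j)) (out i)) (out j))
    where
    out : ∀ (i : Fin m) → swap (toℕ i) n ≡ n
    out i = swap-above (<-≤-trans (s≤s (Fin.toℕ<n i)) m<n)

iter-shift : ∀ c i j q x → iter q (swaps (c + i) (c + j)) (c + x) ≡ c + iter q (swaps i j) x
iter-shift c i j zero    x = refl
iter-shift c i j (suc q) x = trans (cong (iter q _) (trans (cong (swap (c + j)) (swap-shift c i x)) (swap-shift c j _))) (iter-shift c i j q _)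

order-shift : ∀ c i j q → HasOrder q i j ⇔ HasOrder q (c + i) (c + j)
order-shift c i j q = mk⇔ to λ h n → +-cancelˡ-≡ c _ _ (trans (sym (iter-shift c i j q n)) (h (c + n)))
  where
  to : HasOrder q i j → HasOrder q (c + i) (c + j)
  to h n with <-≤-connex n c
  ... | inj₁ n<c = iter-fix q (trans (cong (swap (c + j)) (swap-below (<-≤-trans n<c (m≤m+n c i)))) (swap-below (<-≤-trans n<c (m≤m+n c j))))
  ... | inj₂ c≤n = subst (λ n → iter q _ n ≡ n) (m+[n∸m]≡n c≤n) (trans (iter-shift c i j q _) (cong (c +_) (h _)))

order-adjacent : ∀ i → HasOrder 3 i (suc i)
order-adjacent i n = begin
  b (a (b (a (b (a n)))))   ≡⟨ cong (b ∘ a ∘ b) (swap-braid i n) ⟩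
  b (a (b (b (a (b n)))))   ≡⟨ cong (b ∘ a) (swap-involutive (suc i) _) ⟩
  b (a (a (b n)))           ≡⟨ cong b (swap-involutive i _) ⟩
  b (b n)                   ≡⟨ swap-involutive (suc i) n ⟩
  n                         ∎
  where
  open ≡-Reasoning
  a = swap i
  b = swap (suc i)

-- For letters further apart the product exchanges `i` and `suc i`, and so does its cube.
order-3⇒adjacent : ∀ {i j} → i < j → HasOrder 3 i j → j ≡ suc i
order-3⇒adjacent {i} {j} i<j h with m≤n⇒m<n∨m≡n i<j
... | inj₂ eq = sym eq
... | inj₁ lt = contradiction (trans (sym (h i)) eq) (<⇒≢ (n<1+n i))
  where
  forth : swaps i j i ≡ suc i
  forth = trans (cong (swap j) (swap-left i)) (swap-below lt)
  back : swaps i j (suc i) ≡ i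
  back = trans (cong (swap j) (swap-right i)) (swap-below i<j)
  eq : iter 3 (swaps i j) i ≡ suc i
  eq = trans (cong (swaps i j ∘ swaps i j) forth) (trans (cong (swaps i j) back) forth)

-- The relation of order 3 makes neighbours go to neighbours, and orientation makes the next
-- generator go to the next one. Everything is then determined by the image of the lowest generator.
embedding-offset : ∀ {k m} {f : Fin k → Fin m} → IsCoxeterEmbedding f → ∃[ c ] ∀ i → toℕ (f i) ≡ c + toℕ i
embedding-offset {zero} _ = 0 , λ ()
embedding-offset {suc k} {m} {f} (coxeterEmbedding inj rel ori) = c , λ i → go (toℕ i) i refl
  where
  c = toℕ (f zero)
  go : ∀ n (i : Fin (suc k)) → toℕ i ≡ n → toℕ (f i) ≡ c + toℕ i
  go _       zero    _  = sym (+-identityʳ c)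
  go (suc n) (suc i) eq = begin
    toℕ (f (suc i))          ≡⟨ order-3⇒adjacent (ori i′ (suc i) i′<) order ⟩
    suc (toℕ (f i′))         ≡⟨ cong suc (go n i′ (trans (Fin.toℕ-inject₁ i) (suc-injective eq))) ⟩
    suc (c + toℕ i′)         ≡⟨ cong (λ z → suc (c + z)) (Fin.toℕ-inject₁ i) ⟩
    suc (c + toℕ i)          ≡⟨ +-suc c (toℕ i) ⟨
    c + suc (toℕ i)          ∎
    where
    open ≡-Reasoning
    i′ = inject₁ i
    i′< : i′ Fin.< suc i
    i′< = s≤s (≤-reflexive (Fin.toℕ-inject₁ i))
    order : HasOrder 3 (toℕ (f i′)) (toℕ (f (suc i)))
    order = Equivalence.to (order⇔ (f i′) (f (suc i)) 3) (Equivalence.to (rel 3 (inj₂ refl) i′ (suc i))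
      (Equivalence.from (order⇔ i′ (suc i) 3) (subst (λ z → HasOrder 3 z (suc (toℕ i))) (sym (Fin.toℕ-inject₁ i)) (order-adjacent (toℕ i)))))

offset-embedding : ∀ {k m} {f : Fin k → Fin m} c → (∀ i → toℕ (f i) ≡ c + toℕ i) → IsCoxeterEmbedding f
offset-embedding {f = f} c eq = coxeterEmbedding
  (λ {i} {j} e → Fin.toℕ-injective (+-cancelˡ-≡ c _ _ (trans (sym (eq i)) (trans (cong toℕ e) (eq j)))))
  (λ q _ i j → mk⇔
    (λ h → Equivalence.from (order⇔ (f i) (f j) q) (subst₂ (HasOrder q) (sym (eq i)) (sym (eq j))
             (Equivalence.to (order-shift c (toℕ i) (toℕ j) q) (Equivalence.to (order⇔ i j q) h))))
    (λ h → Equivalence.from (order⇔ i j q) (Equivalence.from (order-shift c (toℕ i) (toℕ j) q)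
             (subst₂ (HasOrder q) (eq i) (eq j) (Equivalence.to (order⇔ (f i) (f j) q) h)))))
  (λ i j i<j → subst₂ _<_ (sym (eq i)) (sym (eq j)) (+-monoʳ-< c i<j))

letters-offset : ∀ {k m} {f : Fin k → Fin m} {c} → (∀ i → toℕ (f i) ≡ c + toℕ i) → ∀ 𝐡 → letters (map f 𝐡) ≡ shift c (letters 𝐡)
letters-offset eq 𝐡 = trans (sym (List.map-∘ 𝐡)) (trans (List.map-cong eq 𝐡) (List.map-∘ 𝐡))

letters-++₃ : ∀ {m} (A U B : Word m) → letters (A ++ U ++ B) ≡ letters A ++ letters U ++ letters B
letters-++₃ A U B = trans (List.map-++ toℕ A _) (cong (letters A ++_) (List.map-++ toℕ U B))

-- Heap containment as a factorization of reduced words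

heapContains⇒ : ∀ {m k} {w : Permutation′ (suc m)} {h : Permutation′ (suc k)} → HeapContains w h → Contains (RedWord h) (ext w)
heapContains⇒ {w = w} {h} (𝐰 , red-w , 𝐡 , red-h , f , cox , _ , conv) with reducedFor⇒ {w = w} {𝐰} red-w | embedding-offset cox | convex⇒factor conv
... | rw , same | c , off | A , B , eq , len =
  contains (letters 𝐡) (reducedFor⇒ {w = h} red-h) (letters A) c (letters B)
    (Red-shortest rw (λ x → sym (eq′ x)) (≤-reflexive (sym (trans len (cong (λ v → length (letters A ++ v ++ letters B)) (letters-offset off 𝐡))))))
    (λ x → trans (sym (eq′ x)) (same x))
  where
  eq′ : act (letters 𝐰) ≗ act (letters A ++ shift c (letters 𝐡) ++ letters B)
  eq′ x = trans (eq x) (cong (λ v → act (letters A ++ v ++ letters B) x) (letters-offset off 𝐡))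

-- A factor only shows that the shifted letters occurring in `H` are letters of the ambient group,
-- whereas an embedding must map all `k` generators. The hypothesis of full support closes this gap.
heapContains⇐ : ∀ {m k} {w : Permutation′ (suc m)} {h : Permutation′ (suc k)} →
                (∀ {H} → RedWord h H → ∀ (i : Fin k) → toℕ i ∈ H) → Contains (RedWord h) (ext w) → HeapContains w h
heapContains⇐ {m} {k} {w} {h} full (contains H q X c Y red same)
  with all ← redWord-letters {w = w} (red , same)
  with letters⁻¹ (redWord-letters {w = h} q) | letters⁻¹ (All.++⁻ˡ X all) | letters⁻¹ (All.++⁻ʳ (shift c H) (All.++⁻ʳ X all))
... | 𝐡 , refl | A , refl | B , refl =
  A ++ map f 𝐡 ++ B , reducedFor⇐ {w = w} (subst (λ v → RedWord w v) (sym eq) (red , same)) ,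
  𝐡 , reducedFor⇐ {w = h} q , f , offset-embedding c off , convex-++ A (map f 𝐡) B
  where
  fits : ∀ i → c + toℕ i < m
  fits i = All.lookup (All.map⁻ (All.++⁻ˡ (shift c H) (All.++⁻ʳ X all))) (full q i)
  f : Fin k → Fin m
  f i = fromℕ< (fits i)
  off : ∀ i → toℕ (f i) ≡ c + toℕ i
  off i = Fin.toℕ-fromℕ< (fits i)
  eq : letters (A ++ map f 𝐡 ++ B) ≡ letters A ++ shift c (letters 𝐡) ++ letters B
  eq = trans (letters-++₃ A (map f 𝐡) B) (cong (λ v → letters A ++ v ++ letters B) (letters-offset off 𝐡))

-- The words of the elements of H

Admissible : ∃[ k ] Permutation′ (suc k) → Set
Admissible (k , h) = Connected h × FullyCommutative h × InternalColumns≥2 h × FullSupport h × k ≢ 2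

count-commutation : ∀ {m} {𝐮 𝐯 : Word m} n → CommutationMove 𝐮 𝐯 → count n (letters 𝐮) ≡ count n (letters 𝐯)
count-commutation n (move 𝐮 i j 𝐯 _) = trans (expand i j) (trans (cong (c (letters 𝐮) +_) (two (toℕ i) (toℕ j))) (sym (expand j i)))
  where
  c = count n
  expand : ∀ i j → c (letters (𝐮 ++ i ∷ j ∷ 𝐯)) ≡ c (letters 𝐮) + c (toℕ i ∷ toℕ j ∷ letters 𝐯)
  expand i j = trans (cong c (List.map-++ toℕ 𝐮 _)) (count-++ n (letters 𝐮) _)
  two : ∀ i j → c (i ∷ j ∷ letters 𝐯) ≡ c (j ∷ i ∷ letters 𝐯)
  two i j with i ≟ n | j ≟ n
  ... | yes refl | yes refl = refl
  ... | yes refl | no n₂ = trans (count-here i _) (trans (cong suc (count-skip _ n₂)) (sym (trans (count-skip _ n₂) (count-here i _))))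
  ... | no n₁ | yes refl = trans (count-skip _ n₁) (trans (count-here j _) (sym (trans (count-here j _) (cong suc (count-skip _ n₁)))))
  ... | no n₁ | no n₂ = trans (count-skip _ n₁) (trans (count-skip _ n₂) (sym (trans (count-skip _ n₂) (count-skip _ n₁))))

module _ {k} {h : Permutation′ (suc k)} (adm : Admissible (k , h)) where
  private
    fcomm = proj₁ (proj₂ adm)
    internal≥2 = proj₁ (proj₂ (proj₂ adm))
    full = proj₁ (proj₂ (proj₂ (proj₂ adm)))

  redWords-count : ∀ {U V} → RedWord h U → RedWord h V → ∀ n → count n U ≡ count n V
  redWords-count {U} {V} ru rv n with letters⁻¹ (redWord-letters {w = h} ru) | letters⁻¹ (redWord-letters {w = h} rv)
  ... | 𝐮 , refl | 𝐯 , refl =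
    EqClosure.gfold isEquivalence (count n ∘ letters) (count-commutation n)
      (fcomm 𝐮 𝐯 (reducedFor⇐ {w = h} ru) (reducedFor⇐ {w = h} rv))

  full-letters : ∀ {H} → RedWord h H → ∀ (i : Fin k) → toℕ i ∈ H
  full-letters {H} q i with full i
  ... | 𝐰 , red , i∈ with _∈?_ _≟_ (toℕ i) H
  ...   | yes ∈H = ∈H
  ...   | no ∉H = contradiction (subst (0 <_) (trans (redWords-count (reducedFor⇒ {w = h} red) q (toℕ i)) (count-none (∉⇒All ∉H)))
                    (count-∈ (∈-map⁺ toℕ i∈))) λ ()
    where open import Data.List.Membership.Propositional.Properties using (∈-map⁺)

  -- Connectedness supplies some generator, hence a positive rank, and full support then makes the
  -- lowest generator occur.
  zero-letter : ∀ {H} → RedWord h H → 0 ∈ H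
  zero-letter q with proj₁ adm
  ... | zero , _ = full-letters q zero
  ... | suc _ , _ = full-letters q zero

  heapShape : ∀ {H} → RedWord h H → HeapShape k H
  heapShape {H} q@(red , same) = record
    { fc = fcWord red λ v eq len → redWords-count {v} (Red-shortest red eq (≤-reflexive len) , λ x → trans (eq x) (same x)) q
    ; letters = redWord-letters {w = h} q
    ; internal = int
    ; k≢2 = proj₂ (proj₂ (proj₂ (proj₂ adm)))
    }
    where
    int : ∀ i → 0 < i → suc i < k → 2 ≤ count i H
    int i 0<i 1+i<k = subst (λ n → 2 ≤ count n H) (Fin.toℕ-fromℕ< i<k) (≥2 (proj₁ (letters⁻¹ all)) (proj₂ (letters⁻¹ all)) (fromℕ< i<k)
        (subst (0 <_) (sym (Fin.toℕ-fromℕ< i<k)) 0<i) (subst (λ z → suc z < k) (sym (Fin.toℕ-fromℕ< i<k)) 1+i<k))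
      where
      all = redWord-letters {w = h} q
      i<k : i < k
      i<k = <-trans (n<1+n i) 1+i<k
      column : ∀ (i : Fin k) 𝐰 → columnSize i 𝐰 ≡ count (toℕ i) (letters 𝐰)
      column i []      = refl
      column i (j ∷ 𝐰) with i Fin.≟ j
      ... | yes refl = trans (cong suc (column i 𝐰)) (sym (count-here (toℕ i) _))
      ... | no n     = trans (column i 𝐰) (sym (count-skip _ λ e → n (Fin.toℕ-injective (sym e))))
      support : ∀ {k} (h : Permutation′ (suc (suc k))) → FullSupport h → SupportIs[ zero , Fin.fromℕ k ] h
      support {k} h full = z≤n , λ i → mk⇔ (λ _ → z≤n , Fin.≤fromℕ i) (λ _ → full i)
      ≥2 : ∀ 𝐡 → letters 𝐡 ≡ H → ∀ (i : Fin k) → 0 < toℕ i → suc (toℕ i) < k → 2 ≤ count (toℕ i) H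
      ≥2 𝐡 refl i 0<i 1+i<k = subst (2 ≤_) (column i 𝐡) (go k h internal≥2 full 𝐡 (reducedFor⇐ {w = h} q) i 0<i 1+i<k)
        where
        go : ∀ k (h : Permutation′ (suc k)) → InternalColumns≥2 h → FullSupport h → ∀ 𝐡 → ReducedFor h 𝐡 → ∀ (i : Fin k) → 0 < toℕ i →
             suc (toℕ i) < k → 2 ≤ columnSize i 𝐡
        go (suc k) h int full 𝐡 red i 0<i (s≤s i<k) = int (support h full) 𝐡 red i 0<i (subst (toℕ i <_) (sym (Fin.toℕ-fromℕ k)) i<k)

  contains⇒ : ∀ {m} {w : Permutation′ (suc m)} → HeapContains w h → Contains (RedWord h) (ext w)
  contains⇒ {w = w} = heapContains⇒ {w = w} {h}

  contains⇐ : ∀ {m} {w : Permutation′ (suc m)} → Contains (RedWord h) (ext w) → HeapContains w h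
  contains⇐ {w = w} = heapContains⇐ {w = w} {h} full-letters

-- Adjoining a fixed first point

lift : (ℕ → ℕ) → ℕ → ℕ
lift g zero    = zero
lift g (suc x) = suc (g x)

act-shift-1 : ∀ w → act (shift 1 w) ≗ lift (act w)
act-shift-1 w zero    = act-shift-below 1 w z<s
act-shift-1 w (suc x) = act-shift 1 w x

Red-shift⁻ : ∀ p {w} → Red (shift p w) → Red w
Red-shift⁻ p {w} red = minimal⇒Red {P = λ _ → ⊤} (All.universal _ w) λ v _ eq →
  subst₂ _≤_ (List.length-map (p +_) w) (List.length-map (p +_) v) (Red⇒minimal red (shift p v) (same v eq))
  where
  same : ∀ v → act v ≗ act w → act (shift p v) ≗ act (shift p w)
  same v eq x with <-≤-connex x p
  ... | inj₁ x<p = trans (act-shift-below p v x<p) (sym (act-shift-below p w x<p))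
  ... | inj₂ p≤x = subst (λ x → act (shift p v) x ≡ act (shift p w) x) (m+[n∸m]≡n p≤x)
                     (trans (act-shift p v _) (trans (cong (p +_) (eq _)) (sym (act-shift p w _))))

module _ {Q : List ℕ → Set} where

  contains-lift⇐ : ∀ {g} → Contains Q g → Contains Q (lift g)
  contains-lift⇐ {g} (contains H q X c Y red same) = contains H q (shift 1 X) (suc c) (shift 1 Y)
    (subst Red eq (Red-shift 1 red))
    λ x → trans (cong (λ v → act v x) (sym eq)) (trans (act-shift-1 (X ++ shift c H ++ Y) x) (lift-cong x))
    where
    eq : shift 1 (X ++ shift c H ++ Y) ≡ shift 1 X ++ shift (suc c) H ++ shift 1 Y
    eq = trans (List.map-++ suc X _) (cong (shift 1 X ++_) (trans (List.map-++ suc (shift c H) Y) (cong (_++ shift 1 Y) (sym (List.map-∘ H)))))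
    lift-cong : lift (act (X ++ shift c H ++ Y)) ≗ lift g
    lift-cong zero    = refl
    lift-cong (suc x) = cong suc (same x)

  module _ (zero∈ : ∀ {H} → Q H → 0 ∈ H) where
    open import Data.List.Membership.Propositional.Properties using (∈-map⁺; ∈-++⁺ˡ; ∈-++⁺ʳ)

    private
      offset∈ : ∀ {H} → Q H → ∀ X c Y → c ∈ X ++ shift c H ++ Y
      offset∈ {H} q X c Y = ∈-++⁺ʳ X (∈-++⁺ˡ (subst (_∈ shift c H) (+-identityʳ c) (∈-map⁺ (c +_) (zero∈ q))))

    -- No wire passes the gap above a fixed 0, so the letter 0 does not occur. As the heap has a
    -- letter 0, the offset is itself a letter of the word and hence positive, and the whole
    -- factorization can be shifted down.
    contains-lift⇒ : ∀ {g} → Contains Q (lift g) → Contains Q g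
    contains-lift⇒ {g} (contains H q X c Y red same) = go c refl
      where
      0∉ : 0 ∉ X ++ shift c H ++ Y
      0∉ 0∈ with crossed-gap red 0∈
      ... | zero , y , _ , _ , cr = n≮0 (subst (act (X ++ shift c H ++ Y) y <_) (same 0) cr)
      pos : All (0 <_) (X ++ shift c H ++ Y)
      pos = All.map n≢0⇒n>0 (∉⇒All 0∉)
      unshift-1 : ∀ {w} → All (0 <_) w → ∃[ v ] w ≡ shift 1 v
      unshift-1 []              = [] , refl
      unshift-1 {suc i ∷ w} (_ ∷ ps) = let (v , eq) = unshift-1 ps in i ∷ v , cong (suc i ∷_) eq
      go : ∀ c′ → c ≡ c′ → Contains Q g
      go zero     refl = contradiction (offset∈ q X 0 Y) 0∉
      go (suc c′) refl with unshift-1 (All.++⁻ˡ X pos) | unshift-1 (All.++⁻ʳ (shift (suc c′) H) (All.++⁻ʳ X pos))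
      ... | X′ , refl | Y′ , refl = contains H q X′ c′ Y′ (Red-shift⁻ 1 (subst Red (sym eq) red))
            λ x → suc-injective (trans (sym (act-shift-1 (X′ ++ shift c′ H ++ Y′) (suc x))) (trans (cong (λ v → act v (suc x)) eq) (same (suc x))))
        where
        eq : shift 1 (X′ ++ shift c′ H ++ Y′) ≡ shift 1 X′ ++ shift (suc c′) H ++ shift 1 Y′
        eq = trans (List.map-++ suc X′ _) (cong (shift 1 X′ ++_) (trans (List.map-++ suc (shift c′ H) Y′) (cong (_++ shift 1 Y′) (sym (List.map-∘ H)))))

    ¬contains-id : ¬ Contains Q id
    ¬contains-id (contains H q X c Y red same) with X ++ shift c H ++ Y | offset∈ q X c Y | Red⇒minimal red [] (λ x → sym (same x))
    ... | _ ∷ _ | _ | ()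
    ... | [] | () | _

    -- Only the one-column heap fits into s₁, and every other element
    -- contains it.
    contains-swap⇒ : Contains Q (swap 0) → ∀ {g w} → Red w → act w ≗ g → ∀ {x} → g x ≢ x → Contains Q g
    contains-swap⇒ (contains H q X c Y red same) {w = []} redw samew {x} moves = contradiction (sym (samew x)) moves
    contains-swap⇒ (contains H q X c Y red same) {w = i ∷ w} redw samew {x} moves =
      contains (0 ∷ []) (subst Q (single H (zero∈ q) short) q) [] i w (subst (λ j → Red (j ∷ w)) (sym (+-identityʳ i)) redw)
        λ x → trans (cong (λ j → swap j (act w x)) (+-identityʳ i)) (samew x)
      where
      short : length H ≤ 1
      short = ≤-trans (≤-trans (≤-reflexive (sym (List.length-map (c +_) H))) (≤-trans (m≤m+n _ (length Y)) (≤-trans (≤-reflexive (sym (List.length-++ (shift c H))))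
                (≤-trans (m≤n+m _ (length X)) (≤-reflexive (sym (List.length-++ X))))))) (Red⇒minimal red (0 ∷ []) λ x → sym (same x))
      single : ∀ H → 0 ∈ H → length H ≤ 1 → H ≡ 0 ∷ []
      single (.0 ∷ []) (here refl) _ = refl
      single (_ ∷ _ ∷ _) _ (s≤s ())

-- Patterns

Av321 : (ℕ → ℕ) → Set
Av321 g = ∀ {x y z} → x < y → y < z → g y < g x → g z < g y → ⊥

-- Avoidance of 3421, 4312 and 4321: the middle entry of a 321-pattern
-- determines the other two.
MaxClustered : (ℕ → ℕ) → Set
MaxClustered g = ∀ {x y z} → x < y → y < z → g y < g x → g z < g y →
                 (∀ {t} → t < y → g y < g t → t ≡ x) × (∀ {t} → y < t → g t < g y → t ≡ z)

Av4231 : (ℕ → ℕ) → Set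
Av4231 g = ∀ {a b c d} → a < b → b < c → c < d → g d < g b → g b < g c → g c < g a → ⊥

av321⇒maxClustered : ∀ {g} → Av321 g → MaxClustered g
av321⇒maxClustered av x<y y<z yx zy = ⊥-elim (av x<y y<z yx zy)

av321⇒av4231 : ∀ {g} → Av321 g → Av4231 g
av321⇒av4231 av a<b b<c c<d db bc ca = av a<b (<-trans b<c c<d) (<-trans bc ca) db

Av321-resp : ∀ {g g′} → g ≗ g′ → Av321 g → Av321 g′
Av321-resp eq av {x} {y} {z} p q r t = av p q (subst₂ _<_ (sym (eq y)) (sym (eq x)) r) (subst₂ _<_ (sym (eq z)) (sym (eq y)) t)

MaxClustered-resp : ∀ {g g′} → g ≗ g′ → MaxClustered g → MaxClustered g′
MaxClustered-resp eq mc {x} {y} {z} p q r t =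
  let (l , m) = mc p q (subst₂ _<_ (sym (eq y)) (sym (eq x)) r) (subst₂ _<_ (sym (eq z)) (sym (eq y)) t)
  in (λ {t} t<y yt → l t<y (subst₂ _<_ (sym (eq y)) (sym (eq t)) yt)) , (λ {t} y<t ty → m y<t (subst₂ _<_ (sym (eq t)) (sym (eq y)) ty))

Av4231-resp : ∀ {g g′} → g ≗ g′ → Av4231 g → Av4231 g′
Av4231-resp eq av {a} {b} {c} {d} p q r x y z = av p q r (subst₂ _<_ (sym (eq d)) (sym (eq b)) x)
  (subst₂ _<_ (sym (eq b)) (sym (eq c)) y) (subst₂ _<_ (sym (eq c)) (sym (eq a)) z)

Cut-resp : ∀ {g g′ p} → g ≗ g′ → Cut g p → Cut g′ p
Cut-resp {g} {g′} {p} eq c = record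
  { fixed = trans (sym (eq p)) fixed ; x = x ; y = y ; x<p = x<p ; p<wx = subst (p <_) (eq x) p<wx
  ; unique-x = λ {z} z<p p<gz → unique-x z<p (subst (p <_) (sym (eq z)) p<gz)
  ; p<y = p<y ; wy<p = subst (_< p) (eq y) wy<p
  ; unique-y = λ {z} p<z gz<p → unique-y p<z (subst (_< p) (sym (eq z)) gz<p) }
  where open Cut c

injection-≤ : ∀ {a b} (f : ℕ → ℕ) → (∀ {x} → x < a → f x < b) → (∀ {x y} → x < a → y < a → f x ≡ f y → x ≡ y) → a ≤ b
injection-≤ {a} {b} f into inj = Fin.injective⇒≤ {f = λ i → fromℕ< (into (Fin.toℕ<n i))} λ {i} {j} eq →
  Fin.toℕ-injective (inj (Fin.toℕ<n i) (Fin.toℕ<n j)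
    (trans (sym (Fin.toℕ-fromℕ< (into (Fin.toℕ<n i)))) (trans (cong toℕ eq) (Fin.toℕ-fromℕ< (into (Fin.toℕ<n j))))))

module _ {g g⁻¹ : ℕ → ℕ} (left : g⁻¹ ∘ g ≗ id) (right : g ∘ g⁻¹ ≗ id) where
  private
    inj : ∀ {x y} → g x ≡ g y → x ≡ y
    inj {x} {y} eq = trans (sym (left x)) (trans (cong g⁻¹ eq) (left y))
    inj⁻¹ : ∀ {x y} → g⁻¹ x ≡ g⁻¹ y → x ≡ y
    inj⁻¹ {x} {y} eq = trans (sym (right x)) (trans (cong g eq) (right y))

  -- Exchanging the arguments x and z makes g preserve the set of numbers
  -- on either side of y and g y, so these are equal.
  maxClustered⇒cut : MaxClustered g → ∀ {x y z} → x < y → y < z → g y < g x → g z < g y → Cut g y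
  maxClustered⇒cut mc {x} {y} {z} x<y y<z yx zy = record
    { fixed = fixed ; x = x ; y = z ; x<p = x<y ; p<wx = subst (_< g x) fixed yx
    ; unique-x = λ {t} t<y ty → ux t<y (subst (_< g t) (sym fixed) ty)
    ; p<y = y<z ; wy<p = subst (g z <_) fixed zy
    ; unique-y = λ {t} y<t ty → uz y<t (subst (g t <_) (sym fixed) ty) }
    where
    ux : ∀ {t} → t < y → g y < g t → t ≡ x
    ux = proj₁ (mc x<y y<z yx zy)
    uz : ∀ {t} → y < t → g t < g y → t ≡ z
    uz = proj₂ (mc x<y y<z yx zy)
    below : ∀ {t} → t < y → t ≢ x → g t < g y
    below {t} t<y t≢x with <-cmp (g t) (g y)
    ... | tri< l _ _ = l
    ... | tri≈ _ e _ = contradiction (inj e) (<⇒≢ t<y)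
    ... | tri> _ _ gt = contradiction (ux t<y gt) t≢x
    f : ℕ → ℕ
    f t with t ≟ x
    ... | yes _ = g z
    ... | no  _ = g t
    f-into : ∀ {t} → t < y → f t < g y
    f-into {t} t<y with t ≟ x
    ... | yes _ = zy
    ... | no n  = below t<y n
    f-inj : ∀ {s t} → s < y → t < y → f s ≡ f t → s ≡ t
    f-inj {s} {t} s<y t<y eq with s ≟ x | t ≟ x
    ... | yes e | yes e′ = trans e (sym e′)
    ... | yes _ | no _   = contradiction (inj eq) (>⇒≢ (<-trans t<y y<z))
    ... | no _  | yes _  = contradiction (inj eq) (<⇒≢ (<-trans s<y y<z))
    ... | no _  | no _   = inj eq
    h : ℕ → ℕ
    h v with g⁻¹ v ≟ z
    ... | yes _ = x
    ... | no  _ = g⁻¹ v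
    h-into : ∀ {v} → v < g y → h v < y
    h-into {v} v<gy with g⁻¹ v ≟ z
    ... | yes _ = x<y
    ... | no n with <-cmp (g⁻¹ v) y
    ...   | tri< l _ _ = l
    ...   | tri≈ _ e _ = contradiction (trans (sym (right v)) (cong g e)) (<⇒≢ v<gy)
    ...   | tri> _ _ gt = contradiction (uz gt (subst (_< g y) (sym (right v)) v<gy)) n
    x-big : ∀ {v} → v < g y → g⁻¹ v ≢ x
    x-big {v} v<gy e = <-asym v<gy (subst (g y <_) (trans (cong g (sym e)) (right v)) yx)
    h-inj : ∀ {s t} → s < g y → t < g y → h s ≡ h t → s ≡ t
    h-inj {s} {t} s< t< eq with g⁻¹ s ≟ z | g⁻¹ t ≟ z
    ... | yes e | yes e′ = inj⁻¹ (trans e (sym e′))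
    ... | yes _ | no _   = contradiction (sym eq) (x-big t<)
    ... | no _  | yes _  = contradiction eq (x-big s<)
    ... | no _  | no _   = inj⁻¹ eq
    fixed : g y ≡ y
    fixed = ≤-antisym (injection-≤ h h-into h-inj) (injection-≤ f f-into f-inj)

cut⇒321 : ∀ {g p} (c : Cut g p) → let open Cut c in x < p × p < y × g p < g x × g y < g p
cut⇒321 {g} c = x<p , p<y , subst (_< g x) (sym fixed) p<wx , subst (g y <_) (sym fixed) wy<p
  where open Cut c

NoCutBelow : ℕ → (ℕ → ℕ) → Set
NoCutBelow p g = ∀ {q} → q < p → ¬ Cut g q

FirstCut : ℕ → (ℕ → ℕ) → Set
FirstCut p g = Cut g p × NoCutBelow p g

record Inv (g : ℕ → ℕ) : Set where
  constructor inverses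
  field
    g⁻¹   : ℕ → ℕ
    left  : g⁻¹ ∘ g ≗ id
    right : g ∘ g⁻¹ ≗ id

  bijective : Bij g
  bijective = bij (λ {x} {y} eq → trans (sym (left x)) (trans (cong g⁻¹ eq) (left y))) (λ y → g⁻¹ y , right y)

reflect-< : ∀ {f : ℕ → ℕ} → (∀ {x y} → x < y → f x < f y) → ∀ {x y} → f x < f y → x < y
reflect-< {f} mono {x} {y} lt with <-cmp x y
... | tri< l _ _ = l
... | tri≈ _ refl _ = contradiction lt (<-irrefl refl)
... | tri> _ _ g = contradiction lt (<-asym (mono g))

-- A 321-pattern of w whose middle entry is not the fixed point p lies in
-- the copy of u at 0,…,p-1,y or in the copy of v at x,p+1,p+2,….
module GluePatterns {p u v w} (G : Glue p u v w) (bu : Bounded p u) (iu : Inv u) (iv : Inv v)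
                    (up≢ : u p ≢ p) (v0≢ : v 0 ≢ 0) where
  private
    module G = Glue G
    cut : Cut w p
    cut = glue⇒cut G bu (Inv.bijective iu) (Inv.bijective iv) up≢ v0≢
    open Cut cut

    ιv : ℕ → ℕ
    ιv zero    = x
    ιv (suc r) = p + suc r

    fv : ℕ → ℕ
    fv zero    = u p
    fv (suc r) = p + suc r

    up<p : u p < p
    up<p = ≤∧≢⇒< (Bounded.inside bu ≤-refl) up≢

    ιv-mono : ∀ {a b} → a < b → ιv a < ιv b
    ιv-mono {zero}  {suc b} _   = <-≤-trans x<p (m≤m+n p _)
    ιv-mono {suc a} {suc b} a<b = +-monoʳ-< p a<b

    ιv-reflect : ∀ a b → ιv a < ιv b → a < b
    ιv-reflect _ _ = reflect-< ιv-mono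

    fv-pos : ∀ {n} → n ≢ 0 → fv n ≡ p + n
    fv-pos {zero}  n≢0 = contradiction refl n≢0
    fv-pos {suc n} _   = refl

    fv-mono : ∀ {a b} → a < b → fv a < fv b
    fv-mono {zero}  {suc b} _   = <-≤-trans up<p (m≤m+n p _)
    fv-mono {suc a} {suc b} a<b = +-monoʳ-< p a<b

    ux : u x ≡ p
    ux with m≤n⇒m<n∨m≡n (Bounded.inside bu (<⇒≤ x<p))
    ... | inj₂ e = e
    ... | inj₁ l = contradiction p<wx (<-asym (subst (_< p) (sym (G.low x<p l)) l))

    wιv : ∀ r → w (ιv r) ≡ fv (v r)
    wιv zero    = trans (G.jump↑ x<p ux) (sym (fv-pos v0≢))
    wιv (suc r) with v (suc r) in eq
    ... | zero  = G.jump↓ eq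
    ... | suc t = trans (G.high (λ e → 1+n≢0 (trans (sym eq) e))) (cong (p +_) eq)

    wv⁺ : ∀ {a b} → v a < v b → w (ιv a) < w (ιv b)
    wv⁺ {a} {b} lt = subst₂ _<_ (sym (wιv a)) (sym (wιv b)) (fv-mono lt)

    wv⁻ : ∀ {a b} → w (ιv a) < w (ιv b) → v a < v b
    wv⁻ {a} {b} lt = reflect-< fv-mono (subst₂ _<_ (wιv a) (wιv b) lt)

    ιv-injective : ∀ {a b} → ιv a ≡ ιv b → a ≡ b
    ιv-injective {a} {b} eq with <-cmp a b
    ... | tri< l _ _ = contradiction eq (<⇒≢ (ιv-mono l))
    ... | tri≈ _ e _ = e
    ... | tri> _ _ g = contradiction eq (>⇒≢ (ιv-mono g))

    ιv-high : ∀ {q} → p < q → ∃[ r ] q ≡ ιv (suc r)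
    ιv-high = above⇒suc

    ιv-above : ∀ {q} → p < w q → ∃[ r ] q ≡ ιv r
    ιv-above {q} p<wq with <-cmp q p
    ... | tri< l _ _ = 0 , unique-x l p<wq
    ... | tri≈ _ refl _ = contradiction (subst (p <_) fixed p<wq) (<-irrefl refl)
    ... | tri> _ _ g = let (r , eq) = ιv-high g in suc r , eq

    ιu : ℕ → ℕ
    ιu a with a <? p
    ... | yes _ = a
    ... | no  _ = y

    ιu-low : ∀ {a} → a < p → ιu a ≡ a
    ιu-low {a} a<p with a <? p
    ... | yes _ = refl
    ... | no n  = contradiction a<p n

    ιu-top : ιu p ≡ y
    ιu-top with p <? p
    ... | yes l = contradiction l (<-irrefl refl)
    ... | no _  = refl

    ιu-mono : ∀ {a b} → a < b → b ≤ p → ιu a < ιu b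
    ιu-mono {a} {b} a<b b≤p with m≤n⇒m<n∨m≡n b≤p
    ... | inj₁ b<p = subst₂ _<_ (sym (ιu-low (<-trans a<b b<p))) (sym (ιu-low b<p)) a<b
    ... | inj₂ refl = subst₂ _<_ (sym (ιu-low a<b)) (sym ιu-top) (<-trans a<b p<y)

    vy : ∃[ r ] y ≡ p + suc r × v (suc r) ≡ 0
    vy with above⇒suc p<y
    ... | r , eq with v (suc r) ≟ 0
    ...   | yes e = r , eq , e
    ...   | no n  = contradiction (subst (p ≤_) (sym (trans (cong w eq) (G.high n))) (m≤m+n p _)) (<⇒≱ wy<p)

    wy : w y ≡ u p
    wy = let (r , eq , e) = vy in trans (cong w eq) (G.jump↓ e)

    wιu : ∀ {a} → a ≤ p → (u a < p × w (ιu a) ≡ u a) ⊎ (u a ≡ p × p < w (ιu a))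
    wιu {a} a≤p with m≤n⇒m<n∨m≡n a≤p | m≤n⇒m<n∨m≡n (Bounded.inside bu a≤p)
    ... | inj₁ a<p  | inj₁ l = inj₁ (l , trans (cong w (ιu-low a<p)) (G.low a<p l))
    ... | inj₁ a<p  | inj₂ e = inj₂ (e , subst (p <_) (sym (trans (cong w (ιu-low a<p)) (G.jump↑ a<p e))) (m<m+n p (n≢0⇒n>0 v0≢)))
    ... | inj₂ refl | inj₁ l = inj₁ (l , trans (cong w ιu-top) wy)
    ... | inj₂ refl | inj₂ e = contradiction e up≢

    wu⁺ : ∀ {a b} → a ≤ p → b ≤ p → u a < u b → w (ιu a) < w (ιu b)
    wu⁺ {a} {b} a≤ b≤ lt with wιu a≤ | wιu b≤
    ... | inj₁ (_ , e) | inj₁ (_ , e′) = subst₂ _<_ (sym e) (sym e′) lt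
    ... | inj₁ (l , e) | inj₂ (_ , g)  = <-trans (subst (_< p) (sym e) l) g
    ... | inj₂ (e , _) | _ = contradiction (Bounded.inside bu b≤) (<⇒≱ (subst (_< u b) e lt))

    wu⁻ : ∀ {a b} → a ≤ p → b ≤ p → w (ιu a) < w (ιu b) → u a < u b
    wu⁻ {a} {b} a≤ b≤ lt with <-cmp (u a) (u b)
    ... | tri< l _ _ = l
    ... | tri≈ _ e _ = contradiction (cong (w ∘ ιu) (Bij.injective (Inv.bijective iu) e)) (<⇒≢ lt)
    ... | tri> _ _ g = contradiction lt (<-asym (wu⁺ b≤ a≤ g))

    -- The value `p` is taken by `p` itself, and if `w q` exceeded it, both `a` and `q` would rise
    -- past `p`. So the pattern lies in the copy of `u`: a last entry beyond `p` can only be `y`,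
    -- which plays the position `p` of `u`.
    low-321 : ∀ {a q z} → q < p → a < q → q < z → w q < w a → w z < w q →
              ∃[ c ] q < c × u q < u a × u c < u q
    low-321 {a} {q} {z} q<p a<q q<z qa zq with ≤-<-connex p (w q)
    ... | inj₁ p≤wq with m≤n⇒m<n∨m≡n p≤wq
    ...   | inj₁ p<wq = contradiction (trans (unique-x (<-trans a<q q<p) (<-trans p<wq qa)) (sym (unique-x q<p p<wq))) (<⇒≢ a<q)
    ...   | inj₂ p≡wq = contradiction qa (λ qa → <⇒≢ a<q (trans (unique-x (<-trans a<q q<p) (subst (_< w a) (sym p≡wq) qa)) (sym (no-value q<p (sym p≡wq)))))
      where
      no-value : ∀ {q} → q < p → w q ≡ p → q ≡ x
      no-value {q} q<p e with m≤n⇒m<n∨m≡n (Bounded.inside bu (<⇒≤ q<p))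
      ... | inj₁ l = contradiction (trans (sym (G.low q<p l)) e) (<⇒≢ l)
      ... | inj₂ e′ = contradiction (trans (sym (G.jump↑ q<p e′)) e) (>⇒≢ (m<m+n p (n≢0⇒n>0 v0≢)))
    low-321 {a} {q} {z} q<p a<q q<z qa zq | inj₂ wq<p = c , q<c ,
      wu⁻ (<⇒≤ q<p) (<⇒≤ a<p) (subst₂ _<_ (cong w (sym (ιu-low q<p))) (cong w (sym (ιu-low a<p))) qa) ,
      wu⁻ c≤p (<⇒≤ q<p) (subst₂ _<_ (cong w (sym ιc)) (cong w (sym (ιu-low q<p))) zq)
      where
      a<p = <-trans a<q q<p
      preimage : ∃[ c ] q < c × c ≤ p × ιu c ≡ z
      preimage with <-cmp z p
      ... | tri< l _ _ = z , q<z , <⇒≤ l , ιu-low l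
      ... | tri≈ _ refl _ = contradiction (subst (_< w q) fixed zq) (<-asym wq<p)
      ... | tri> _ _ g = p , q<p , ≤-refl , trans ιu-top (sym (unique-y g (<-trans zq wq<p)))
      c = proj₁ preimage
      q<c = proj₁ (proj₂ preimage)
      c≤p = proj₁ (proj₂ (proj₂ preimage))
      ιc = proj₂ (proj₂ (proj₂ preimage))

    -- A value below `p` at `q` would make `q` and `z` two entries falling past `p`.
    high-value : ∀ {q z} → p < q → q < z → w z < w q → p < w q
    high-value {q} {z} p<q q<z zq with <-cmp (w q) p
    ... | tri> _ _ g = g
    ... | tri< l _ _ = contradiction (trans (unique-y p<q l) (sym (unique-y (<-trans p<q q<z) (<-trans zq l)))) (<⇒≢ q<z)
    ... | tri≈ _ e _ with above⇒suc p<q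
    ...   | r , refl with v (suc r) ≟ 0
    ...     | yes e′ = contradiction (trans (sym (G.jump↓ e′)) e) (<⇒≢ up<p)
    ...     | no n   = contradiction (trans (sym (G.high n)) e) (>⇒≢ (m<m+n p (n≢0⇒n>0 n)))

  maxClustered⇒ : Inv w → MaxClustered w → NoCutBelow p w → Av321 u × MaxClustered v
  maxClustered⇒ iw mc first = av , mcv
    where
    av : Av321 u
    av {a} {b} {c} a<b b<c ba cb = first b<p (subst (Cut w) (ιu-low b<p)
        (maxClustered⇒cut (Inv.left iw) (Inv.right iw) mc (ιu-mono a<b (<⇒≤ b<p)) (ιu-mono b<c c≤p)
          (wu⁺ (<⇒≤ b<p) (<⇒≤ (<-trans a<b b<p)) ba) (wu⁺ c≤p (<⇒≤ b<p) cb)))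
      where
      c≤p : c ≤ p
      c≤p = ≮⇒≥ λ p<c → case <-≤-connex p b of λ
        { (inj₁ p<b) → <-asym b<c (subst₂ _<_ (Bounded.outside bu p<c) (Bounded.outside bu p<b) cb)
        ; (inj₂ b≤p) → <⇒≱ (subst (_< u b) (Bounded.outside bu p<c) cb) (≤-trans (Bounded.inside bu b≤p) (<⇒≤ p<c)) }
      b<p = <-≤-trans b<c c≤p
    mcv : MaxClustered v
    mcv a<b b<c ba cb =
      let (l , r) = mc (ιv-mono a<b) (ιv-mono b<c) (wv⁺ ba) (wv⁺ cb)
      in (λ t<b bt → ιv-injective (l (ιv-mono t<b) (wv⁺ bt))) , (λ b<t tb → ιv-injective (r (ιv-mono b<t) (wv⁺ tb)))

  noCutBelow : Av321 u → NoCutBelow p w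
  noCutBelow av q<p c =
    let (a<q , q<z , qa , zq) = cut⇒321 c
        (_ , q<c , ua , uc) = low-321 q<p a<q q<z qa zq
    in av a<q q<c ua uc

  maxClustered⇐ : Av321 u → MaxClustered v → MaxClustered w
  maxClustered⇐ av mcv {a} {q} {z} a<q q<z qa zq with <-cmp q p
  ... | tri< q<p _ _ = let (_ , q<c , ua , uc) = low-321 q<p a<q q<z qa zq in ⊥-elim (av a<q q<c ua uc)
  ... | tri≈ _ refl _ =
    (λ t<p pt → trans (unique-x t<p (subst (_< _) fixed pt)) (sym (unique-x a<q (subst (_< _) fixed qa)))) ,
    (λ p<t tp → trans (unique-y p<t (subst (_ <_) fixed tp)) (sym (unique-y q<z (subst (_ <_) fixed zq))))
  ... | tri> _ _ p<q with ιv-above (<-trans (high-value p<q q<z zq) qa) | ιv-high p<q | ιv-high (<-trans p<q q<z)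
  ...   | α , refl | β , refl | ζ , refl =
    let (l , r) = mcv {α} {suc β} {suc ζ} (ιv-reflect α (suc β) a<q) (ιv-reflect (suc β) (suc ζ) q<z) (wv⁻ qa) (wv⁻ zq)
    in (λ t<q qt → let (τ , eq) = ιv-above (<-trans (high-value p<q q<z zq) qt)
                   in trans eq (cong ιv (l (ιv-reflect τ (suc β) (subst (_< _) eq t<q)) (wv⁻ {suc β} {τ} (subst (λ t → w (ιv (suc β)) < w t) eq qt))))) ,
       (λ q<t tq → let (τ , eq) = ιv-high (<-trans p<q q<t)
                   in trans eq (cong ιv (r (ιv-reflect (suc β) (suc τ) (subst (_ <_) eq q<t)) (wv⁻ {suc τ} {suc β} (subst (λ t → w t < w (ιv (suc β))) eq tq)))))

  firstCut : Av321 u → FirstCut p w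
  firstCut av = cut , noCutBelow av

  av4231⇒ : Av4231 w → Av4231 v × ¬ Cut v 1
  av4231⇒ av = (λ a<b b<c c<d db bc ca → av (ιv-mono a<b) (ιv-mono b<c) (ιv-mono c<d) (wv⁺ db) (wv⁺ bc) (wv⁺ ca)) , nocut
    where
    nocut : ¬ Cut v 1
    -- The fixed points `p` and `p + 1` stand side by side beneath the same large entry `x` and
    -- before the same small one, and form the 2 and 3 of the pattern.
    nocut c = av {x} {p} {ιv 1} {ιv (Cut.y c)} x<p (m<m+n p z<s) (ιv-mono (Cut.p<y c))
        (subst₂ _<_ (sym (trans (wιv _) (cong fv vy≡0))) (sym fixed) up<p)
        (subst₂ _<_ (sym fixed) (sym (trans (wιv 1) (cong fv (Cut.fixed c)))) (m<m+n p z<s))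
        (wv⁺ {1} {0} (subst₂ _<_ (sym (Cut.fixed c)) (cong v x≡0) (Cut.p<wx c)))
      where
      x≡0 : Cut.x c ≡ 0
      x≡0 = n<1⇒n≡0 (Cut.x<p c)
      vy≡0 : v (Cut.y c) ≡ 0
      vy≡0 = n<1⇒n≡0 (Cut.wy<p c)

  av4231⇐ : Av321 u → MaxClustered v → Av4231 v → ¬ Cut v 1 → Av4231 w
  av4231⇐ av mcv av4 nc {a} {b} {c} {d} a<b b<c c<d db bc ca with <-cmp b p
  ... | tri< b<p _ _ = let (_ , q<c , ua , uc) = low-321 b<p a<b (<-trans b<c c<d) (<-trans bc ca) db in av a<b q<c ua uc
  ... | tri> _ _ p<b with ιv-above (<-trans (high-value p<b (<-trans b<c c<d) db) (<-trans bc ca))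
                        | ιv-high p<b | ιv-high (<-trans p<b b<c) | ιv-high (<-trans p<b (<-trans b<c c<d))
  ...   | α , refl | β , refl | γ , refl | δ , refl =
    av4 (ιv-reflect α (suc β) a<b) (ιv-reflect (suc β) (suc γ) b<c) (ιv-reflect (suc γ) (suc δ) c<d) (wv⁻ db) (wv⁻ bc) (wv⁻ ca)
  av4231⇐ av mcv av4 nc {a} {b} {c} {d} a<b b<c c<d db bc ca | tri≈ _ refl _
    with unique-x a<b (subst (_< w a) fixed (<-trans bc ca)) | ιv-high b<c | ιv-high (<-trans b<c c<d)
  -- A 4231-pattern whose 2 is `p` begins at `x`, and its 4, 3 and 1 form a 321-pattern of `v` with
  -- first entry 0. Its middle entry can be replaced by 1.
  ... | refl | γ , refl | δ , refl = nc (maxClustered⇒cut (Inv.left iv) (Inv.right iv) mcv {0} {1} {suc δ} z<s 1<δ v1<v0 vδ<v1)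
    where
    v-inj = Bij.injective (Inv.bijective iv)
    γ<δ : suc γ < suc δ
    γ<δ = ιv-reflect (suc γ) (suc δ) c<d
    1<δ : 1 < suc δ
    1<δ = ≤-<-trans (s≤s z≤n) γ<δ
    vδ≡0 : v (suc δ) ≡ 0
    vδ≡0 with v (suc δ) in e
    ... | zero  = refl
    ... | suc t = contradiction (subst₂ _<_ (trans (wιv (suc δ)) (cong fv e)) fixed db) (≤⇒≯ (m≤m+n p _))
    cutγ : Cut v (suc γ)
    cutγ = maxClustered⇒cut (Inv.left iv) (Inv.right iv) mcv {0} {suc γ} {suc δ} z<s γ<δ (wv⁻ ca) (wv⁻ (<-trans db bc))
    v1<v0 : v 1 < v 0
    v1<v0 with <-cmp (v 1) (v (suc γ))
    ... | tri< l _ _ = <-trans l (wv⁻ ca)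
    ... | tri≈ _ e _ = subst (_< v 0) (sym e) (wv⁻ ca)
    ... | tri> _ _ g with m≤n⇒m<n∨m≡n (s≤s (z≤n {γ}))
    ...   | inj₂ 1≡γ = subst (λ t → v t < v 0) (sym 1≡γ) (wv⁻ ca)
    -- Both 0 and 1 would rise past the cut at `suc γ`, which only one entry does.
    ...   | inj₁ 1<γ = contradiction (trans (Cut.unique-x cutγ 1<γ (subst (_< v 1) (Cut.fixed cutγ) g))
                         (sym (Cut.unique-x cutγ z<s (subst (_< v 0) (Cut.fixed cutγ) (wv⁻ ca))))) λ ()
    vδ<v1 : v (suc δ) < v 1
    vδ<v1 = subst (_< v 1) (sym vδ≡0) (n≢0⇒n>0 λ e → <⇒≢ 1<δ (v-inj (trans e (sym vδ≡0))))

-- Classical patterns of permutations of Fin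

chain-mono : ∀ {k} (f : Fin (suc k) → ℕ) → (∀ i → f (inject₁ i) < f (suc i)) → ∀ {a b} → a Fin.< b → f a < f b
chain-mono {suc k} f ch {zero}  {suc zero}    _         = ch zero
chain-mono {suc k} f ch {zero}  {suc (suc b)} _         = <-trans (ch zero) (chain-mono (f ∘ suc) (ch ∘ suc) {zero} {suc b} z<s)
chain-mono {suc k} f ch {suc a} {suc b}       (s≤s a<b) = chain-mono (f ∘ suc) (ch ∘ suc) a<b

-- An occurrence of p in w: increasing positions, with values increasing
-- when listed in the order of the values of p.
Occurrence : ∀ {n k} → Permutation′ n → Permutation′ (suc k) → (Fin (suc k) → ℕ) → Set
Occurrence {k = k} w p e = (∀ (i : Fin k) → e (inject₁ i) < e (suc i)) ×
                           (∀ (i : Fin k) → ext w (e (p ⟨$⟩ˡ inject₁ i)) < ext w (e (p ⟨$⟩ˡ suc i)))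

occurrence⇒ : ∀ {n k} {w : Permutation′ n} {p : Permutation′ (suc k)} {e} → (∀ a → e a < n) → Occurrence w p e → ContainsPattern w p
occurrence⇒ {n} {k} {w} {p} {e} e<n (pos , val) = e′ , (λ a b a<b → subst₂ _<_ (sym (toℕ-e′ a)) (sym (toℕ-e′ b)) (chain-mono e pos a<b)) ,
    λ a b → mk⇔ (forward a b) (backward a b)
  where
  e′ : Fin (suc k) → Fin n
  e′ a = fromℕ< (e<n a)
  toℕ-e′ : ∀ a → toℕ (e′ a) ≡ e a
  toℕ-e′ a = Fin.toℕ-fromℕ< (e<n a)
  value : ∀ a → ext w (e (p ⟨$⟩ˡ (p ⟨$⟩ʳ a))) ≡ toℕ (w ⟨$⟩ʳ e′ a)
  value a = trans (cong (ext w) (trans (cong e (inverseˡ p)) (sym (toℕ-e′ a)))) (ext-toℕ w (e′ a))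
  forward : ∀ a b → p ⟨$⟩ʳ a Fin.< p ⟨$⟩ʳ b → w ⟨$⟩ʳ e′ a Fin.< w ⟨$⟩ʳ e′ b
  forward a b lt = subst₂ _<_ (value a) (value b) (chain-mono (λ c → ext w (e (p ⟨$⟩ˡ c))) val lt)
  backward : ∀ a b → w ⟨$⟩ʳ e′ a Fin.< w ⟨$⟩ʳ e′ b → p ⟨$⟩ʳ a Fin.< p ⟨$⟩ʳ b
  backward a b lt with Fin.<-cmp (p ⟨$⟩ʳ a) (p ⟨$⟩ʳ b)
  ... | tri< l _ _ = l
  ... | tri> _ _ g = contradiction lt (<-asym (forward b a g))
  ... | tri≈ _ eq _ = contradiction (subst (λ z → w ⟨$⟩ʳ e′ a Fin.< w ⟨$⟩ʳ e′ z) (sym a≡b) lt) (<-irrefl refl)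
    where a≡b = trans (sym (inverseˡ p)) (trans (cong (p ⟨$⟩ˡ_) eq) (inverseˡ p))

occurrence⇐ : ∀ {n k} {w : Permutation′ n} {p : Permutation′ (suc k)} → ContainsPattern w p → ∃ (Occurrence w p)
occurrence⇐ {w = w} {p} (e , mono , iso) = toℕ ∘ e , (λ i → mono (inject₁ i) (suc i) (s≤s (≤-reflexive (Fin.toℕ-inject₁ i)))) ,
  λ i → subst₂ _<_ (sym (ext-toℕ w _)) (sym (ext-toℕ w _)) (Equivalence.to (iso _ _)
    (subst₂ Fin._<_ (sym (inverseʳ p)) (sym (inverseʳ p)) (s≤s (≤-reflexive (Fin.toℕ-inject₁ i)))))

-- This bounds the last position of a pattern found in `ext w`, so that the occurrence can be read
-- back in `Fin n`.
inversion-bound : ∀ {n} (w : Permutation′ n) {y z} → y < z → ext w z < ext w y → z < n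
inversion-bound {n} w {y} {z} y<z inv with <-≤-connex z n
... | inj₁ z<n = z<n
... | inj₂ n≤z = contradiction wy≡y (>⇒≢ (<-trans y<z z<wy))
  where
  z<wy : z < ext w y
  z<wy = subst (_< ext w y) (ext-outside w n≤z) inv
  wy≡y : ext w y ≡ y
  wy≡y = Bij.injective (ext-Bij w) (ext-outside w (≤-trans n≤z (<⇒≤ z<wy)))

triple : ℕ → ℕ → ℕ → Fin 3 → ℕ
triple a b c zero             = a
triple a b c (suc zero)       = b
triple a b c (suc (suc zero)) = c

quadruple : ℕ → ℕ → ℕ → ℕ → Fin 4 → ℕ
quadruple a b c d zero                   = a
quadruple a b c d (suc zero)             = b
quadruple a b c d (suc (suc zero))       = c
quadruple a b c d (suc (suc (suc zero))) = d

module _ {n} (w : Permutation′ n) where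
  private
    g = ext w

    occ₃ : ∀ {p : Permutation′ 3} {a b c} → a < b → b < c → c < n →
           (∀ i → g (triple a b c (p ⟨$⟩ˡ inject₁ i)) < g (triple a b c (p ⟨$⟩ˡ suc i))) → ContainsPattern w p
    occ₃ {p} {a} {b} {c} a<b b<c c<n val = occurrence⇒ {w = w} {p} {triple a b c}
      (λ { zero → <-trans a<b (<-trans b<c c<n) ; (suc zero) → <-trans b<c c<n ; (suc (suc zero)) → c<n })
      ((λ { zero → a<b ; (suc zero) → b<c }) , val)

    occ₄ : ∀ {p : Permutation′ 4} {a b c d} → a < b → b < c → c < d → d < n →
           (∀ i → g (quadruple a b c d (p ⟨$⟩ˡ inject₁ i)) < g (quadruple a b c d (p ⟨$⟩ˡ suc i))) → ContainsPattern w p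
    occ₄ {p} {a} {b} {c} {d} a<b b<c c<d d<n val = occurrence⇒ {w = w} {p} {quadruple a b c d}
      (λ { zero → <-trans a<b (<-trans b<c (<-trans c<d d<n)) ; (suc zero) → <-trans b<c (<-trans c<d d<n)
         ; (suc (suc zero)) → <-trans c<d d<n ; (suc (suc (suc zero))) → d<n })
      ((λ { zero → a<b ; (suc zero) → b<c ; (suc (suc zero)) → c<d }) , val)

  av321⇔ : (¬ ContainsPattern w [321]) ⇔ Av321 g
  av321⇔ = mk⇔ to from
    where
    to : ¬ ContainsPattern w [321] → Av321 g
    to av x<y y<z yx zy = av (occ₃ {[321]} x<y y<z (inversion-bound w y<z zy) λ { zero → zy ; (suc zero) → yx })
    from : Av321 g → ¬ ContainsPattern w [321]
    from av c = let (e , pos , val) = occurrence⇐ {w = w} {[321]} c in av (pos zero) (pos (suc zero)) (val (suc zero)) (val zero)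

  av4231⇔ : (¬ ContainsPattern w [4231]) ⇔ Av4231 g
  av4231⇔ = mk⇔ to from
    where
    to : ¬ ContainsPattern w [4231] → Av4231 g
    to av a<b b<c c<d db bc ca = av (occ₄ {[4231]} a<b b<c c<d (inversion-bound w (<-trans b<c c<d) db)
      λ { zero → db ; (suc zero) → bc ; (suc (suc zero)) → ca })
    from : Av4231 g → ¬ ContainsPattern w [4231]
    from av c = let (e , pos , val) = occurrence⇐ {w = w} {[4231]} c
                in av (pos zero) (pos (suc zero)) (pos (suc (suc zero))) (val zero) (val (suc zero)) (val (suc (suc zero)))

  -- Two larger entries before the middle one of a 321-pattern give 3421 or 4321, depending on their
  -- order; two smaller ones after it give 4312 or 4321. Each of the three patterns conversely
  -- contains such a configuration.
  maxClustered⇔ : (¬ ContainsPattern w [3421] × ¬ ContainsPattern w [4312] × ¬ ContainsPattern w [4321]) ⇔ MaxClustered g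
  maxClustered⇔ = mk⇔ to from
    where
    to : (¬ ContainsPattern w [3421] × ¬ ContainsPattern w [4312] × ¬ ContainsPattern w [4321]) → MaxClustered g
    to (av₃ , av₄ , av) {x} {y} {z} x<y y<z yx zy = larger , smaller
      where
      z<n = inversion-bound w y<z zy
      two-larger : ∀ {a b} → a < b → b < y → g y < g a → g y < g b → ⊥
      two-larger {a} {b} a<b b<y ya yb with <-cmp (g a) (g b)
      ... | tri< l _ _ = av₃ (occ₄ {[3421]} a<b b<y y<z z<n λ { zero → zy ; (suc zero) → ya ; (suc (suc zero)) → l })
      ... | tri≈ _ e _ = <⇒≢ a<b (Bij.injective (ext-Bij w) e)
      ... | tri> _ _ l = av (occ₄ {[4321]} a<b b<y y<z z<n λ { zero → zy ; (suc zero) → yb ; (suc (suc zero)) → l })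
      larger : ∀ {t} → t < y → g y < g t → t ≡ x
      larger {t} t<y yt with <-cmp t x
      ... | tri< l _ _ = ⊥-elim (two-larger l x<y yt yx)
      ... | tri≈ _ e _ = e
      ... | tri> _ _ l = ⊥-elim (two-larger l t<y yx yt)
      two-smaller : ∀ {c d} → c < d → y < c → g c < g y → g d < g y → ⊥
      two-smaller {c} {d} c<d y<c cy dy with <-cmp (g c) (g d)
      ... | tri< l _ _ = av₄ (occ₄ {[4312]} x<y y<c c<d d<n λ { zero → l ; (suc zero) → dy ; (suc (suc zero)) → yx })
        where d<n = inversion-bound w (<-trans y<c c<d) dy
      ... | tri≈ _ e _ = <⇒≢ c<d (Bij.injective (ext-Bij w) e)
      ... | tri> _ _ l = av (occ₄ {[4321]} x<y y<c c<d (inversion-bound w c<d l) λ { zero → l ; (suc zero) → cy ; (suc (suc zero)) → yx })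
      smaller : ∀ {t} → y < t → g t < g y → t ≡ z
      smaller {t} y<t ty with <-cmp t z
      ... | tri< l _ _ = ⊥-elim (two-smaller l y<t ty zy)
      ... | tri≈ _ e _ = e
      ... | tri> _ _ l = ⊥-elim (two-smaller l y<z zy ty)
    from : MaxClustered g → ¬ ContainsPattern w [3421] × ¬ ContainsPattern w [4312] × ¬ ContainsPattern w [4321]
    from mc = no₃ , no₄ , no₁
      where
      no₃ : ¬ ContainsPattern w [3421]
      no₃ c = let (e , pos , val) = occurrence⇐ {w = w} {[3421]} c
                  (l , _) = mc (<-trans (pos zero) (pos (suc zero))) (pos (suc (suc zero))) (val (suc zero)) (val zero)
              in <⇒≢ (pos zero) (sym (l (pos (suc zero)) (<-trans (val (suc zero)) (val (suc (suc zero))))))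
      no₄ : ¬ ContainsPattern w [4312]
      no₄ c = let (e , pos , val) = occurrence⇐ {w = w} {[4312]} c
                  (_ , l) = mc (pos zero) (pos (suc zero)) (val (suc (suc zero))) (<-trans (val zero) (val (suc zero)))
              in <⇒≢ (pos (suc (suc zero))) (sym (l (<-trans (pos (suc zero)) (pos (suc (suc zero)))) (val (suc zero))))
      no₁ : ¬ ContainsPattern w [4321]
      no₁ c = let (e , pos , val) = occurrence⇐ {w = w} {[4321]} c
                  (l , _) = mc (<-trans (pos zero) (pos (suc zero))) (pos (suc (suc zero))) (<-trans (val (suc zero)) (val (suc (suc zero)))) (val zero)
             in <⇒≢ (pos zero) (sym (l (pos (suc zero)) (val (suc zero))))

-- Gluing and splitting permutations

glueAbove : ℕ → (ℕ → ℕ) → (ℕ → ℕ) → ℕ → ℕ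
glueAbove p u v r with v r ≟ 0
... | yes _ = u p
... | no  _ = p + v r

glueFn : ℕ → (ℕ → ℕ) → (ℕ → ℕ) → ℕ → ℕ
glueFn p u v x with <-cmp x p
... | tri≈ _ _ _ = p
... | tri> _ _ _ = glueAbove p u v (x ∸ p)
... | tri< _ _ _ with u x ≟ p
...   | yes _ = p + v 0
...   | no  _ = u x

glueFn-Glue : ∀ p u v → Glue p u v (glueFn p u v)
glueFn-Glue p u v = record { low = l ; jump↑ = j↑ ; mid = m ; high = h ; jump↓ = j↓ }
  where
  l : ∀ {q} → q < p → u q < p → glueFn p u v q ≡ u q
  l {q} q<p uq with <-cmp q p
  ... | tri≈ _ e _ = contradiction e (<⇒≢ q<p)
  ... | tri> _ _ g = contradiction q<p (<-asym g)
  ... | tri< _ _ _ with u q ≟ p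
  ...   | yes e = contradiction e (<⇒≢ uq)
  ...   | no _  = refl
  j↑ : ∀ {q} → q < p → u q ≡ p → glueFn p u v q ≡ p + v 0
  j↑ {q} q<p uq with <-cmp q p
  ... | tri≈ _ e _ = contradiction e (<⇒≢ q<p)
  ... | tri> _ _ g = contradiction q<p (<-asym g)
  ... | tri< _ _ _ with u q ≟ p
  ...   | yes _ = refl
  ...   | no n  = contradiction uq n
  m : glueFn p u v p ≡ p
  m with <-cmp p p
  ... | tri≈ _ _ _ = refl
  ... | tri< l _ _ = contradiction l (<-irrefl refl)
  ... | tri> _ _ l = contradiction l (<-irrefl refl)
  h : ∀ {r} → v (suc r) ≢ 0 → glueFn p u v (p + suc r) ≡ p + v (suc r)
  h {r} n with <-cmp (p + suc r) p
  ... | tri≈ _ e _ = contradiction e (>⇒≢ (m<m+n p z<s))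
  ... | tri< l _ _ = contradiction l (<-asym (m<m+n p z<s))
  ... | tri> _ _ _ = trans (cong (glueAbove p u v) (m+n∸m≡n p (suc r))) keeps
    where
    keeps : glueAbove p u v (suc r) ≡ p + v (suc r)
    keeps with v (suc r) ≟ 0
    ... | yes e = contradiction e n
    ... | no _  = refl
  j↓ : ∀ {r} → v (suc r) ≡ 0 → glueFn p u v (p + suc r) ≡ u p
  j↓ {r} e with <-cmp (p + suc r) p
  ... | tri≈ _ e _ = contradiction e (>⇒≢ (m<m+n p z<s))
  ... | tri< l _ _ = contradiction l (<-asym (m<m+n p z<s))
  ... | tri> _ _ _ = trans (cong (glueAbove p u v) (m+n∸m≡n p (suc r))) drops
    where
    drops : glueAbove p u v (suc r) ≡ u p
    drops with v (suc r) ≟ 0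
    ... | yes _ = refl
    ... | no n  = contradiction e n

-- Gluing commutes with inversion, with `jump↑` and `jump↓` trading roles. This supplies the inverse
-- of a glued permutation.
glue-inverse : ∀ {p u u′ v v′ w w′} → Glue p u v w → Glue p u′ v′ w′ → Bounded p u → u p ≢ p → v 0 ≢ 0 →
               u′ ∘ u ≗ id → v′ ∘ v ≗ id → w′ ∘ w ≗ id
glue-inverse {p} {u} {u′} {v} {v′} {w} {w′} G G′ bu up≢ v0≢ uu vv x with <-cmp x p
... | tri≈ _ refl _ = trans (cong w′ (Glue.mid G)) (Glue.mid G′)
... | tri< x<p _ _ with m≤n⇒m<n∨m≡n (Bounded.inside bu (<⇒≤ x<p))
...   | inj₁ l = trans (cong w′ (Glue.low G x<p l)) (trans (Glue.low G′ l (subst (_< p) (sym (uu x)) x<p)) (uu x))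
...   | inj₂ e with v 0 in eq
...     | zero  = contradiction refl v0≢
...     | suc r = trans (cong w′ (trans (Glue.jump↑ G x<p e) (cong (p +_) eq)))
                    (trans (Glue.jump↓ G′ (trans (cong v′ (sym eq)) (vv 0))) (trans (cong u′ (sym e)) (uu x)))
glue-inverse {p} {u} {u′} {v} {v′} {w} {w′} G G′ bu up≢ v0≢ uu vv x | tri> _ _ g with above⇒suc g
... | r , refl with v (suc r) in eq
...   | zero  = trans (cong w′ (Glue.jump↓ G eq)) (trans (Glue.jump↑ G′ (≤∧≢⇒< (Bounded.inside bu ≤-refl) up≢) (uu p))
                  (cong (p +_) (trans (cong v′ (sym eq)) (vv (suc r)))))
...   | suc t = trans (cong w′ (trans (Glue.high G (λ e → 1+n≢0 (trans (sym eq) e))) (cong (p +_) eq)))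
                  (trans (Glue.high G′ (λ e → 1+n≢0 (trans (sym v′t) e))) (cong (p +_) v′t))
  where
  v′t : v′ (suc t) ≡ suc r
  v′t = trans (cong v′ (sym eq)) (vv (suc r))

mkPerm : ∀ {m g} → Inv g → (∀ {x} → m < x → g x ≡ x) → ∃[ w ] ext {suc m} w ≗ g
mkPerm {m} {g} (inverses g⁻¹ left right) out = w , λ x → sym (ext-ext w (λ i → sym (Fin.toℕ-fromℕ< (to< i))) out x)
  where
  out⁻¹ : ∀ {x} → m < x → g⁻¹ x ≡ x
  out⁻¹ {x} m<x = trans (cong g⁻¹ (sym (out m<x))) (left x)
  keeps : ∀ {f f⁻¹ : ℕ → ℕ} → f⁻¹ ∘ f ≗ id → (∀ {x} → m < x → f⁻¹ x ≡ x) → ∀ (i : Fin (suc m)) → f (toℕ i) < suc m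
  keeps {f} fl fo i = ≰⇒> λ m<fi → <⇒≱ (Fin.toℕ<n i) (subst (suc m ≤_) (trans (sym (fo m<fi)) (fl (toℕ i))) m<fi)
  to<   = keeps {g} {g⁻¹} left out⁻¹
  from< = keeps {g⁻¹} {g} right out
  w : Permutation′ (suc m)
  w = permutation (λ i → fromℕ< (to< i)) (λ i → fromℕ< (from< i))
    (λ i → Fin.toℕ-injective (trans (Fin.toℕ-fromℕ< (to< _)) (trans (cong g (Fin.toℕ-fromℕ< (from< i))) (right (toℕ i)))))
    (λ i → Fin.toℕ-injective (trans (Fin.toℕ-fromℕ< (from< _)) (trans (cong g⁻¹ (Fin.toℕ-fromℕ< (to< i))) (left (toℕ i)))))

ext-Inv : ∀ {m} (w : Permutation′ m) → Inv (ext w)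
ext-Inv w = inverses (ext (flip w)) (ext-flipˡ w) (ext-flipʳ w)

glue-perm : ∀ {p m} (u : Permutation′ (suc p)) (v : Permutation′ (suc m)) → ext u p ≢ p → ext v 0 ≢ 0 →
            ∃[ w ] Glue p (ext u) (ext v) (ext {suc (p + m)} w)
glue-perm {p} {m} u v up≢ v0≢ = proj₁ W , glue-resp (λ _ → refl) (λ _ → refl) (λ x → sym (proj₂ W x)) G
  where
  u⁻¹ = ext (flip u)
  v⁻¹ = ext (flip v)
  G  = glueFn-Glue p (ext u) (ext v)
  G⁻ = glueFn-Glue p u⁻¹ v⁻¹
  up≢⁻ : u⁻¹ p ≢ p
  up≢⁻ e = up≢ (trans (cong (ext u) (sym e)) (ext-flipʳ u p))
  v0≢⁻ : v⁻¹ 0 ≢ 0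
  v0≢⁻ e = v0≢ (trans (cong (ext v) (sym e)) (ext-flipʳ v 0))
  out : ∀ {x} → p + m < x → glueFn p (ext u) (ext v) x ≡ x
  out {x} lt with above⇒suc (≤-<-trans (m≤m+n p m) lt)
  ... | r , refl = trans (Glue.high G (λ e → 1+n≢0 (trans (sym fix) e))) (cong (p +_) fix)
    where
    fix : ext v (suc r) ≡ suc r
    fix = ext-outside v (+-cancelˡ-< p m (suc r) lt)
  W = mkPerm (inverses (glueFn p u⁻¹ v⁻¹) (glue-inverse G G⁻ (ext-Bounded u) up≢ v0≢ (ext-flipˡ u) (ext-flipˡ v))
                                    (glue-inverse G⁻ G (ext-Bounded (flip u)) up≢⁻ v0≢⁻ (ext-flipʳ u) (ext-flipʳ v))) out

module SplitFn {p} {w : ℕ → ℕ} (i : Inv w) (cut : Cut w p) where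
  open Cut cut
  private
    w-inj = Bij.injective (Inv.bijective i)

  splitˡ : ℕ → ℕ
  splitˡ q with <-cmp q p
  ... | tri≈ _ _ _ = w y
  ... | tri> _ _ _ = q
  ... | tri< _ _ _ with w q <? p
  ...   | yes _ = w q
  ...   | no  _ = p

  -- Truncated subtraction is meant: the value at `y` lies below `p`, so the position of `y`
  -- receives the value 0 that the upper half must have there.
  splitʳ : ℕ → ℕ
  splitʳ zero    = w x ∸ p
  splitʳ (suc r) = w (p + suc r) ∸ p

  splitˡ-low : ∀ {q} → q < p → w q < p → splitˡ q ≡ w q
  splitˡ-low {q} q<p wq<p with <-cmp q p
  ... | tri≈ _ e _ = contradiction e (<⇒≢ q<p)
  ... | tri> _ _ g = contradiction q<p (<-asym g)
  ... | tri< _ _ _ with w q <? p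
  ...   | yes _ = refl
  ...   | no n  = contradiction wq<p n

  splitˡ-x : splitˡ x ≡ p
  splitˡ-x with <-cmp x p
  ... | tri≈ _ e _ = contradiction e (<⇒≢ x<p)
  ... | tri> _ _ g = contradiction x<p (<-asym g)
  ... | tri< _ _ _ with w x <? p
  ...   | yes l = contradiction p<wx (<-asym l)
  ...   | no _  = refl

  splitˡ-p : splitˡ p ≡ w y
  splitˡ-p with <-cmp p p
  ... | tri≈ _ _ _ = refl
  ... | tri< l _ _ = contradiction l (<-irrefl refl)
  ... | tri> _ _ l = contradiction l (<-irrefl refl)

  splitˡ-above : ∀ {q} → p < q → splitˡ q ≡ q
  splitˡ-above {q} p<q with <-cmp q p
  ... | tri≈ _ e _ = contradiction e (>⇒≢ p<q)
  ... | tri> _ _ _ = refl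
  ... | tri< l _ _ = contradiction p<q (<-asym l)

  low-or-x : ∀ {q} → q < p → w q < p ⊎ q ≡ x
  low-or-x {q} q<p with <-cmp (w q) p
  ... | tri< l _ _ = inj₁ l
  ... | tri≈ _ e _ = contradiction (w-inj (trans e (sym fixed))) (<⇒≢ q<p)
  ... | tri> _ _ g = inj₂ (unique-x q<p g)

  high-or-y : ∀ {q} → p < q → p < w q ⊎ q ≡ y
  high-or-y {q} p<q with <-cmp (w q) p
  ... | tri> _ _ g = inj₁ g
  ... | tri≈ _ e _ = contradiction (w-inj (trans e (sym fixed))) (>⇒≢ p<q)
  ... | tri< l _ _ = inj₂ (unique-y p<q l)

  splitʳ-high : ∀ {r} → p < w (p + suc r) → p + splitʳ (suc r) ≡ w (p + suc r)
  splitʳ-high lt = m+[n∸m]≡n (<⇒≤ lt)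

  splitʳ-0 : p + splitʳ 0 ≡ w x
  splitʳ-0 = m+[n∸m]≡n (<⇒≤ p<wx)

  splitʳ-y : ∀ {r} → p + suc r ≡ y → splitʳ (suc r) ≡ 0
  splitʳ-y e = m≤n⇒m∸n≡0 (<⇒≤ (subst (λ z → w z < p) (sym e) wy<p))

  split-Glue : Glue p splitˡ splitʳ w
  split-Glue = record { low = l ; jump↑ = j↑ ; mid = fixed ; high = h ; jump↓ = j↓ }
    where
    l : ∀ {q} → q < p → splitˡ q < p → w q ≡ splitˡ q
    l {q} q<p uq with low-or-x q<p
    ... | inj₁ wq   = sym (splitˡ-low q<p wq)
    ... | inj₂ refl = contradiction splitˡ-x (<⇒≢ uq)
    j↑ : ∀ {q} → q < p → splitˡ q ≡ p → w q ≡ p + splitʳ 0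
    j↑ {q} q<p uq with low-or-x q<p
    ... | inj₁ wq   = contradiction (trans (sym (splitˡ-low q<p wq)) uq) (<⇒≢ wq)
    ... | inj₂ refl = sym splitʳ-0
    h : ∀ {r} → splitʳ (suc r) ≢ 0 → w (p + suc r) ≡ p + splitʳ (suc r)
    h {r} n with high-or-y (m<m+n p (z<s {r}))
    ... | inj₁ g = sym (splitʳ-high g)
    ... | inj₂ e = contradiction (splitʳ-y e) n
    j↓ : ∀ {r} → splitʳ (suc r) ≡ 0 → w (p + suc r) ≡ splitˡ p
    j↓ {r} v0 with high-or-y (m<m+n p (z<s {r}))
    ... | inj₁ g = contradiction (trans (sym (splitʳ-high g)) (trans (cong (p +_) v0) (+-identityʳ p))) (>⇒≢ g)
    ... | inj₂ e = trans (cong w e) (sym splitˡ-p)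

cut-inverse : ∀ {p w} (i : Inv w) → Cut w p → Cut (Inv.g⁻¹ i) p
cut-inverse {p} {w} (inverses w⁻¹ left right) cut = record
  { fixed = trans (cong w⁻¹ (sym fixed)) (left p)
  ; x = w y ; y = w x
  ; x<p = wy<p ; p<wx = subst (p <_) (sym (left y)) p<y
  ; unique-x = λ {z} z<p p<w⁻¹z → trans (sym (right z)) (cong w (unique-y p<w⁻¹z (subst (_< p) (sym (right z)) z<p)))
  ; p<y = p<wx ; wy<p = subst (_< p) (sym (left x)) x<p
  ; unique-y = λ {z} p<z w⁻¹z<p → trans (sym (right z)) (cong w (unique-x w⁻¹z<p (subst (p <_) (sym (right z)) p<z)))
  }
  where open Cut cut

-- The endpoints of the two cuts are matched by hypotheses, since the module serves both directions:
-- inverting a cut twice returns its endpoints only up to a propositional equality.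
module _ {p w w⁻¹} (left : w⁻¹ ∘ w ≗ id) (i : Inv w) (i⁻ : Inv w⁻¹) (cut : Cut w p) (cut⁻ : Cut w⁻¹ p)
         (x⁻ : Cut.x cut⁻ ≡ w (Cut.y cut)) (y⁻ : Cut.y cut⁻ ≡ w (Cut.x cut)) where
  private
    open Cut cut
    module S = SplitFn i cut
    module S⁻ = SplitFn i⁻ cut⁻

  splitˡ-inverse : S⁻.splitˡ ∘ S.splitˡ ≗ id
  splitˡ-inverse q with <-cmp q p
  ... | tri> _ _ g = S⁻.splitˡ-above g
  ... | tri≈ _ refl _ = trans (cong S⁻.splitˡ (sym x⁻)) S⁻.splitˡ-x
  ... | tri< q<p _ _ with w q <? p
  ...   | yes wq = trans (S⁻.splitˡ-low wq (subst (_< p) (sym (left q)) q<p)) (left q)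
  ...   | no n with S.low-or-x q<p
  ...     | inj₁ wq   = contradiction wq n
  ...     | inj₂ refl = trans S⁻.splitˡ-p (trans (cong w⁻¹ y⁻) (left x))

  splitʳ-inverse : S⁻.splitʳ ∘ S.splitʳ ≗ id
  splitʳ-inverse zero with S.splitʳ 0 | S.splitʳ-0
  ... | zero  | e = contradiction (subst (p <_) (trans (sym e) (+-identityʳ p)) p<wx) (<-irrefl refl)
  ... | suc r | e = trans (cong (λ z → w⁻¹ z ∸ p) e) (trans (cong (_∸ p) (left x)) (m≤n⇒m∸n≡0 (<⇒≤ x<p)))
  splitʳ-inverse (suc r) with S.high-or-y (m<m+n p (z<s {r}))
  ... | inj₂ e = trans (cong S⁻.splitʳ (S.splitʳ-y e)) (trans (cong (λ z → w⁻¹ z ∸ p) x⁻)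
                   (trans (cong (_∸ p) (trans (left y) (sym e))) (m+n∸m≡n p (suc r))))
  ... | inj₁ g with S.splitʳ (suc r) | S.splitʳ-high g
  ...   | zero  | e = contradiction (subst (p <_) (trans (sym e) (+-identityʳ p)) g) (<-irrefl refl)
  ...   | suc t | e = trans (cong (λ z → w⁻¹ z ∸ p) e) (trans (cong (_∸ p) (left _)) (m+n∸m≡n p (suc r)))

split-perm : ∀ {p m} (w : Permutation′ (suc (p + m))) → Cut (ext w) p →
             ∃[ u ] ∃[ v ] Glue p (ext {suc p} u) (ext {suc m} v) (ext w) × ext u p ≢ p × ext v 0 ≢ 0
split-perm {p} {m} w cut = proj₁ U , proj₁ V , glue-resp (λ x → sym (proj₂ U x)) (λ x → sym (proj₂ V x)) (λ _ → refl) S.split-Glue ,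
  (λ e → <⇒≢ wy<p (trans (trans (sym S.splitˡ-p) (sym (proj₂ U p))) e)) ,
  (λ e → <⇒≢ p<wx (trans (sym (+-identityʳ p)) (trans (cong (p +_) (sym (trans (sym (proj₂ V 0)) e))) S.splitʳ-0)))
  where
  open Cut cut
  i  = ext-Inv w
  i⁻ = ext-Inv (flip w)
  cut⁻ = cut-inverse i cut
  module S = SplitFn i cut
  module S⁻ = SplitFn i⁻ cut⁻
  x⁻⁻ : Cut.x cut ≡ ext (flip w) (Cut.y cut⁻)
  x⁻⁻ = sym (ext-flipˡ w x)
  y⁻⁻ : Cut.y cut ≡ ext (flip w) (Cut.x cut⁻)
  y⁻⁻ = sym (ext-flipˡ w y)
  out : ∀ {r} → m < r → S.splitʳ r ≡ r
  out {suc r} m<r = trans (cong (_∸ p) (ext-outside w (+-monoʳ-< p m<r))) (m+n∸m≡n p (suc r))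
  U = mkPerm {p} (inverses S⁻.splitˡ (splitˡ-inverse (ext-flipˡ w) i i⁻ cut cut⁻ refl refl)
                              (splitˡ-inverse (ext-flipʳ w) i⁻ i cut⁻ cut x⁻⁻ y⁻⁻)) S.splitˡ-above
  V = mkPerm {m} (inverses S⁻.splitʳ (splitʳ-inverse (ext-flipˡ w) i i⁻ cut cut⁻ refl refl)
                              (splitʳ-inverse (ext-flipʳ w) i⁻ i cut⁻ cut x⁻⁻ y⁻⁻)) out

-- Cardinalities of finite setoids

Card : Setoid 0ℓ 0ℓ → ℕ → Set
Card S n = Inverse S (setoid (Fin n))

Card-unique : ∀ {S m n} → Card S m → Card S n → m ≡ n
Card-unique {S} i j = ↔⇒≡ (Composition.inverse (Symmetry.inverse i) j)

module _ (S T : Setoid 0ℓ 0ℓ) where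
  private
    module S = Setoid S
    module T = Setoid T

  mkIso : (to : S.Carrier → T.Carrier) (from : T.Carrier → S.Carrier) →
          (∀ {x y} → x S.≈ y → to x T.≈ to y) → (∀ {x y} → x T.≈ y → from x S.≈ from y) →
          (∀ y → to (from y) T.≈ y) → (∀ x → from (to x) S.≈ x) → Inverse S T
  mkIso to from to-cong from-cong to-from from-to = record
    { to = to ; from = from ; to-cong = to-cong ; from-cong = from-cong
    ; inverse = (λ {x} eq → T.trans (to-cong eq) (to-from x)) , (λ {x} eq → S.trans (from-cong eq) (from-to x)) }

Restrict : (S : Setoid 0ℓ 0ℓ) → (Setoid.Carrier S → Set) → Setoid 0ℓ 0ℓ
Restrict S P = record
  { Carrier = Σ (Setoid.Carrier S) P
  ; _≈_ = λ a b → Setoid._≈_ S (proj₁ a) (proj₁ b)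
  ; isEquivalence = record { refl = Setoid.refl S ; sym = Setoid.sym S ; trans = Setoid.trans S } }

Card-product : ∀ {S T m n} → Card S m → Card T n → Card (S ×ₛ T) (m * n)
Card-product {S} {T} {m} {n} i j = Composition.inverse (i ×-inverse j)
  (mkIso (setoid (Fin m) ×ₛ setoid (Fin n)) (setoid (Fin (m * n))) (λ (a , b) → Fin.combine a b) (Fin.remQuot {m} n)
    (λ { (refl , refl) → refl }) (λ { refl → refl , refl }) (Fin.combine-remQuot {m} n)
    (λ (a , b) → let eq = Fin.remQuot-combine {m} {n} a b in cong proj₁ eq , cong proj₂ eq))

Card-empty : ∀ {S} → (Setoid.Carrier S → ⊥) → Card S 0
Card-empty {S} ¬s = mkIso S (setoid (Fin 0)) (⊥-elim ∘ ¬s) (λ ()) (λ {x} → ⊥-elim (¬s x)) (λ { {()} }) (λ ()) (λ x → ⊥-elim (¬s x))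

record SplitCard (S : Setoid 0ℓ 0ℓ) (P : Setoid.Carrier S → Set) (n : ℕ) : Set where
  constructor splitCard
  field
    {yes# no#} : ℕ
    card-yes   : Card (Restrict S P) yes#
    card-no    : Card (Restrict S (¬_ ∘ P)) no#
    total      : n ≡ yes# + no#

private
  Fin-extend : ∀ {n a} {Q : Fin (suc n) → Set} → Q zero → Card (Restrict (setoid (Fin n)) (Q ∘ suc)) a → Card (Restrict (setoid (Fin (suc n))) Q) (suc a)
  Fin-extend {n} {a} {Q} q c = mkIso (Restrict (setoid (Fin (suc n))) Q) (setoid (Fin (suc a))) to from
      (λ {x} {y} → to-cong {x} {y}) (λ { refl → refl })
      (λ { zero → refl ; (suc i) → cong suc (Inverse.strictlyInverseˡ c i) })
      (λ { (zero , _) → refl ; (suc i , q′) → cong suc (Inverse.strictlyInverseʳ c (i , q′)) })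
    where
    to : Σ (Fin (suc n)) Q → Fin (suc a)
    to (zero , _)   = zero
    to (suc i , q′) = suc (Inverse.to c (i , q′))
    from : Fin (suc a) → Σ (Fin (suc n)) Q
    from zero    = zero , q
    from (suc j) = let (i , q′) = Inverse.from c j in suc i , q′
    to-cong : ∀ {x y} → proj₁ x ≡ proj₁ y → to x ≡ to y
    to-cong {zero , _}  {zero , _}  _    = refl
    to-cong {suc i , _} {suc j , _} eq = cong suc (Inverse.to-cong c (Fin.suc-injective eq))

  Fin-skip : ∀ {n a} {Q : Fin (suc n) → Set} → ¬ Q zero → Card (Restrict (setoid (Fin n)) (Q ∘ suc)) a → Card (Restrict (setoid (Fin (suc n))) Q) a
  Fin-skip {n} {a} {Q} ¬q c = Composition.inverse
      (mkIso (Restrict (setoid (Fin (suc n))) Q) (Restrict (setoid (Fin n)) (Q ∘ suc)) to (λ (i , q) → suc i , q)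
        (λ {x} {y} → to-cong {x} {y}) (cong suc) (λ _ → refl) λ { (zero , q) → contradiction q ¬q ; (suc i , q) → refl }) c
    where
    to : Σ (Fin (suc n)) Q → Σ (Fin n) (Q ∘ suc)
    to (zero , q)  = contradiction q ¬q
    to (suc i , q) = i , q
    to-cong : ∀ {x y} → proj₁ x ≡ proj₁ y → proj₁ (to x) ≡ proj₁ (to y)
    to-cong {zero , q}  {_}         _  = contradiction q ¬q
    to-cong {suc i , _} {zero , q}  _  = contradiction q ¬q
    to-cong {suc i , _} {suc j , _} eq = Fin.suc-injective eq

  Fin-split : ∀ n {Q : Fin n → Set} → (∀ i → Dec (Q i)) → SplitCard (setoid (Fin n)) Q n
  Fin-split zero    Q? = splitCard (Card-empty λ ()) (Card-empty λ ()) refl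
  Fin-split (suc n) Q? with Fin-split n (Q? ∘ suc) | Q? zero
  ... | splitCard y m t | yes q = splitCard (Fin-extend q y) (Fin-skip (λ ¬q → ¬q q) m) (cong suc t)
  ... | splitCard y m t | no ¬q = splitCard (Fin-skip ¬q y) (Fin-extend ¬q m) (trans (cong suc t) (sym (+-suc _ _)))

Card-split : ∀ {S n} → Card S n → {P : Setoid.Carrier S → Set} → (∀ {x y} → Setoid._≈_ S x y → P x → P y) → (∀ x → Dec (P x)) → SplitCard S P n
Card-split {S} {n} c {P} resp P? =
  splitCard (Composition.inverse (along P resp) card-yes) (Composition.inverse (along (¬_ ∘ P) (λ eq ¬p p → ¬p (resp (Setoid.sym S eq) p))) card-no) total
  where
  open SplitCard (Fin-split n (P? ∘ Inverse.from c))
  along : (P : Setoid.Carrier S → Set) → (∀ {x y} → Setoid._≈_ S x y → P x → P y) →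
          Inverse (Restrict S P) (Restrict (setoid (Fin n)) (P ∘ Inverse.from c))
  along P resp = mkIso _ _ (λ (x , p) → Inverse.to c x , resp (Setoid.sym S (Inverse.strictlyInverseʳ c x)) p) (λ (i , p) → Inverse.from c i , p)
    (Inverse.to-cong c) (Inverse.from-cong c) (λ (i , _) → Inverse.strictlyInverseˡ c i) (λ (x , _) → Inverse.strictlyInverseʳ c x)

-- Classes of permutations of ℕ

Class : Set₁
Class = (ℕ → ℕ) → Set

infixr 6 _∩_
_∩_ : Class → Class → Class
(P ∩ Q) g = P g × Q g

Perms : ℕ → Class → Setoid 0ℓ 0ℓ
Perms m P = record
  { Carrier = Σ[ w ∈ Permutation′ (suc m) ] P (ext w)
  ; _≈_ = λ a b → ext (proj₁ a) ≗ ext (proj₁ b)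
  ; isEquivalence = record { refl = λ _ → refl ; sym = λ e x → sym (e x) ; trans = λ e f x → trans (e x) (f x) } }

Perms-map : ∀ {m n} P Q → (∀ (w : Permutation′ (suc m)) → P (ext w) → Q (ext w)) → (∀ (w : Permutation′ (suc m)) → Q (ext w) → P (ext w)) →
            Card (Perms m Q) n → Card (Perms m P) n
Perms-map {m} P Q f g = Composition.inverse
  (mkIso (Perms m P) (Perms m Q) (λ (w , p) → w , f w p) (λ (w , q) → w , g w q) id id (λ _ _ → refl) (λ _ _ → refl))

Perms-unique : ∀ {m a b} P → Card (Perms m P) a → Card (Perms m P) b → a ≡ b
Perms-unique {m} P = Card-unique {Perms m P}

Respects : Class → Set
Respects P = ∀ {g g′} → g ≗ g′ → P g → P g′

DecidableOn : ℕ → Class → Set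
DecidableOn m P = ∀ (w : Permutation′ (suc m)) → Dec (P (ext w))

Perms-split : ∀ {m n} P Q → Card (Perms m P) n → Respects Q → DecidableOn m Q →
              ∃₂ λ a b → Card (Perms m (P ∩ Q)) a × Card (Perms m (P ∩ (¬_ ∘ Q))) b × n ≡ a + b
Perms-split {m} P Q c resp Q? = _ , _ , Composition.inverse (assoc Q) card-yes , Composition.inverse (assoc (¬_ ∘ Q)) card-no , total
  where
  open SplitCard (Card-split c {Q ∘ ext ∘ proj₁} resp (Q? ∘ proj₁))
  assoc : ∀ Q → Inverse (Perms m (P ∩ Q)) (Restrict (Perms m P) (Q ∘ ext ∘ proj₁))
  assoc Q = mkIso _ _ (λ (w , p , q) → (w , p) , q) (λ ((w , p) , q) → w , p , q) id id (λ _ _ → refl) (λ _ _ → refl)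

-- The search for `y` and for its rivals may stop at `m`, because an entry beyond `p` with a value
-- below `p` is moved and therefore lies within the range.
cut? : ∀ {m} p → DecidableOn m (λ g → Cut g p)
cut? {m} p w = map′ to from
  ((g p ≟ p) ×-dec
   anyUpTo? (λ x → (p <? g x) ×-dec allUpTo? (λ z → (p <? g z) →-dec (z ≟ x)) p) p ×-dec
   anyUpTo? (λ y → (p <? y) ×-dec (g y <? p) ×-dec allUpTo? (λ z → (p <? z) →-dec ((g z <? p) →-dec (z ≟ y))) (suc m)) (suc m))
  where
  g = ext w
  Data : Set
  Data = g p ≡ p × (∃ λ x → x < p × p < g x × (∀ {z} → z < p → p < g z → z ≡ x)) ×
         (∃ λ y → y < suc m × p < y × g y < p × (∀ {z} → z < suc m → p < z → g z < p → z ≡ y))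
  moved : ∀ {z} → p < z → g z < p → z < suc m
  moved p<z gz<p = ≰⇒> λ m<z → <-asym p<z (subst (_< p) (ext-outside w m<z) gz<p)
  to : Data → Cut g p
  to (fixed , (x , x<p , p<gx , ux) , (y , _ , p<y , gy<p , uy)) = record
    { fixed = fixed ; x = x ; y = y ; x<p = x<p ; p<wx = p<gx ; unique-x = ux ; p<y = p<y ; wy<p = gy<p
    ; unique-y = λ p<z gz<p → uy (moved p<z gz<p) p<z gz<p }
  from : Cut g p → Data
  from c = fixed , (x , x<p , p<wx , unique-x) , (y , moved p<y wy<p , p<y , wy<p , λ _ → unique-y)
    where open Cut c

cut-bound : ∀ {m p} {w : Permutation′ (suc m)} → Cut (ext w) p → p < m
cut-bound {m} {p} {w} c = ≰⇒> λ m≤p → <-asym p<y (subst (_< p) (ext-outside w (≤-<-trans m≤p p<y)) wy<p)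
  where open Cut c

lift-Inv : ∀ {g} → Inv g → Inv (lift g)
lift-Inv (inverses g⁻¹ left right) = inverses (lift g⁻¹) (λ { zero → refl ; (suc x) → cong suc (left x) })
                                                 (λ { zero → refl ; (suc x) → cong suc (right x) })

unlift : ∀ {g} → Inv g → g 0 ≡ 0 → ∃[ h ] Inv h × lift h ≗ g
unlift {g} i@(inverses g⁻¹ left right) g0 = (λ x → g (suc x) ∸ 1) , inverses (λ x → g⁻¹ (suc x) ∸ 1)
    (λ x → trans (cong (λ z → g⁻¹ z ∸ 1) (pos x)) (cong (_∸ 1) (left (suc x))))
    (λ x → trans (cong (λ z → g z ∸ 1) (pos⁻ x)) (cong (_∸ 1) (right (suc x)))) ,
    λ { zero → sym g0 ; (suc x) → pos x }
  where
  inj = Bij.injective (Inv.bijective i)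
  pos : ∀ x → suc (g (suc x) ∸ 1) ≡ g (suc x)
  pos x = m+[n∸m]≡n (n≢0⇒n>0 λ e → 1+n≢0 (inj (trans e (sym g0))))
  pos⁻ : ∀ x → suc (g⁻¹ (suc x) ∸ 1) ≡ g⁻¹ (suc x)
  pos⁻ x = m+[n∸m]≡n (n≢0⇒n>0 λ e → 1+n≢0 (trans (sym (right (suc x))) (trans (cong g e) g0)))

lift-injective : ∀ {g h : ℕ → ℕ} → lift g ≗ lift h → g ≗ h
lift-injective eq x = suc-injective (eq (suc x))

lift-cong : ∀ {g h : ℕ → ℕ} → g ≗ h → lift g ≗ lift h
lift-cong eq zero    = refl
lift-cong eq (suc x) = cong suc (eq x)

Perms-fix-first : ∀ {m P} → Respects P → (∀ (w : Permutation′ (suc m)) → P (ext w) ⇔ P (lift (ext w))) →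
                  Inverse (Perms (suc m) (P ∩ (λ g → g 0 ≡ 0))) (Perms m P)
Perms-fix-first {m} {P} resp P⇔ = mkIso _ _ to from
    (λ {a} {b} eq → lift-injective λ x → trans (lower-eq a x) (trans (eq x) (sym (lower-eq b x))))
    (λ {a} {b} eq x → trans (raise-eq a x) (trans (lift-cong eq x) (sym (raise-eq b x))))
    (λ b → lift-injective λ x → trans (lower-eq (from b) x) (raise-eq b x))
    (λ a x → trans (raise-eq (to a) x) (lower-eq a x))
  where
  Big = Σ[ w ∈ Permutation′ (suc (suc m)) ] P (ext w) × ext w 0 ≡ 0
  Small = Σ[ w ∈ Permutation′ (suc m) ] P (ext w)
  module Lower (a : Big) where
    w = proj₁ a
    h = unlift (ext-Inv w) (proj₂ (proj₂ a))
    out : ∀ {x} → m < x → proj₁ h x ≡ x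
    out {x} m<x = suc-injective (trans (proj₂ (proj₂ h) (suc x)) (ext-outside w (s≤s m<x)))
    W = mkPerm {m} (proj₁ (proj₂ h)) out
    eq : lift (ext (proj₁ W)) ≗ ext w
    eq x = trans (lift-cong (proj₂ W) x) (proj₂ (proj₂ h) x)
  to : Big → Small
  to a = proj₁ (Lower.W a) , Equivalence.from (P⇔ (proj₁ (Lower.W a))) (resp (λ x → sym (Lower.eq a x)) (proj₁ (proj₂ a)))
  lower-eq : ∀ a → lift (ext (proj₁ (to a))) ≗ ext (proj₁ a)
  lower-eq a = Lower.eq a
  module Raise (b : Small) where
    w = proj₁ b
    W = mkPerm {suc m} (lift-Inv (ext-Inv w)) λ { {suc x} (s≤s m<x) → cong suc (ext-outside w m<x) }
  from : Small → Big
  from b = proj₁ (Raise.W b) , resp (λ x → sym (proj₂ (Raise.W b) x)) (Equivalence.to (P⇔ (proj₁ b)) (proj₂ b)) , proj₂ (Raise.W b) 0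
  raise-eq : ∀ b → ext (proj₁ (from b)) ≗ lift (ext (proj₁ b))
  raise-eq b = proj₂ (Raise.W b)

-- Removing a fixed last point leaves `ext` unchanged. Removing a fixed first point shifts
-- everything, which is why `Perms-fix-first` asks that `P` be compatible with `lift`.
Perms-fix-last : ∀ {m P} → Respects P → Inverse (Perms (suc m) (P ∩ (λ g → g (suc m) ≡ suc m))) (Perms m P)
Perms-fix-last {m} {P} resp = mkIso _ _ to from
    (λ {a} {b} eq x → trans (to-eq a x) (trans (eq x) (sym (to-eq b x))))
    (λ {a} {b} eq x → trans (from-eq a x) (trans (eq x) (sym (from-eq b x))))
    (λ b x → trans (to-eq (from b) x) (from-eq b x)) (λ a x → trans (from-eq (to a) x) (to-eq a x))
  where
  Big = Σ[ w ∈ Permutation′ (suc (suc m)) ] P (ext w) × ext w (suc m) ≡ suc m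
  Small = Σ[ w ∈ Permutation′ (suc m) ] P (ext w)
  down-perm : (a : Big) → ∃[ w ] ext {suc m} w ≗ ext (proj₁ a)
  down-perm (w , _ , fix) = mkPerm {m} (ext-Inv w) λ {x} m<x → case m≤n⇒m<n∨m≡n m<x of λ
    { (inj₁ l) → ext-outside w l ; (inj₂ refl) → fix }
  up-perm : (b : Small) → ∃[ w ] ext {suc (suc m)} w ≗ ext (proj₁ b)
  up-perm (w , _) = mkPerm {suc m} (ext-Inv w) λ m<x → ext-outside w (<⇒≤ m<x)
  to : Big → Small
  to a = proj₁ (down-perm a) , resp (λ x → sym (proj₂ (down-perm a) x)) (proj₁ (proj₂ a))
  to-eq : ∀ a → ext (proj₁ (to a)) ≗ ext (proj₁ a)
  to-eq a = proj₂ (down-perm a)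
  from : Small → Big
  from b = proj₁ (up-perm b) , resp (λ x → sym (proj₂ (up-perm b) x)) (proj₂ b) ,
           trans (proj₂ (up-perm b) (suc m)) (ext-outside (proj₁ b) ≤-refl)
  from-eq : ∀ b → ext (proj₁ (from b)) ≗ ext (proj₁ b)
  from-eq b = proj₂ (up-perm b)

one-perm : (w : Permutation′ 1) → ext w ≗ id
one-perm w zero    = n≤0⇒n≡0 (Bounded.inside (ext-Bounded w) z≤n)
one-perm w (suc x) = ext-outside w (s≤s z≤n)

Perms-one : ∀ {P} → Respects P → P id → Card (Perms 0 P) 1
Perms-one {P} resp pid = mkIso (Perms 0 P) (setoid (Fin 1)) (λ _ → zero) (λ _ → W , resp (λ x → sym (one-perm W x)) pid)
    (λ _ → refl) (λ _ _ → refl) (λ { zero → refl }) (λ (w , _) x → trans (one-perm W x) (sym (one-perm w x)))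
  where
  W : Permutation′ 1
  W = Data.Fin.Permutation.id

-- Counting by the first cut

module Fibre {F N T : Class}
  (⇒ : ∀ {p m} {u : Permutation′ (suc p)} {v : Permutation′ (suc m)} {w : Permutation′ (suc (p + m))} → Glue p (ext u) (ext v) (ext w) →
       ext u p ≢ p → ext v 0 ≢ 0 → T (ext w) → FirstCut p (ext w) → F (ext u) × N (ext v))
  (⇐ : ∀ {p m} {u : Permutation′ (suc p)} {v : Permutation′ (suc m)} {w : Permutation′ (suc (p + m))} → Glue p (ext u) (ext v) (ext w) →
       ext u p ≢ p → F (ext u) → N (ext v) → T (ext w) × FirstCut p (ext w))
  (N-moves : ∀ {g} → N g → g 0 ≢ 0)
  where

  fibre : ∀ p m → Inverse (Perms (p + m) (T ∩ FirstCut p)) (Perms p (F ∩ (λ g → g p ≢ p)) ×ₛ Perms m N)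
  fibre p m = mkIso _ _ to from
      (λ {a} {b} → to-cong {a} {b}) (λ {a} {b} → from-cong {a} {b}) to-from
      (λ a → glue-functional (from-glue (to a)) (to-glue a) (bu a))
    where
    Whole = Setoid.Carrier (Perms (p + m) (T ∩ FirstCut p))
    Parts = Setoid.Carrier (Perms p (F ∩ (λ g → g p ≢ p)) ×ₛ Perms m N)
    sp : (a : Whole) → ∃[ u ] ∃[ v ] Glue p (ext {suc p} u) (ext {suc m} v) (ext (proj₁ a)) × ext u p ≢ p × ext v 0 ≢ 0
    sp (w , _ , cut , _) = split-perm w cut
    to : Whole → Parts
    to a@(w , t , fc) = let (u , v , G , up≢ , v0≢) = sp a
                            (f , n) = ⇒ {u = u} {v} {w} G up≢ v0≢ t fc
                        in (u , f , up≢) , (v , n)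
    to-glue : ∀ a → Glue p (ext (proj₁ (proj₁ (to a)))) (ext (proj₁ (proj₂ (to a)))) (ext (proj₁ a))
    to-glue a = proj₁ (proj₂ (proj₂ (sp a)))
    gp : (b : Parts) → ∃[ w ] Glue p (ext (proj₁ (proj₁ b))) (ext (proj₁ (proj₂ b))) (ext {suc (p + m)} w)
    gp ((u , _ , up≢) , (v , n)) = glue-perm u v up≢ (N-moves n)
    from : Parts → Whole
    from b@((u , f , up≢) , (v , n)) = proj₁ (gp b) , ⇐ {u = u} {v} {proj₁ (gp b)} (proj₂ (gp b)) up≢ f n
    from-glue : ∀ b → Glue p (ext (proj₁ (proj₁ b))) (ext (proj₁ (proj₂ b))) (ext (proj₁ (from b)))
    from-glue b = proj₂ (gp b)
    bu : ∀ a → Bounded p (ext (proj₁ (proj₁ (to a))))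
    bu a = ext-Bounded (proj₁ (proj₁ (to a)))
    ju : ∀ a → Bij (ext (proj₁ (proj₁ (to a))))
    ju a = ext-Bij (proj₁ (proj₁ (to a)))
    jv : ∀ a → Bij (ext (proj₁ (proj₂ (to a))))
    jv a = ext-Bij (proj₁ (proj₂ (to a)))
    to-cong : ∀ {a b} → ext (proj₁ a) ≗ ext (proj₁ b) →
              ext (proj₁ (proj₁ (to a))) ≗ ext (proj₁ (proj₁ (to b))) × ext (proj₁ (proj₂ (to a))) ≗ ext (proj₁ (proj₂ (to b)))
    to-cong {a} {b} eq = glue-injectiveˡ (to-glue a) (to-glue b) (bu a) (bu b) (ju a) (ju b) (jv a) (jv b) eq ,
                         glue-injectiveʳ (to-glue a) (to-glue b) (bu a) (bu b) (ju a) (ju b) (jv a) (jv b) eq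
    from-cong : ∀ {a b} → ext (proj₁ (proj₁ a)) ≗ ext (proj₁ (proj₁ b)) × ext (proj₁ (proj₂ a)) ≗ ext (proj₁ (proj₂ b)) →
                ext (proj₁ (from a)) ≗ ext (proj₁ (from b))
    from-cong {a} {b} (eu , ev) = glue-functional (from-glue a)
      (glue-resp (λ x → sym (eu x)) (λ x → sym (ev x)) (λ _ → refl) (from-glue b)) (ext-Bounded (proj₁ (proj₁ a)))
    to-from : ∀ b → ext (proj₁ (proj₁ (to (from b)))) ≗ ext (proj₁ (proj₁ b)) × ext (proj₁ (proj₂ (to (from b)))) ≗ ext (proj₁ (proj₂ b))
    to-from b@((u , _) , (v , _)) =
      glue-injectiveˡ (to-glue (from b)) (from-glue b) (bu (from b)) (ext-Bounded u) (ju (from b)) (ext-Bij u) (jv (from b)) (ext-Bij v) (λ _ → refl) ,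
      glue-injectiveʳ (to-glue (from b)) (from-glue b) (bu (from b)) (ext-Bounded u) (ju (from b)) (ext-Bij u) (jv (from b)) (ext-Bij v) (λ _ → refl)

-- Counting avoiders

lift-maxClustered : ∀ {g} → MaxClustered g ⇔ MaxClustered (lift g)
lift-maxClustered {g} = mk⇔ to from
  where
  to : MaxClustered g → MaxClustered (lift g)
  to mc {zero}  {suc y} {suc z} _         _         ()
  to mc {suc x} {suc y} {suc z} (s≤s x<y) (s≤s y<z) (s≤s yx) (s≤s zy) = l , r
    where
    l : ∀ {t} → t < suc y → suc (g y) < lift g t → t ≡ suc x
    l {suc t} (s≤s t<y) (s≤s yt) = cong suc (proj₁ (mc x<y y<z yx zy) t<y yt)
    r : ∀ {t} → suc y < t → lift g t < suc (g y) → t ≡ suc z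
    r {suc t} (s≤s y<t) (s≤s ty) = cong suc (proj₂ (mc x<y y<z yx zy) y<t ty)
  from : MaxClustered (lift g) → MaxClustered g
  from mc x<y y<z yx zy = let (l , r) = mc (s≤s x<y) (s≤s y<z) (s≤s yx) (s≤s zy)
    in (λ t<y yt → suc-injective (l (s≤s t<y) (s≤s yt))) , (λ y<t ty → suc-injective (r (s≤s y<t) (s≤s ty)))

lift-av4231 : ∀ {g} → Av4231 g ⇔ Av4231 (lift g)
lift-av4231 {g} = mk⇔ to from
  where
  to : Av4231 g → Av4231 (lift g)
  to av {zero}  {suc b} {suc c} {suc d} _         _         _         _        _        ()
  to av {suc a} {suc b} {suc c} {suc d} (s≤s a<b) (s≤s b<c) (s≤s c<d) (s≤s db) (s≤s bc) (s≤s ca) = av a<b b<c c<d db bc ca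
  from : Av4231 (lift g) → Av4231 g
  from av a<b b<c c<d db bc ca = av (s≤s a<b) (s≤s b<c) (s≤s c<d) (s≤s db) (s≤s bc) (s≤s ca)

module Recurrence {F N T : Class}
  (⇒ : ∀ {p m} {u : Permutation′ (suc p)} {v : Permutation′ (suc m)} {w : Permutation′ (suc (p + m))} → Glue p (ext u) (ext v) (ext w) →
       ext u p ≢ p → ext v 0 ≢ 0 → T (ext w) → FirstCut p (ext w) → F (ext u) × N (ext v))
  (⇐ : ∀ {p m} {u : Permutation′ (suc p)} {v : Permutation′ (suc m)} {w : Permutation′ (suc (p + m))} → Glue p (ext u) (ext v) (ext w) →
       ext u p ≢ p → F (ext u) → N (ext v) → T (ext w) × FirstCut p (ext w))
  (N-moves : ∀ {g} → N g → g 0 ≢ 0)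
  (no-cut : ∀ {m} {w : Permutation′ (suc m)} → T (ext w) → (∀ {p} → ¬ Cut (ext w) p) → F (ext w))
  (is-T : ∀ {m} {w : Permutation′ (suc m)} → F (ext w) → T (ext w) × (∀ {p} → ¬ Cut (ext w) p))
  (t f l n : ℕ → ℕ)
  (card-T : ∀ m → Card (Perms m T) (t m)) (card-F : ∀ m → Card (Perms m F) (f m))
  (card-L : ∀ m → Card (Perms m (F ∩ (λ g → g m ≢ m))) (l m)) (card-N : ∀ m → Card (Perms m N) (n m)) where

  open Fibre {F} {N} {T} (λ {p} {m} {u} {v} {w} → ⇒ {p} {m} {u} {v} {w}) (λ {p} {m} {u} {v} {w} → ⇐ {p} {m} {u} {v} {w}) N-moves

  card-firstCut : ∀ {m} p → p ≤ m → Card (Perms m (T ∩ FirstCut p)) (l p * n (m ∸ p))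
  card-firstCut {m} p p≤m = subst (λ m′ → Card (Perms m′ (T ∩ FirstCut p)) (l p * n (m ∸ p))) (m+[n∸m]≡n p≤m)
    (Composition.inverse (fibre p (m ∸ p)) (Card-product (card-L p) (card-N (m ∸ p))))

  private
    term : ℕ → ℕ → ℤ.ℤ
    term m p = ℤ.+ l p ℤ.* ℤ.+ n (m ∸ p)

    -- Each round splits off the elements whose first cut is at `k`. After `k = m` no place for a
    -- cut remains, and what is left is counted by `f`.
    loop : ∀ m j k → k + j ≡ suc m → ∀ {c} → Card (Perms m (T ∩ NoCutBelow k)) c →
           ℤ.+ c ≡ sum {j} (λ i → term m (k + toℕ i)) ℤ.+ ℤ.+ f m
    loop m zero k eq {c} card = trans (cong ℤ.+_ (Perms-unique (T ∩ NoCutBelow k) card (Perms-map (T ∩ NoCutBelow k) F to from (card-F m)))) (sym (ℤ.+-identityˡ _))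
      where
      k≡ : k ≡ suc m
      k≡ = trans (sym (+-identityʳ k)) eq
      to : ∀ w → (T ∩ NoCutBelow k) (ext w) → F (ext w)
      to w (tw , nc) = no-cut {w = w} tw λ c → nc (subst (_ <_) (sym k≡) (m<n⇒m<1+n (cut-bound {w = w} c))) c
      from : ∀ w → F (ext w) → (T ∩ NoCutBelow k) (ext w)
      from w fw = let (tw , nc) = is-T {w = w} fw in tw , λ _ → nc
    loop m (suc j) k eq {c} card with Perms-split (T ∩ NoCutBelow k) (λ g → Cut g k) card Cut-resp (cut? k)
    ... | a , b , card-a , card-b , c≡ = begin
      ℤ.+ c                                          ≡⟨ cong ℤ.+_ c≡ ⟩
      ℤ.+ (a + b)                                    ≡⟨ cong (λ z → ℤ.+ (z + b)) a≡ ⟩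
      ℤ.+ (l k * n (m ∸ k) + b)                      ≡⟨ ℤ.pos-+ (l k * n (m ∸ k)) b ⟩
      ℤ.+ (l k * n (m ∸ k)) ℤ.+ ℤ.+ b                ≡⟨ cong₂ ℤ._+_ (ℤ.pos-* (l k) (n (m ∸ k))) (loop m j (suc k) (trans (sym (+-suc k j)) eq) card-b′) ⟩
      term m k ℤ.+ (sum {j} (λ i → term m (suc k + toℕ i)) ℤ.+ ℤ.+ f m) ≡⟨ ℤ.+-assoc (term m k) _ _ ⟨
      term m k ℤ.+ sum {j} (λ i → term m (suc k + toℕ i)) ℤ.+ ℤ.+ f m   ≡⟨ cong₂ (λ x y → x ℤ.+ y ℤ.+ ℤ.+ f m) (cong (term m) (sym (+-identityʳ k)))
                                                                            (sum-cong-≗ {j} (λ i → cong (term m) (sym (+-suc k (toℕ i))))) ⟩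
      sum {suc j} (λ i → term m (k + toℕ i)) ℤ.+ ℤ.+ f m ∎
      where
      open ≡-Reasoning
      k≤m : k ≤ m
      k≤m = s≤s⁻¹ (subst (suc k ≤_) eq (subst (suc k ≤_) (sym (+-suc k j)) (s≤s (m≤m+n k j))))
      a≡ : a ≡ l k * n (m ∸ k)
      a≡ = Perms-unique ((T ∩ NoCutBelow k) ∩ (λ g → Cut g k)) card-a
        (Perms-map ((T ∩ NoCutBelow k) ∩ (λ g → Cut g k)) (T ∩ FirstCut k) (λ _ ((tw , nc) , c) → tw , c , nc) (λ _ (tw , c , nc) → (tw , nc) , c) (card-firstCut k k≤m))
      below : ∀ {g} → NoCutBelow k g → ¬ Cut g k → NoCutBelow (suc k) g
      below nc ¬c {q} q<1+k c with m≤n⇒m<n∨m≡n (s≤s⁻¹ q<1+k)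
      ... | inj₁ q<k  = nc q<k c
      ... | inj₂ refl = ¬c c
      card-b′ : Card (Perms m (T ∩ NoCutBelow (suc k))) b
      card-b′ = Perms-map (T ∩ NoCutBelow (suc k)) ((T ∩ NoCutBelow k) ∩ (λ g → ¬ Cut g k))
        (λ _ (tw , nc) → (tw , λ q<k → nc (m<n⇒m<1+n q<k)) , nc (n<1+n k))
        (λ w ((tw , nc) , ¬c) → tw , λ {q} → below {ext w} nc ¬c {q}) card-b

  recurrence : ∀ m → ℤ.+ t m ≡ ℤ.+ f m ℤ.+ sum {suc m} (λ i → ℤ.+ l (toℕ i) ℤ.* ℤ.+ n (m ∸ toℕ i))
  recurrence m = trans (loop m (suc m) 0 refl (Perms-map (T ∩ NoCutBelow 0) T (λ _ → proj₁) (λ _ tw → tw , λ ()) (card-T m))) (ℤ.+-comm (sum {suc m} (λ i → term m (toℕ i))) (ℤ.+ f m))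

module Counting (H : HeapPatterns) (adm : All Admissible H) where

  HAv : Class
  HAv g = All (λ (k , h) → ¬ Contains (RedWord h) g) H

  HAv-resp : Respects HAv
  HAv-resp eq = All.map λ ¬c → ¬c ∘ Contains-resp (λ x → sym (eq x))

  private
    with-adm : ∀ {P Q : ∃[ k ] Permutation′ (suc k) → Set} → (∀ {kh} → Admissible kh → P kh → Q kh) → All P H → All Q H
    with-adm f ps = All.map (λ { {kh} (a , p) → f {kh} a p }) (All.zip (adm , ps))

  HAv-avoids : ∀ {m} {w : Permutation′ (suc m)} → All (λ (_ , h) → ¬ HeapContains w h) H ⇔ HAv (ext w)
  HAv-avoids {w = w} = mk⇔ (with-adm λ {(_ , h)} a ¬c → ¬c ∘ contains⇐ a {w = w})
                          (with-adm λ {(_ , h)} a ¬c → ¬c ∘ contains⇒ a {w = w})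

  HAv-id : HAv id
  HAv-id = All.map (λ {(_ , h)} a → ¬contains-id (zero-letter {h = h} a)) adm

  HAv-lift : ∀ {g} → HAv g ⇔ HAv (lift g)
  HAv-lift {g} = mk⇔ (with-adm λ {(_ , h)} a ¬c → ¬c ∘ contains-lift⇒ (zero-letter {h = h} a))
                    (All.map λ ¬c → ¬c ∘ contains-lift⇐)

  module HeapGlue {p m} {u : Permutation′ (suc (suc p))} {v : Permutation′ (suc m)} {w : Permutation′ (suc (suc p + m))}
                  (G : Glue (suc p) (ext u) (ext v) (ext w)) (up≢ : ext u (suc p) ≢ suc p) (v0≢ : ext v 0 ≢ 0) where
    private
      U = redWord-exists u
      V = redWord-exists v
      u≗ = proj₂ (proj₂ U)
      v≗ = proj₂ (proj₂ V)
      open GlueContains {p} {proj₁ U} {proj₁ V} {ext w} (proj₁ (proj₂ U)) (redWord-letters {w = u} (proj₂ U)) (up≢ ∘ trans (sym (u≗ (suc p))))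
             (proj₁ (proj₂ V)) (v0≢ ∘ trans (sym (v≗ 0))) (glue-resp (λ x → sym (u≗ x)) (λ x → sym (v≗ x)) (λ _ → refl) G)

    HAv-parts : HAv (ext w) → HAv (ext u) × HAv (ext v)
    HAv-parts av = All.map (λ ¬c → ¬c ∘ contains-glue⇐ˡ ∘ Contains-resp (λ x → sym (u≗ x))) av ,
                   All.map (λ ¬c → ¬c ∘ contains-glue⇐ʳ ∘ Contains-resp (λ x → sym (v≗ x))) av

    HAv-whole : HAv (ext u) → HAv (ext v) → HAv (ext w)
    HAv-whole avu avv = with-adm (λ {(_ , h)} a (¬u , ¬v) c → [ ¬u ∘ Contains-resp u≗ , ¬v ∘ Contains-resp v≗ ]′
      (contains-glue⇒ (heapShape {h = h} a) c)) (All.zip (avu , avv))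

  HAv-parts : ∀ {p m} {u : Permutation′ (suc p)} {v : Permutation′ (suc m)} {w : Permutation′ (suc (p + m))} →
              Glue p (ext u) (ext v) (ext w) → ext u p ≢ p → ext v 0 ≢ 0 → HAv (ext w) → HAv (ext u) × HAv (ext v)
  -- For `p = 0` the letter below the gluing point would not exist, but a permutation of a single
  -- point cannot move it.
  HAv-parts {zero}  {u = u} G up≢ = contradiction (one-perm u 0) up≢
  HAv-parts {suc p} {u = u} {v} {w} G up≢ v0≢ = HeapGlue.HAv-parts {u = u} {v} {w} G up≢ v0≢

  HAv-whole : ∀ {p m} {u : Permutation′ (suc p)} {v : Permutation′ (suc m)} {w : Permutation′ (suc (p + m))} →
              Glue p (ext u) (ext v) (ext w) → ext u p ≢ p → ext v 0 ≢ 0 → HAv (ext u) → HAv (ext v) → HAv (ext w)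
  HAv-whole {zero}  {u = u} G up≢ = contradiction (one-perm u 0) up≢
  HAv-whole {suc p} {u = u} {v} {w} G up≢ v0≢ = HeapGlue.HAv-whole {u = u} {v} {w} G up≢ v0≢

  FC MC FB N-MC N-FB Moves : Class
  FC    = Av321 ∩ HAv
  MC    = MaxClustered ∩ HAv
  FB    = MaxClustered ∩ Av4231 ∩ HAv
  Moves = λ g → g 0 ≢ 0
  N-MC  = MC ∩ Moves
  N-FB  = (FB ∩ Moves) ∩ (λ g → ¬ Cut g 1)

  FC-resp : Respects FC
  FC-resp eq (a , b) = Av321-resp eq a , HAv-resp eq b

  MC-resp : Respects MC
  MC-resp eq (a , b) = MaxClustered-resp eq a , HAv-resp eq b

  FB-resp : Respects FB
  FB-resp eq (a , b , c) = MaxClustered-resp eq a , Av4231-resp eq b , HAv-resp eq c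

  private
    no-321 : ∀ {g} → Av321 g → ∀ {p} → ¬ Cut g p
    no-321 av c = let (a , b , d , e) = cut⇒321 c in av a b d e

    av321 : ∀ {m} {w : Permutation′ (suc m)} → MaxClustered (ext w) → (∀ {p} → ¬ Cut (ext w) p) → Av321 (ext w)
    av321 {w = w} mc nc x<y y<z yx zy = nc (maxClustered⇒cut {ext w} {ext (flip w)} (ext-flipˡ w) (ext-flipʳ w) mc x<y y<z yx zy)

    module GP {p m} {u : Permutation′ (suc p)} {v : Permutation′ (suc m)} {w : Permutation′ (suc (p + m))}
              (G : Glue p (ext u) (ext v) (ext w)) = GluePatterns G (ext-Bounded u) (ext-Inv u) (ext-Inv v)

  [FC] [MC] [FB] : Patterns
  [FC] = (3 , [321]) ∷ []
  [MC] = (4 , [3421]) ∷ (4 , [4312]) ∷ (4 , [4321]) ∷ []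
  [FB] = (4 , [3421]) ∷ (4 , [4231]) ∷ (4 , [4312]) ∷ (4 , [4321]) ∷ []

  f mc fb : ℕ → ℕ
  f  = avoiderCount [FC] H
  mc = avoiderCount [MC] H
  fb = avoiderCount [FB] H

  private
    card-avoiders : ∀ {P T} → (∀ {m} (w : Permutation′ (suc m)) → Avoids P H w → T (ext w)) → (∀ {m} (w : Permutation′ (suc m)) → T (ext w) → Avoids P H w) →
                    ∀ m → Card (Perms m T) (avoiderCount P H m)
    card-avoiders {P} {T} to from m = Composition.inverse (mkIso (Perms m T) (DecSetoid.setoid (AvoiderSetoid P H m))
      (λ (w , t) → w , from w t) (λ (w , a) → w , to w a)
      (λ {(w , _)} {(w′ , _)} → ext-reflects {w = w} {w′}) (λ {(w , _)} {(w′ , _)} → ext-cong {w = w} {w′}) (λ _ _ → refl) (λ _ _ → refl))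
      (proj₂ (avoiders-finite P H m))

  card-FC : ∀ m → Card (Perms m FC) (f m)
  card-FC = card-avoiders {[FC]} {FC}
    (λ { w ((a ∷ []) , h) → Equivalence.to (av321⇔ w) a , Equivalence.to (HAv-avoids {w = w}) h })
    (λ w (a , h) → (Equivalence.from (av321⇔ w) a ∷ []) , Equivalence.from (HAv-avoids {w = w}) h)

  card-MC : ∀ m → Card (Perms m MC) (mc m)
  card-MC = card-avoiders {[MC]} {MC}
    (λ { w ((a ∷ b ∷ c ∷ []) , h) → Equivalence.to (maxClustered⇔ w) (a , b , c) , Equivalence.to (HAv-avoids {w = w}) h })
    (λ w (mc , h) → let (a , b , c) = Equivalence.from (maxClustered⇔ w) mc in (a ∷ b ∷ c ∷ []) , Equivalence.from (HAv-avoids {w = w}) h)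

  card-FB : ∀ m → Card (Perms m FB) (fb m)
  card-FB = card-avoiders {[FB]} {FB}
    (λ { w ((a ∷ d ∷ b ∷ c ∷ []) , h) → Equivalence.to (maxClustered⇔ w) (a , b , c) , Equivalence.to (av4231⇔ w) d , Equivalence.to (HAv-avoids {w = w}) h })
    (λ w (mc , d , h) → let (a , b , c) = Equivalence.from (maxClustered⇔ w) mc
                        in (a ∷ Equivalence.from (av4231⇔ w) d ∷ b ∷ c ∷ []) , Equivalence.from (HAv-avoids {w = w}) h)

  av321-id : Av321 id
  av321-id x<y _ yx _ = <-asym x<y yx

  id-FC : FC id
  id-FC = av321-id , HAv-id

  id-MC : MC id
  id-MC = av321⇒maxClustered av321-id , HAv-id

  id-FB : FB id
  id-FB = av321⇒maxClustered av321-id , av321⇒av4231 av321-id , HAv-id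

  private
    fixes-last-resp : ∀ {m} → Respects (λ g → g m ≡ m)
    fixes-last-resp {m} eq e = trans (sym (eq m)) e

    abstract
     last-split : ∀ m → ∃₂ λ a b → Card (Perms m (FC ∩ (λ g → g m ≡ m))) a × Card (Perms m (FC ∩ (λ g → g m ≢ m))) b × f m ≡ a + b
     last-split m = Perms-split FC (λ g → g m ≡ m) (card-FC m) fixes-last-resp (λ w → ext w m ≟ m)

  l : ℕ → ℕ
  l m = proj₁ (proj₂ (last-split m))

  card-L : ∀ m → Card (Perms m (FC ∩ (λ g → g m ≢ m))) (l m)
  card-L m = proj₁ (proj₂ (proj₂ (proj₂ (last-split m))))

  f-zero : f 0 ≡ 1
  f-zero = Perms-unique FC (card-FC 0) (Perms-one FC-resp id-FC)

  l-zero : l 0 ≡ 0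
  l-zero = Perms-unique (FC ∩ (λ g → g 0 ≢ 0)) (card-L 0) (Card-empty λ (w , _ , moves) → moves (one-perm w 0))

  -- Avoiders fixing their last point are the avoiders of the preceding size. Hence the coefficients
  -- of L count those that move it.
  f-suc : ∀ m → f (suc m) ≡ f m + l (suc m)
  f-suc m = let (a , b , card-a , _ , eq) = last-split (suc m)
            in trans eq (cong (_+ b) (Perms-unique (FC ∩ (λ g → g (suc m) ≡ suc m)) card-a (Composition.inverse (Perms-fix-last FC-resp) (card-FC m))))

  module FirstPoint {T : Class} (T-resp : Respects T) (T-id : T id) (T-lift : ∀ {g} → T g ⇔ T (lift g))
                    (t : ℕ → ℕ) (card-T : ∀ m → Card (Perms m T) (t m)) where
    private
      abstract
       first-split : ∀ m → ∃₂ λ a b → Card (Perms m (T ∩ (λ g → g 0 ≡ 0))) a × Card (Perms m (T ∩ Moves)) b × t m ≡ a + b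
       first-split m = Perms-split T (λ g → g 0 ≡ 0) (card-T m) (λ eq e → trans (sym (eq 0)) e) (λ w → ext w 0 ≟ 0)

    n : ℕ → ℕ
    n m = proj₁ (proj₂ (first-split m))

    card-n : ∀ m → Card (Perms m (T ∩ Moves)) (n m)
    card-n m = proj₁ (proj₂ (proj₂ (proj₂ (first-split m))))

    t-zero : t 0 ≡ 1
    t-zero = Perms-unique T (card-T 0) (Perms-one T-resp T-id)

    n-zero : n 0 ≡ 0
    n-zero = Perms-unique (T ∩ Moves) (card-n 0) (Card-empty λ (w , _ , moves) → moves (one-perm w 0))

    t-suc : ∀ m → t (suc m) ≡ t m + n (suc m)
    t-suc m = let (a , b , card-a , _ , eq) = first-split (suc m)
              in trans eq (cong (_+ b) (Perms-unique (T ∩ (λ g → g 0 ≡ 0)) card-a (Composition.inverse (Perms-fix-first T-resp (λ _ → T-lift)) (card-T m))))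

  private
    MC-lift : ∀ {g} → MC g ⇔ MC (lift g)
    MC-lift = mk⇔ (λ (a , h) → Equivalence.to lift-maxClustered a , Equivalence.to HAv-lift h)
                  (λ (a , h) → Equivalence.from lift-maxClustered a , Equivalence.from HAv-lift h)

    FB-lift : ∀ {g} → FB g ⇔ FB (lift g)
    FB-lift = mk⇔ (λ (a , b , h) → Equivalence.to lift-maxClustered a , Equivalence.to lift-av4231 b , Equivalence.to HAv-lift h)
                  (λ (a , b , h) → Equivalence.from lift-maxClustered a , Equivalence.from lift-av4231 b , Equivalence.from HAv-lift h)

  module MC-first = FirstPoint {MC} MC-resp id-MC MC-lift mc card-MC

  module FB-first = FirstPoint {FB} FB-resp id-FB FB-lift fb card-FB

  private
    abstract
     cut-split : ∀ m → ∃₂ λ a b → Card (Perms m ((FB ∩ Moves) ∩ (λ g → Cut g 1))) a × Card (Perms m N-FB) b × FB-first.n m ≡ a + b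
     cut-split m = Perms-split (FB ∩ Moves) (λ g → Cut g 1) (FB-first.card-n m) Cut-resp (cut? 1)

  n-FB : ℕ → ℕ
  n-FB m = proj₁ (proj₂ (cut-split m))

  card-N-FB : ∀ m → Card (Perms m N-FB) (n-FB m)
  card-N-FB m = proj₁ (proj₂ (proj₂ (proj₂ (cut-split m))))

  private
    MC-parts : ∀ {p m} {u : Permutation′ (suc p)} {v : Permutation′ (suc m)} {w : Permutation′ (suc (p + m))} → Glue p (ext u) (ext v) (ext w) →
              ext u p ≢ p → ext v 0 ≢ 0 → MC (ext w) → FirstCut p (ext w) → FC (ext u) × N-MC (ext v)
    MC-parts {u = u} {v} {w} G up≢ v0≢ (mcw , hw) (_ , nc) =
      let (avu , mcv) = GP.maxClustered⇒ {u = u} {v} {w} G up≢ v0≢ (ext-Inv w) mcw nc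
          (hu , hv) = HAv-parts {u = u} {v} {w} G up≢ v0≢ hw
      in (avu , hu) , (mcv , hv) , v0≢

    MC-whole : ∀ {p m} {u : Permutation′ (suc p)} {v : Permutation′ (suc m)} {w : Permutation′ (suc (p + m))} → Glue p (ext u) (ext v) (ext w) →
              ext u p ≢ p → FC (ext u) → N-MC (ext v) → MC (ext w) × FirstCut p (ext w)
    MC-whole {u = u} {v} {w} G up≢ (avu , hu) ((mcv , hv) , v0≢) =
      (GP.maxClustered⇐ {u = u} {v} {w} G up≢ v0≢ avu mcv , HAv-whole {u = u} {v} {w} G up≢ v0≢ hu hv) ,
      GP.firstCut {u = u} {v} {w} G up≢ v0≢ avu

    MC-no-cut : ∀ {m} {w : Permutation′ (suc m)} → MC (ext w) → (∀ {p} → ¬ Cut (ext w) p) → FC (ext w)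
    MC-no-cut {w = w} (mcw , hw) nc = av321 {w = w} mcw nc , hw

    FC⇒MC : ∀ {m} {w : Permutation′ (suc m)} → FC (ext w) → MC (ext w) × (∀ {p} → ¬ Cut (ext w) p)
    FC⇒MC (av , hw) = (av321⇒maxClustered av , hw) , no-321 av

    FB-parts : ∀ {p m} {u : Permutation′ (suc p)} {v : Permutation′ (suc m)} {w : Permutation′ (suc (p + m))} → Glue p (ext u) (ext v) (ext w) →
              ext u p ≢ p → ext v 0 ≢ 0 → FB (ext w) → FirstCut p (ext w) → FC (ext u) × N-FB (ext v)
    FB-parts {u = u} {v} {w} G up≢ v0≢ (mcw , a4 , hw) first =
      let (fcu , (mcv , hv) , _) = MC-parts {u = u} {v} {w} G up≢ v0≢ (mcw , hw) first
          (a4v , nc1) = GP.av4231⇒ {u = u} {v} {w} G up≢ v0≢ a4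
      in fcu , ((mcv , a4v , hv) , v0≢) , nc1

    FB-whole : ∀ {p m} {u : Permutation′ (suc p)} {v : Permutation′ (suc m)} {w : Permutation′ (suc (p + m))} → Glue p (ext u) (ext v) (ext w) →
              ext u p ≢ p → FC (ext u) → N-FB (ext v) → FB (ext w) × FirstCut p (ext w)
    FB-whole {u = u} {v} {w} G up≢ (avu , hu) (((mcv , a4v , hv) , v0≢) , nc1) =
      let ((mcw , hw) , first) = MC-whole {u = u} {v} {w} G up≢ (avu , hu) ((mcv , hv) , v0≢)
      in (mcw , GP.av4231⇐ {u = u} {v} {w} G up≢ v0≢ avu mcv a4v nc1 , hw) , first

    FB-no-cut : ∀ {m} {w : Permutation′ (suc m)} → FB (ext w) → (∀ {p} → ¬ Cut (ext w) p) → FC (ext w)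
    FB-no-cut {w = w} (mcw , _ , hw) = MC-no-cut {w = w} (mcw , hw)

    FC⇒FB : ∀ {m} {w : Permutation′ (suc m)} → FC (ext w) → FB (ext w) × (∀ {p} → ¬ Cut (ext w) p)
    FC⇒FB (av , hw) = (av321⇒maxClustered av , av321⇒av4231 av , hw) , no-321 av

  module MC-rec = Recurrence {FC} {N-MC} {MC} (λ {p} {m} {u} {v} {w} → MC-parts {p} {m} {u} {v} {w}) (λ {p} {m} {u} {v} {w} → MC-whole {p} {m} {u} {v} {w})
    proj₂ (λ {m} {w} → MC-no-cut {m} {w}) (λ {m} {w} → FC⇒MC {m} {w}) mc f l MC-first.n card-MC card-FC card-L MC-first.card-n

  module FB-rec = Recurrence {FC} {N-FB} {FB} (λ {p} {m} {u} {v} {w} → FB-parts {p} {m} {u} {v} {w}) (λ {p} {m} {u} {v} {w} → FB-whole {p} {m} {u} {v} {w})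
    (proj₂ ∘ proj₁) (λ {m} {w} → FB-no-cut {m} {w}) (λ {m} {w} → FC⇒FB {m} {w}) fb f l n-FB card-FB card-FC card-L card-N-FB

  n-split-zero : FB-first.n 0 ≡ n-FB 0
  n-split-zero = let (a , b , card-a , _ , eq) = cut-split 0
                 in trans eq (cong (_+ b) (Perms-unique ((FB ∩ Moves) ∩ (λ g → Cut g 1)) card-a (Card-empty λ (w , _ , c) → n≮0 (cut-bound {w = w} c))))

  -- A cut at 1 is automatically the first one, since nothing can pass the point 0 from below. The
  -- fibre over it pairs an avoider on two points, counted by `l 1`, with an element of `N-FB`.
  n-split-suc : ∀ m → FB-first.n (suc m) ≡ l 1 * n-FB m + n-FB (suc m)
  n-split-suc m = let (a , b , card-a , _ , eq) = cut-split (suc m)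
                  in trans eq (cong (_+ b) (Perms-unique ((FB ∩ Moves) ∩ (λ g → Cut g 1)) card-a (Perms-map ((FB ∩ Moves) ∩ (λ g → Cut g 1)) (FB ∩ FirstCut 1)
                       (λ w ((t , _) , c) → t , c , λ {q} → first {ext w} {q}) (λ w (t , c , _) → (t , moves c) , c) (FB-rec.card-firstCut 1 (s≤s z≤n)))))
    where
    first : ∀ {g} → NoCutBelow 1 g
    first {g} {q} q<1 c = n≮0 (<-≤-trans (Cut.x<p c) (s≤s⁻¹ q<1))
    moves : ∀ {g} → Cut g 1 → g 0 ≢ 0
    moves {g} c g0 = n≮0 (subst (1 <_) (trans (cong g (n<1⇒n≡0 (Cut.x<p c))) g0) (Cut.p<wx c))

  -- If `l m` is positive, some avoider is not the identity. It contains the one-column heap, so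
  -- this is not forbidden and the transposition on two points is an avoider, the only one that
  -- moves its last point.
  l-one : ∀ m → l 1 * l m ≡ l m
  l-one m with l m | card-L m
  ... | zero  | _    = *-zeroʳ (l 1)
  ... | suc n | card = trans (cong (_* suc n) l1≡1) (*-identityˡ (suc n))
    where
    u = Inverse.from card zero
    hs : HAv (swap 0)
    hs = with-adm (λ {(_ , h)} a ¬c c → ¬c (contains-swap⇒ (zero-letter {h = h} a) c (proj₁ (proj₂ (redWord-exists (proj₁ u)))) (proj₂ (proj₂ (redWord-exists (proj₁ u)))) (proj₂ (proj₂ u))))
           (proj₂ (proj₁ (proj₂ u)))
    swap-outside : ∀ {x} → 1 < x → swap 0 x ≡ x
    swap-outside = swap-above
    S = mkPerm {1} (inverses (swap 0) (swap-involutive 0) (swap-involutive 0)) swap-outside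
    avs : Av321 (swap 0)
    avs {zero} {suc zero} {suc (suc z)} _ _ _ ()
    avs {zero} {suc (suc y)} {_} _ _ (s≤s ()) _
    avs {suc x} {suc zero} {_} (s≤s ()) _ _ _
    avs {suc zero} {suc (suc y)} {_} _ _ () _
    avs {suc (suc x)} {suc (suc y)} {_} x<y _ yx _ = <-asym x<y yx
    only : (w : Permutation′ 2) → ext w 1 ≢ 1 → ext w ≗ swap 0
    only w moves = λ { zero → at-0 ; (suc zero) → at-1 ; (suc (suc x)) → ext-outside w (s≤s (s≤s z≤n)) }
      where
      inside₁ = Bounded.inside (ext-Bounded w) {1} ≤-refl
      at-1 : ext w 1 ≡ 0
      at-1 = n≤0⇒n≡0 (s≤s⁻¹ (≤∧≢⇒< inside₁ moves))
      at-0 : ext w 0 ≡ 1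
      at-0 with ext w 0 in e | Bounded.inside (ext-Bounded w) {0} z≤n
      ... | zero | _ = contradiction (Bij.injective (ext-Bij w) {0} {1} (trans e (sym at-1))) λ ()
      ... | suc zero | _ = refl
      ... | suc (suc _) | s≤s ()
    l1≡1 : l 1 ≡ 1
    l1≡1 = Perms-unique (FC ∩ (λ g → g 1 ≢ 1)) (card-L 1) (mkIso (Perms 1 (FC ∩ (λ g → g 1 ≢ 1))) (setoid (Fin 1)) (λ _ → zero)
      (λ _ → proj₁ S , FC-resp (λ x → sym (proj₂ S x)) (avs , hs) , λ e → 1+n≢0 (sym (trans (sym (proj₂ S 1)) e)))
      (λ _ → refl) (λ _ _ → refl) (λ { zero → refl })
      (λ (w , _ , moves) x → trans (proj₂ S x) (sym (only w moves x))))

-- The ring of power series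

import Algebra.Solver.Ring
open import Algebra.Solver.Ring.AlmostCommutativeRing using (fromCommutativeRing; _-Raw-AlmostCommutative⟶_; Induced-equivalence)
open import Relation.Binary.Definitions using (WeaklyDecidable)
open import Data.Integer.Solver using (module +-*-Solver)

tail : Series → Series
tail f n = f (suc n)

scale : ℤ.ℤ → Series → Series
scale c f n = c ℤ.* f n

0ˢ 1ˢ : Series
0ˢ = constant ℤ.0ℤ
1ˢ = constant ℤ.1ℤ

-ˢ_ : Series → Series
(-ˢ f) n = ℤ.- f n

*ˢ-cong : ∀ {f f′ g g′} → f ≋ f′ → g ≋ g′ → f *ˢ g ≋ f′ *ˢ g′
*ˢ-cong {f} {f′} {g} {g′} ef eg n = sum-cong-≗ {suc n} λ i → cong₂ ℤ._*_ (ef (toℕ i)) (eg (n ∸ toℕ i))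

*ˢ-zeroˡ : ∀ f → 0ˢ *ˢ f ≋ 0ˢ
*ˢ-zeroˡ f zero    = refl
*ˢ-zeroˡ f (suc n) = trans (ℤ.+-identityˡ _) (trans (*ˢ-cong {tail 0ˢ} {0ˢ} {f} {f} (λ { zero → refl ; (suc _) → refl }) (λ _ → refl) n)
  (trans (*ˢ-zeroˡ f n) (zeros n)))
  where
  zeros : ∀ n → 0ˢ n ≡ ℤ.0ℤ
  zeros zero    = refl
  zeros (suc _) = refl

scale-*ˢ : ∀ c f g → scale c f *ˢ g ≋ scale c (f *ˢ g)
scale-*ˢ c f g zero    = solve 3 (λ c f g → c :* f :* g :+ con ℤ.0ℤ := c :* (f :* g :+ con ℤ.0ℤ)) refl c (f 0) (g 0)
  where open +-*-Solver
scale-*ˢ c f g (suc n) = trans (cong₂ ℤ._+_ (ℤ.*-assoc c (f 0) (g (suc n))) (scale-*ˢ c (tail f) g n)) (sym (ℤ.*-distribˡ-+ c _ _))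

constant-*ˢ : ∀ c f → constant c *ˢ f ≋ scale c f
constant-*ˢ c f zero    = ℤ.+-identityʳ _
constant-*ˢ c f (suc n) = trans (cong (λ z → c ℤ.* f (suc n) ℤ.+ z) (trans (*ˢ-cong {tail (constant c)} {0ˢ} {f} {f} (λ { zero → refl ; (suc _) → refl }) (λ _ → refl) n)
  (trans (*ˢ-zeroˡ f n) (zeros n)))) (ℤ.+-identityʳ _)
  where
  zeros : ∀ n → 0ˢ n ≡ ℤ.0ℤ
  zeros zero    = refl
  zeros (suc _) = refl

*ˢ-distribʳ : ∀ h f g → (f +ˢ g) *ˢ h ≋ f *ˢ h +ˢ g *ˢ h
*ˢ-distribʳ h f g zero = solve 3 (λ f g h → (f :+ g) :* h :+ con ℤ.0ℤ := (f :* h :+ con ℤ.0ℤ) :+ (g :* h :+ con ℤ.0ℤ)) refl (f 0) (g 0) (h 0)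
  where open +-*-Solver
*ˢ-distribʳ h f g (suc n) = trans (cong (λ z → (f 0 ℤ.+ g 0) ℤ.* h (suc n) ℤ.+ z) (*ˢ-distribʳ h (tail f) (tail g) n))
  (solve 5 (λ f g h x y → (f :+ g) :* h :+ (x :+ y) := (f :* h :+ x) :+ (g :* h :+ y)) refl (f 0) (g 0) (h (suc n)) ((tail f *ˢ h) n) ((tail g *ˢ h) n))
  where open +-*-Solver

-- The definition of the product peels off the first term of the convolution; commutativity needs
-- the last term peeled off as well.
*ˢ-last : ∀ f g n → (f *ˢ g) (suc n) ≡ f (suc n) ℤ.* g 0 ℤ.+ (f *ˢ tail g) n
*ˢ-last f g zero    = solve 4 (λ a b c d → a :* b :+ (c :* d :+ con ℤ.0ℤ) := c :* d :+ (a :* b :+ con ℤ.0ℤ)) refl (f 0) (g 1) (f 1) (g 0)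
  where open +-*-Solver
*ˢ-last f g (suc n) = trans (cong (λ z → f 0 ℤ.* g (suc (suc n)) ℤ.+ z) (*ˢ-last (tail f) g n))
  (solve 3 (λ a b c → a :+ (b :+ c) := b :+ (a :+ c)) refl (f 0 ℤ.* g (suc (suc n))) (f (suc (suc n)) ℤ.* g 0) ((tail f *ˢ tail g) n))
  where open +-*-Solver

*ˢ-comm : ∀ f g → f *ˢ g ≋ g *ˢ f
*ˢ-comm f g zero    = cong (ℤ._+ ℤ.0ℤ) (ℤ.*-comm (f 0) (g 0))
*ˢ-comm f g (suc n) = trans (cong₂ ℤ._+_ (ℤ.*-comm (f 0) (g (suc n))) (*ˢ-comm (tail f) g n)) (sym (*ˢ-last g f n))

*ˢ-assoc : ∀ f g h → (f *ˢ g) *ˢ h ≋ f *ˢ (g *ˢ h)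
*ˢ-assoc f g h zero    = solve 3 (λ a b c → (a :* b :+ con ℤ.0ℤ) :* c :+ con ℤ.0ℤ := a :* (b :* c :+ con ℤ.0ℤ) :+ con ℤ.0ℤ) refl (f 0) (g 0) (h 0)
  where open +-*-Solver
*ˢ-assoc f g h (suc n) = begin
  (f 0 ℤ.* g 0 ℤ.+ ℤ.0ℤ) ℤ.* h (suc n) ℤ.+ (tail (f *ˢ g) *ˢ h) n
    ≡⟨ cong (λ z → (f 0 ℤ.* g 0 ℤ.+ ℤ.0ℤ) ℤ.* h (suc n) ℤ.+ z) (trans (*ˢ-distribʳ h (scale (f 0) (tail g)) (tail f *ˢ g) n)
         (cong₂ ℤ._+_ (scale-*ˢ (f 0) (tail g) h n) (*ˢ-assoc (tail f) g h n))) ⟩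
  (f 0 ℤ.* g 0 ℤ.+ ℤ.0ℤ) ℤ.* h (suc n) ℤ.+ (f 0 ℤ.* (tail g *ˢ h) n ℤ.+ (tail f *ˢ (g *ˢ h)) n)
    ≡⟨ solve 5 (λ a b c d e → (a :* b :+ con ℤ.0ℤ) :* c :+ (a :* d :+ e) := a :* (b :* c :+ d) :+ e) refl
         (f 0) (g 0) (h (suc n)) ((tail g *ˢ h) n) ((tail f *ˢ (g *ˢ h)) n) ⟩
  f 0 ℤ.* (g *ˢ h) (suc n) ℤ.+ (tail f *ˢ (g *ˢ h)) n ∎
  where
  open ≡-Reasoning
  open +-*-Solver

*ˢ-identityˡ : ∀ f → 1ˢ *ˢ f ≋ f
*ˢ-identityˡ f n = trans (constant-*ˢ ℤ.1ℤ f n) (ℤ.*-identityˡ (f n))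

X-*ˢ-suc : ∀ f n → (X *ˢ f) (suc n) ≡ f n
X-*ˢ-suc f n = trans (ℤ.+-identityˡ _) (trans (*ˢ-cong {tail X} {1ˢ} {f} {f} (λ { zero → refl ; (suc _) → refl }) (λ _ → refl) n) (*ˢ-identityˡ f n))

seriesRing : CommutativeRing 0ℓ 0ℓ
seriesRing = record
  { Carrier = Series ; _≈_ = _≋_ ; _+_ = _+ˢ_ ; _*_ = _*ˢ_ ; -_ = -ˢ_ ; 0# = 0ˢ ; 1# = 1ˢ
  ; isCommutativeRing = record
    { isRing = record
      { +-isAbelianGroup = record
        { isGroup = record
          { isMonoid = record
            { isSemigroup = record
              { isMagma = record
                { isEquivalence = record { refl = λ _ → refl ; sym = λ e n → sym (e n) ; trans = λ e e′ n → trans (e n) (e′ n) }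
                ; ∙-cong = λ e e′ n → cong₂ ℤ._+_ (e n) (e′ n) }
              ; assoc = λ f g h n → ℤ.+-assoc (f n) (g n) (h n) }
            ; identity = (λ f → λ { zero → ℤ.+-identityˡ _ ; (suc n) → ℤ.+-identityˡ _ }) , (λ f → λ { zero → ℤ.+-identityʳ _ ; (suc n) → ℤ.+-identityʳ _ }) }
          ; inverse = (λ f → λ { zero → ℤ.+-inverseˡ (f 0) ; (suc n) → ℤ.+-inverseˡ (f (suc n)) }) ,
                      (λ f → λ { zero → ℤ.+-inverseʳ (f 0) ; (suc n) → ℤ.+-inverseʳ (f (suc n)) })
          ; ⁻¹-cong = λ e n → cong ℤ.-_ (e n) }
        ; comm = λ f g n → ℤ.+-comm (f n) (g n) }
      ; *-cong = *ˢ-cong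
      ; *-assoc = *ˢ-assoc
      ; *-identity = *ˢ-identityˡ , λ f n → trans (*ˢ-comm f 1ˢ n) (*ˢ-identityˡ f n)
      ; distrib = (λ f g h n → trans (*ˢ-comm f (g +ˢ h) n) (trans (*ˢ-distribʳ f g h n) (cong₂ ℤ._+_ (*ˢ-comm g f n) (*ˢ-comm h f n)))) , *ˢ-distribʳ }
    ; *-comm = *ˢ-comm } }

private
  -- With integer coefficients the solver can compute with the constants 1 and 2 of the statement.
  ℤ-coefficients : CommutativeRing.rawRing ℤ.+-*-commutativeRing -Raw-AlmostCommutative⟶ fromCommutativeRing seriesRing
  ℤ-coefficients = record
    { ⟦_⟧ = constant
    ; +-homo = λ a b → λ { zero → refl ; (suc _) → refl }
    ; *-homo = λ a b n → sym (trans (constant-*ˢ a (constant b) n) (products a b n))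
    ; -‿homo = λ a → λ { zero → refl ; (suc _) → refl }
    ; 0-homo = λ _ → refl
    ; 1-homo = λ _ → refl }
    where
    products : ∀ a b → scale a (constant b) ≋ constant (a ℤ.* b)
    products a b zero    = refl
    products a b (suc _) = ℤ.*-zeroʳ a

  same-coefficient? : WeaklyDecidable (Induced-equivalence ℤ-coefficients)
  same-coefficient? a b with a ℤ.≟ b
  ... | yes refl = just λ _ → refl
  ... | no  _    = nothing

  module Solver = Algebra.Solver.Ring (CommutativeRing.rawRing ℤ.+-*-commutativeRing) (fromCommutativeRing seriesRing) ℤ-coefficients same-coefficient?

-- Solving for the generating functions

-- With L = (1-X)F - 1 one has M + X = (1-X)L, so T (A-X-M) = F (A-X-M) + L²
-- is equivalent to A (T-F) = L ((1-X)T - 1).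
module Solution (F T : Series) where
  open import Relation.Binary.Reasoning.Setoid (CommutativeRing.setoid seriesRing)

  L M : Series
  L = F -ˢ X *ˢ F -ˢ 1ˢ
  M = F -ˢ constant (ℤ.+ 2) *ˢ X *ˢ F +ˢ X *ˢ X *ˢ F -ˢ 1ˢ

  private
    module R = CommutativeRing seriesRing

    divide : ∀ D → D 0 ≡ ℤ.1ℤ → T *ˢ D ≋ F *ˢ D +ˢ L *ˢ L → T ≋ F +ˢ (L *ˢ L) /ˢ D
    divide D D₀ eq = begin
      T                                   ≈⟨ R.*-identityʳ T ⟨
      T *ˢ 1ˢ                             ≈⟨ R.*-congˡ {T} unit ⟨
      T *ˢ (D *ˢ I)                       ≈⟨ R.*-assoc T D I ⟨
      T *ˢ D *ˢ I                         ≈⟨ R.*-congʳ {I} eq ⟩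
      (F *ˢ D +ˢ L *ˢ L) *ˢ I             ≈⟨ R.distribʳ I (F *ˢ D) (L *ˢ L) ⟩
      F *ˢ D *ˢ I +ˢ L *ˢ L *ˢ I          ≈⟨ R.+-congʳ {L *ˢ L *ˢ I} (R.*-assoc F D I) ⟩
      F *ˢ (D *ˢ I) +ˢ L *ˢ L *ˢ I        ≈⟨ R.+-congʳ {L *ˢ L *ˢ I} (R.*-congˡ {F} unit) ⟩
      F *ˢ 1ˢ +ˢ L *ˢ L *ˢ I              ≈⟨ R.+-congʳ {L *ˢ L *ˢ I} (R.*-identityʳ F) ⟩
      F +ˢ L *ˢ L *ˢ I                    ∎
      where
      I = inverse D
      unit : D *ˢ I ≋ 1ˢ
      unit = inverse-correct D D₀

    K : Series
    K = T -ˢ X *ˢ T -ˢ 1ˢ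

    -- Both sides of each identity are multiples of the vanishing E.
    cancel : ∀ {P Q E} → P ≋ Q +ˢ E → E ≋ 0ˢ → P ≋ Q
    cancel {P} {Q} {E} eq e₀ = begin
      P         ≈⟨ eq ⟩
      Q +ˢ E    ≈⟨ R.+-congˡ {Q} e₀ ⟩
      Q +ˢ 0ˢ   ≈⟨ R.+-identityʳ Q ⟩
      Q         ∎

    difference : ∀ {P Q} → P ≋ Q → P -ˢ Q ≋ 0ˢ
    difference {P} {Q} eq = begin
      P -ˢ Q    ≈⟨ R.+-congʳ { -ˢ Q} eq ⟩
      Q -ˢ Q    ≈⟨ R.-‿inverseʳ Q ⟩
      0ˢ        ∎

  open Solver using (solve; con; _:+_; _:*_; _:-_; _:=_)

  solution₂ : T 0 ≡ ℤ.1ℤ → F 0 ≡ ℤ.1ℤ → ∀ N → T ≋ F +ˢ L *ˢ N → N ≋ K → T ≋ F +ˢ (L *ˢ L) /ˢ (1ˢ -ˢ X -ˢ M)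
  solution₂ T₀ F₀ N rec N≋K = divide (1ˢ -ˢ X -ˢ M) D₀ (cancel identity (difference (R.trans rec (R.+-congˡ {F} (R.*-congˡ {L} N≋K)))))
    where
    D₀ : (1ˢ -ˢ X -ˢ M) 0 ≡ ℤ.1ℤ
    D₀ rewrite F₀ = refl
    identity : T *ˢ (1ˢ -ˢ X -ˢ M) ≋ F *ˢ (1ˢ -ˢ X -ˢ M) +ˢ L *ˢ L +ˢ (T -ˢ (F +ˢ L *ˢ K))
    identity = solve 3 (λ t f x → let one = con ℤ.1ℤ
                                      l = f :- x :* f :- one
                                      m = f :- con (ℤ.+ 2) :* x :* f :+ x :* x :* f :- one
                                      d = one :- x :- m
                                  in t :* d := f :* d :+ l :* l :+ (t :- (f :+ l :* (t :- x :* t :- one)))) (λ _ → refl) T F X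

  -- The number `c` will be `l 1`. Multiplying by `L` absorbs it because `c` times `L` is `L`, so
  -- the values 0 and 1 of `c` are treated together.
  solution₁ : T 0 ≡ ℤ.1ℤ → F 0 ≡ ℤ.1ℤ → ∀ N c → T ≋ F +ˢ L *ˢ N → N +ˢ constant c *ˢ (X *ˢ N) ≋ K → constant c *ˢ L ≋ L →
              T ≋ F +ˢ (L *ˢ L) /ˢ (1ˢ -ˢ M)
  solution₁ T₀ F₀ N c rec N≋K cL≋L = divide (1ˢ -ˢ M) D₀ (cancel identity (difference scaled))
    where
    D₀ : (1ˢ -ˢ M) 0 ≡ ℤ.1ℤ
    D₀ rewrite F₀ = refl
    C = constant c
    scaled : (1ˢ +ˢ X) *ˢ T ≋ (1ˢ +ˢ X) *ˢ F +ˢ L *ˢ K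
    scaled = begin
      (1ˢ +ˢ X) *ˢ T                                         ≈⟨ R.*-congˡ {1ˢ +ˢ X} rec ⟩
      (1ˢ +ˢ X) *ˢ (F +ˢ L *ˢ N)                             ≈⟨ expand ⟩
      (1ˢ +ˢ X) *ˢ F +ˢ (L *ˢ N +ˢ L *ˢ (X *ˢ N))            ≈⟨ R.+-congˡ {(1ˢ +ˢ X) *ˢ F} (R.+-congˡ {L *ˢ N} (R.*-congʳ {X *ˢ N} cL≋L)) ⟨
      (1ˢ +ˢ X) *ˢ F +ˢ (L *ˢ N +ˢ C *ˢ L *ˢ (X *ˢ N))       ≈⟨ collect ⟩
      (1ˢ +ˢ X) *ˢ F +ˢ L *ˢ (N +ˢ C *ˢ (X *ˢ N))            ≈⟨ R.+-congˡ {(1ˢ +ˢ X) *ˢ F} (R.*-congˡ {L} N≋K) ⟩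
      (1ˢ +ˢ X) *ˢ F +ˢ L *ˢ K                               ∎
      where
      expand : (1ˢ +ˢ X) *ˢ (F +ˢ L *ˢ N) ≋ (1ˢ +ˢ X) *ˢ F +ˢ (L *ˢ N +ˢ L *ˢ (X *ˢ N))
      expand = solve 4 (λ f l x n → (con ℤ.1ℤ :+ x) :* (f :+ l :* n) := (con ℤ.1ℤ :+ x) :* f :+ (l :* n :+ l :* (x :* n))) (λ _ → refl) F L X N
      collect : (1ˢ +ˢ X) *ˢ F +ˢ (L *ˢ N +ˢ C *ˢ L *ˢ (X *ˢ N)) ≋ (1ˢ +ˢ X) *ˢ F +ˢ L *ˢ (N +ˢ C *ˢ (X *ˢ N))
      collect = solve 5 (λ a l c x n → a :+ (l :* n :+ c :* l :* (x :* n)) := a :+ l :* (n :+ c :* (x :* n))) (λ _ → refl) ((1ˢ +ˢ X) *ˢ F) L C X N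
    identity : T *ˢ (1ˢ -ˢ M) ≋ F *ˢ (1ˢ -ˢ M) +ˢ L *ˢ L +ˢ ((1ˢ +ˢ X) *ˢ T -ˢ ((1ˢ +ˢ X) *ˢ F +ˢ L *ˢ K))
    identity = solve 3 (λ t f x → let one = con ℤ.1ℤ
                                      l = f :- x :* f :- one
                                      m = f :- con (ℤ.+ 2) :* x :* f :+ x :* x :* f :- one
                                      d = one :- m
                                  in t :* d := f :* d :+ l :* l :+ ((one :+ x) :* t :- ((one :+ x) :* f :+ l :* (t :- x :* t :- one)))) (λ _ → refl) T F X

differences : ∀ (f l : ℕ → ℕ) → f 0 ≡ 1 → l 0 ≡ 0 → (∀ m → f (suc m) ≡ f m + l (suc m)) →
              let F = λ n → ℤ.+ f n in (λ n → ℤ.+ l n) ≋ F -ˢ X *ˢ F -ˢ 1ˢ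
differences f l f₀ l₀ f₊ zero    rewrite f₀ | l₀ = refl
differences f l f₀ l₀ f₊ (suc n) = sym (trans (cong₂ (λ a b → a ℤ.- b ℤ.- ℤ.0ℤ) (trans (cong ℤ.+_ (f₊ n)) (ℤ.pos-+ (f n) (l (suc n)))) (X-*ˢ-suc (λ n → ℤ.+ f n) n))
  (solve 2 (λ a b → a :+ b :- a :- con ℤ.0ℤ := b) refl (ℤ.+ f n) (ℤ.+ l (suc n))))
  where open +-*-Solver

open import Data.Integer using (+_; 1ℤ)

theorem2p4 :
  (H : HeapPatterns) →
  All (λ (k , h) → Connected h × FullyCommutative h × InternalColumns≥2 h × FullSupport h × k ≢ 2) H →
  let F = avoiderSeries ((3 , [321]) ∷ []) H
      L = F -ˢ X *ˢ F -ˢ constant 1ℤ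
      M = F -ˢ constant (+ 2) *ˢ X *ˢ F +ˢ X *ˢ X *ˢ F -ˢ constant 1ℤ
  in (avoiderSeries ((4 , [3421]) ∷ (4 , [4231]) ∷ (4 , [4312]) ∷ (4 , [4321]) ∷ []) H
        ≋ F +ˢ (L *ˢ L) /ˢ (constant 1ℤ -ˢ M))
     ×
     (avoiderSeries ((4 , [3421]) ∷ (4 , [4312]) ∷ (4 , [4321]) ∷ []) H
        ≋ F +ˢ (L *ˢ L) /ˢ (constant 1ℤ -ˢ X -ˢ M))
theorem2p4 H adm =
  Solution.solution₁ F (series fb) (cong ℤ.+_ FB-first.t-zero) (cong ℤ.+_ f-zero) (series n-FB) (+ l 1)
    (λ n → trans (FB-rec.recurrence n) (cong (λ z → F n ℤ.+ z) (*ˢ-cong {series l} {L} {series n-FB} {series n-FB} l≋L (λ _ → refl) n)))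
    (λ n → trans (sym (n-split n)) (differences fb FB-first.n FB-first.t-zero FB-first.n-zero FB-first.t-suc n))
    (λ n → trans (constant-*ˢ (+ l 1) L n) (trans (cong (λ z → + l 1 ℤ.* z) (sym (l≋L n)))
             (trans (sym (ℤ.pos-* (l 1) (l n))) (trans (cong ℤ.+_ (l-one n)) (l≋L n))))) ,
  Solution.solution₂ F (series mc) (cong ℤ.+_ MC-first.t-zero) (cong ℤ.+_ f-zero) (series MC-first.n)
    (λ n → trans (MC-rec.recurrence n) (cong (λ z → F n ℤ.+ z) (*ˢ-cong {series l} {L} {series MC-first.n} {series MC-first.n} l≋L (λ _ → refl) n)))
    (differences mc MC-first.n MC-first.t-zero MC-first.n-zero MC-first.t-suc)
  where
  open Counting H adm
  series : (ℕ → ℕ) → Series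
  series a n = + a n
  F L : Series
  F = series f
  L = F -ˢ X *ˢ F -ˢ 1ˢ
  l≋L : series l ≋ L
  l≋L = differences f l f-zero l-zero f-suc
  n-split : series FB-first.n ≋ series n-FB +ˢ constant (+ l 1) *ˢ (X *ˢ series n-FB)
  n-split zero    = trans (cong ℤ.+_ n-split-zero) (sym (trans (cong (λ z → + n-FB 0 ℤ.+ z) (trans (constant-*ˢ (+ l 1) (X *ˢ series n-FB) 0) (ℤ.*-zeroʳ (+ l 1)))) (ℤ.+-identityʳ _)))
  n-split (suc n) = trans (cong ℤ.+_ (n-split-suc n)) (trans (ℤ.pos-+ (l 1 * n-FB n) (n-FB (suc n))) (trans (ℤ.+-comm (+ (l 1 * n-FB n)) (+ n-FB (suc n)))
    (cong (λ z → + n-FB (suc n) ℤ.+ z) (trans (ℤ.pos-* (l 1) (n-FB n)) (sym (trans (constant-*ˢ (+ l 1) (X *ˢ series n-FB) (suc n)) (cong (λ z → + l 1 ℤ.* z) (X-*ˢ-suc (series n-FB) n))))))))
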